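{- Let $D\in\{2,3,4,6\}$, let $A$ be a rational number and $K$ a nonzero integer, and let $(v_n)_{n\ge0}$ be a sequence with $v_0,v_1\in\mathbb{Z}$ satisfying $(Dn+1)v_{n+1}=Anv_n-K(Dn-1)v_{n-1}$ for all $n\ge1$. Define $d_D(n)=\operatorname{lcm}(Dj+1)_{1\le j\le n}$ and $d_D^*(n)=d_D(n)/\prod_{p\in\mathcal{P}_n}p$, where $\mathcal{P}_n=\emptyset$ if $D=2$, and otherwise $\mathcal{P}_n$ is the set of primes $p$ with $\sqrt{2Dn}<p\le n$, $p\equiv-1\pmod D$, $p\ne D-1$, $p\nmid n+1$, $\{(n+1-1/D)/p\}\ge1/D$ and $\{(n+1/D)/p\}<1-1/D$. Then for every $n\ge1$: (i) If $A/K\in\mathbb{Z}$, then $d_D^*(n)K^{ -\lfloor(n+1)/2\rfloor}v_{n+1}\in\mathbb{Z}$. (ii) More generally, let $g$ be the denominator of $A/K$, and assume that all prime divisors of $g$ divide $D$, that $v_2(K)\ge2v_2(g)-2$, and that $v_p(K)\ge2v_p(g)-1$ for primes $p\ge3$. Then there exist arithmetic functions $e_p(n)$ (for primes $p\mid g$) with $e_p(n)=O(\log n)$ such that $\prod_{p\mid g}p^{e_p(n)}\,d_D^*(n)K^{ -\lfloor(n+1)/2\rfloor}v_{n+1}\in\mathbb{Z}$.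
   Context: $\{x\}=x-\lfloor x\rfloor$ is the fractional part; $v_p$ is the $p$-adic valuation. The paper writes the recurrence equivalently as $(n+B)v_{n+1}=Znv_n+K(B-n)v_{n-1}$ with $B=1/D$, $Z=A/D$. -}

module Defs where

open import Data.Bool using (Bool; true; false; if_then_else_; _∧_; not)
open import Data.Nat as ℕ using (ℕ; zero; suc; NonZero; _≡ᵇ_; _<ᵇ_)
open import Data.Nat.Properties using (m*n≢0)
open import Data.Nat.LCM using (lcm)
open import Data.Nat.Divisibility using (_∣?_)
open import Data.Nat.Primality using (prime?)
open import Data.Integer as ℤ using (ℤ; +_)
open import Data.Integer.Properties as ℤP using ()
open import Data.Integer.GCD using (gcd)
open import Data.Rational as ℚ using (ℚ; _/_; 0ℚ; 1ℚ; floor; 1/_; ↥_)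
open import Data.Rational.Properties as ℚP using (↥-/)
open import Data.List using (List; applyUpTo; foldr)
open import Data.Nat.ListAction using (product)
open import Data.Product using (∃)
open import Relation.Nullary.Decidable using (isYes)
open import Relation.Binary.PropositionalEquality using (_≡_; _≢_; refl; sym; trans; cong)

ιℕ : ℕ → ℚ
ιℕ m = + m / 1

ιℤ : ℤ → ℚ
ιℤ z = z / 1

IsInt : ℚ → Set
IsInt q = ∃ λ (z : ℤ) → q ≡ ιℤ z

frac : ℚ → ℚ
frac q = ℚ._-_ q (ιℤ (floor q))

_^ℚ_ : ℚ → ℕ → ℚ
q ^ℚ zero = 1ℚ
q ^ℚ suc m = ℚ._*_ q (q ^ℚ m)

ιℤ-nonZero : (K : ℤ) → K ≢ ℤ.0ℤ → ℚ.NonZero (ιℤ K)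
ιℤ-nonZero K K≢0 = ℚ.≢-nonZero {ιℤ K} λ eq →
  K≢0 (trans (sym (↥-/ K 1)) (trans (cong (λ q → ℤ._*_ (↥ q) (gcd K (+ 1))) eq)
        (ℤP.*-zeroˡ (gcd K (+ 1)))))

invℤ : (K : ℤ) → K ≢ ℤ.0ℤ → ℚ
invℤ K K≢0 = 1/_ (ιℤ K) {{ιℤ-nonZero K K≢0}}

dD : ℕ → ℕ → ℕ
dD D n = foldr lcm 1 (applyUpTo (λ k → ℕ._+_ (ℕ._*_ D (suc k)) 1) n)

-- p ∈ 𝒫_n  (as a boolean), for D ≠ 2:
--   √(2Dn) < p  (i.e. 2Dn < p²),  p ≤ n (handled by the range of p),
--   p prime, p ≡ -1 (mod D), p ≠ D - 1, p ∤ n + 1,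
--   {(n+1-1/D)/p} ≥ 1/D  and  {(n+1/D)/p} < 1 - 1/D.
inP : (D : ℕ) .{{_ : NonZero D}} → ℕ → (p : ℕ) .{{_ : NonZero p}} → Bool
inP D n p =
  not (D ≡ᵇ 2)
  ∧ (ℕ._*_ (ℕ._*_ 2 D) n <ᵇ ℕ._*_ p p)
  ∧ isYes (prime? p)
  ∧ isYes (D ∣? ℕ._+_ p 1)
  ∧ not (p ≡ᵇ ℕ._∸_ D 1)
  ∧ not (isYes (p ∣? ℕ._+_ n 1))
  ∧ isYes ((+ 1 / D) ℚP.≤? frac (ℚ._*_ (ℚ._-_ (ιℕ (ℕ._+_ n 1)) (+ 1 / D)) (+ 1 / p)))
  ∧ isYes (frac (ℚ._*_ (ℚ._+_ (ιℕ n) (+ 1 / D)) (+ 1 / p)) ℚP.<? ℚ._-_ 1ℚ (+ 1 / D))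

PFactor : (D : ℕ) .{{_ : NonZero D}} → ℕ → ℕ → ℕ
PFactor D n k = if inP D n (suc k) then suc k else 1

PFactor-nonZero : (D : ℕ) .{{_ : NonZero D}} → (n k : ℕ) → NonZero (PFactor D n k)
PFactor-nonZero D n k with inP D n (suc k)
... | true = _
... | false = _

prodP : (D : ℕ) .{{_ : NonZero D}} → ℕ → ℕ
prodP D n = product (applyUpTo (PFactor D n) n)

product-nonZero : (f : ℕ → ℕ) → (∀ k → NonZero (f k)) → ∀ m → NonZero (product (applyUpTo f m))
product-nonZero f nz zero = _
product-nonZero f nz (suc m) =
  m*n≢0 (f 0) _ {{nz 0}} {{product-nonZero (λ k → f (suc k)) (λ k → nz (suc k)) m}}

dStar : (D : ℕ) .{{_ : NonZero D}} → ℕ → ℚ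
dStar D n = ℚ._*_ (ιℕ (dD D n))
  (_/_ (+ 1) (prodP D n) {{product-nonZero (PFactor D n) (PFactor-nonZero D n) n}})

primeDivProd : ℕ → (ℕ → ℕ) → ℕ
primeDivProd g e = product (applyUpTo
  (λ k → if isYes (prime? (suc k)) ∧ isYes (suc k ∣? g) then ℕ._^_ (suc k) (e (suc k)) else 1) g)

{-# OPTIONS --safe #-}
module Submission where

-- The recurrence is a first-order differential equation for the generating function of s_n = v_(n+1).
-- With Q = 1 - (A/D) x + K x², its operator maps x^j Q^-(j+1) to (D j + 1) (1 - K x²) x^j Q^-(j+1); hence s
-- expands in the series x^j Q^-(j+1), and the only denominators of the coefficients are the numbers D j + 1.
-- For primes p ∤ D the coefficients of Q^-(j+1) are p-integral and divisible by the expected powers of K.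
-- If moreover p ∈ 𝒫_n, the coefficients that meet a denominator D j + 1 divisible by p vanish modulo p.
-- For primes p ∣ D every D j + 1 is a p-unit, and the series x^j (1 + K x²)^-(j+1) are used instead. The operator
-- maps them to (1 - K x²) ((D j + 1) x^j (1 + K x²)^-(j+1) - (j + 1) A x^(j+1) (1 + K x²)^-(j+2)), so the
-- coefficients contain products (j + 1) ⋯ (j + d) A^d, in which the valuation of d! makes up for the
-- denominator of A^d / K^(d/2), up to an error of size O(log n).

open import Defs
open import Data.Bool using (true; false; if_then_else_; _∧_; not)
open import Data.Empty using (⊥-elim)
open import Data.Integer as ℤ using (ℤ; +_; 0ℤ; 1ℤ; ∣_∣)
import Data.Integer.DivMod as ℤD
import Data.Integer.Properties as ℤP
import Data.Integer.Solver as ℤS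
open import Data.List using ([]; _∷_; applyUpTo; foldr)
open import Data.List.Relation.Unary.All using (_∷_)
open import Data.Nat as ℕ using (ℕ; zero; suc; _+_; _*_; _∸_; _^_; _!; _≤_; _<_; NonZero; ⌊_/2⌋; ⌈_/2⌉; z≤n; s≤s; z<s)
open import Data.Nat.Combinatorics using (_C_; nCk≡n!/k![n-k]!; k![n∸k]!∣n!)
import Data.Nat.Coprimality as Coprimality
open import Data.Nat.DivMod using (_/_; _%_; m≡m%n+[m/n]*n; m%n<n; m/n*n≡m; [m+kn]%n≡m%n; m<n⇒m%n≡m; +-distrib-/-∣ˡ)
open import Data.Nat.Divisibility
open import Data.Nat.Induction using (<-rec)
open import Data.Nat.LCM using (lcm; m∣lcm[m,n]; n∣lcm[m,n])
open import Data.Nat.ListAction using (product)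
open import Data.Nat.Logarithm using (⌊log₂_⌋; ⌊log₂⌋-mono-≤; ⌊log₂[2*b]⌋≡1+⌊log₂b⌋; ⌊log₂[2^n]⌋≡n)
open import Data.Nat.Primality using (Prime; prime?; prime[2]; euclidsLemma; prime⇒nonTrivial; prime⇒nonZero; prime⇒irreducible)
open import Data.Nat.Primality.Factorisation using (factorise)
import Data.Nat.Properties as ℕP
import Data.Nat.Solver as ℕS
open import Data.Product using (_×_; _,_; ∃; ∃₂; proj₁; proj₂)
open import Data.Rational as ℚ using (ℚ; 0ℚ; 1ℚ; ↥_; ↧_; ↧ₙ_; mkℚ; toℚᵘ; floor)
  renaming (_+_ to _⊕_; _*_ to _⊗_; _-_ to _⊖_; -_ to ⊝_)
import Data.Rational.Properties as ℚP
import Data.Rational.Solver as ℚS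
open import Data.Rational.Unnormalised as ℚᵘ using (mkℚᵘ; *≡*; *≤*; *<*)
import Data.Rational.Unnormalised.Properties as ℚᵘP
open import Data.Sum using (_⊎_; inj₁; inj₂; [_,_]′)
open import Function using (id)
open import Relation.Binary.PropositionalEquality
open import Relation.Nullary using (¬_; Dec; yes; no)
open import Relation.Nullary.Decidable using (isYes; from-yes)

-- Denominators do not multiply up in the first basis. If (D j + 1) c = ρ, then removing c x^j
-- Q^-(j+1) from s changes the right-hand side by ρ (1 - K x²) x^j Q^-(j+1), where D j + 1 has
-- cancelled again; so each coefficient meets a single denominator, and an lcm suffices. The
-- exponent ⌊(n+1)/2⌋ = ⌈n/2⌉ comes from the monomials X^i K^k with i + 2k = l and X = A/D: if X/K
-- is p-integral, they carry i + k ≥ ⌈l/2⌉ factors K. The obstacle is that this needs p ∤ D and A/K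
-- integral at p. In the second basis the denominators do accumulate, but at p ∣ D they are units.
-- The hypothesis on g puts every p ∣ g into this second case, with p = 2 or p = 3. There A²/K = K
-- (A/K)² has valuation at least -f with f = 2 or f = 1 respectively, and d! supplies about f ⌊d/2⌋
-- factors p; this is the origin of the constants 2 and 1 in the hypotheses on v_p(K).

-- Binomial and trinomial coefficients.

C*!*! : ∀ a b → ((a + b) C b) * (a ! * b !) ≡ (a + b) !
C*!*! a b = begin
  ((a + b) C b) * (a ! * b !)              ≡⟨ cong₂ _*_ (nCk≡n!/k![n-k]! b≤) (trans (ℕP.*-comm (a !) (b !)) (cong (λ z → b ! * z !) (sym (ℕP.m+n∸n≡m a b)))) ⟩
  (a + b) ! / (b ! * (a + b ∸ b) !) * (b ! * (a + b ∸ b) !)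
                                           ≡⟨ m/n*n≡m (k![n∸k]!∣n! b≤) ⟩
  (a + b) !                                ∎
  where
  open ≡-Reasoning
  b≤ : b ≤ a + b
  b≤ = ℕP.m≤n+m b a
  instance
    nz : NonZero (b ! * (a + b ∸ b) !)
    nz = ℕP.m*n≢0 (b !) _ {{b ℕP.!≢0}} {{(a + b ∸ b) ℕP.!≢0}}

C-absorb : ∀ a b → suc b * ((a + suc b) C suc b) ≡ (a + suc b) * ((a + b) C b)
C-absorb a b = ℕP.*-cancelʳ-≡ _ _ (a ! * b !) {{ℕP.m*n≢0 (a !) (b !) {{a ℕP.!≢0}} {{b ℕP.!≢0}}}} (begin
  suc b * ((a + suc b) C suc b) * (a ! * b !)   ≡⟨ solve 4 (λ s c x y → s :* c :* (x :* y) := c :* (x :* (s :* y))) refl (suc b) ((a + suc b) C suc b) (a !) (b !) ⟩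
  ((a + suc b) C suc b) * (a ! * (suc b) !)     ≡⟨ C*!*! a (suc b) ⟩
  (a + suc b) !                                 ≡⟨ cong _! (ℕP.+-suc a b) ⟩
  suc (a + b) * (a + b) !                       ≡⟨ cong₂ _*_ (ℕP.+-suc a b) (C*!*! a b) ⟨
  (a + suc b) * (((a + b) C b) * (a ! * b !))   ≡⟨ ℕP.*-assoc (a + suc b) _ _ ⟨
  (a + suc b) * ((a + b) C b) * (a ! * b !)     ∎)
  where
  open ≡-Reasoning
  open ℕS.+-*-Solver

abstract
  -- The multinomial coefficient (j+i+k)! / (j! i! k!), which is the coefficient of X^i Y^k in (1 -
  -- X - Y)^-(j+1). The form as a product of two binomials exposes the two factors to which Lucas'
  -- theorem is applied later.
  trinom : ℕ → ℕ → ℕ → ℕ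
  trinom j i k = ((j + (i + k)) C (i + k)) * ((i + k) C k)

  trinom*! : ∀ j i k → trinom j i k * (j ! * (i ! * k !)) ≡ (j + (i + k)) !
  trinom*! j i k = begin
    trinom j i k * (j ! * (i ! * k !))
      ≡⟨ solve 5 (λ a b x y z → a :* b :* (x :* (y :* z)) := a :* (x :* (b :* (y :* z)))) refl
           ((j + (i + k)) C (i + k)) ((i + k) C k) (j !) (i !) (k !) ⟩
    ((j + (i + k)) C (i + k)) * (j ! * (((i + k) C k) * (i ! * k !)))
      ≡⟨ cong (λ z → ((j + (i + k)) C (i + k)) * (j ! * z)) (C*!*! i k) ⟩
    ((j + (i + k)) C (i + k)) * (j ! * (i + k) !)  ≡⟨ C*!*! j (i + k) ⟩
    (j + (i + k)) !                                ∎
    where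
    open ≡-Reasoning
    open ℕS.+-*-Solver

  trinom-0 : ∀ j → trinom j 0 0 ≡ 1
  trinom-0 j = refl

  C∣trinom : ∀ j i k → (j + (i + k)) C (i + k) ∣ trinom j i k
  C∣trinom j i k = m∣m*n _

  C∣trinom′ : ∀ j i k → (i + k) C k ∣ trinom j i k
  C∣trinom′ j i k = n∣m*n ((j + (i + k)) C (i + k))

private
  fact³≢0 : ∀ j i k → NonZero (j ! * (i ! * k !))
  fact³≢0 j i k = ℕP.m*n≢0 (j !) _ {{j ℕP.!≢0}} {{ℕP.m*n≢0 (i !) (k !) {{i ℕP.!≢0}} {{k ℕP.!≢0}}}}

trinom-sucⁱ : ∀ j i k → suc i * trinom j (suc i) k ≡ suc (j + (i + k)) * trinom j i k
trinom-sucⁱ j i k = ℕP.*-cancelʳ-≡ _ _ (j ! * (i ! * k !)) {{fact³≢0 j i k}} (begin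
  suc i * trinom j (suc i) k * (j ! * (i ! * k !))
    ≡⟨ solve 5 (λ s c x y z → s :* c :* (x :* (y :* z)) := c :* (x :* (s :* y :* z))) refl (suc i) (trinom j (suc i) k) (j !) (i !) (k !) ⟩
  trinom j (suc i) k * (j ! * ((suc i) ! * k !))   ≡⟨ trinom*! j (suc i) k ⟩
  (j + suc (i + k)) !                              ≡⟨ cong _! (ℕP.+-suc j (i + k)) ⟩
  suc (j + (i + k)) * (j + (i + k)) !              ≡⟨ cong (suc (j + (i + k)) *_) (trinom*! j i k) ⟨
  suc (j + (i + k)) * (trinom j i k * (j ! * (i ! * k !)))  ≡⟨ ℕP.*-assoc (suc (j + (i + k))) (trinom j i k) (j ! * (i ! * k !)) ⟨
  suc (j + (i + k)) * trinom j i k * (j ! * (i ! * k !)) ∎)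
  where
  open ≡-Reasoning
  open ℕS.+-*-Solver

trinom-sucᵏ : ∀ j i k → suc k * trinom j i (suc k) ≡ suc (j + (i + k)) * trinom j i k
trinom-sucᵏ j i k = ℕP.*-cancelʳ-≡ _ _ (j ! * (i ! * k !)) {{fact³≢0 j i k}} (begin
  suc k * trinom j i (suc k) * (j ! * (i ! * k !))
    ≡⟨ solve 5 (λ s c x y z → s :* c :* (x :* (y :* z)) := c :* (x :* (y :* (s :* z)))) refl (suc k) (trinom j i (suc k)) (j !) (i !) (k !) ⟩
  trinom j i (suc k) * (j ! * (i ! * (suc k) !))   ≡⟨ trinom*! j i (suc k) ⟩
  (j + (i + suc k)) !                              ≡⟨ cong _! (trans (cong (λ z → j + z) (ℕP.+-suc i k)) (ℕP.+-suc j (i + k))) ⟩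
  suc (j + (i + k)) * (j + (i + k)) !              ≡⟨ cong (suc (j + (i + k)) *_) (trinom*! j i k) ⟨
  suc (j + (i + k)) * (trinom j i k * (j ! * (i ! * k !)))  ≡⟨ ℕP.*-assoc (suc (j + (i + k))) (trinom j i k) (j ! * (i ! * k !)) ⟨
  suc (j + (i + k)) * trinom j i k * (j ! * (i ! * k !)) ∎)
  where
  open ≡-Reasoning
  open ℕS.+-*-Solver

trinom-sucʲ : ∀ j i k → suc j * trinom (suc j) i k ≡ suc (j + (i + k)) * trinom j i k
trinom-sucʲ j i k = ℕP.*-cancelʳ-≡ _ _ (j ! * (i ! * k !)) {{fact³≢0 j i k}} (begin
  suc j * trinom (suc j) i k * (j ! * (i ! * k !))
    ≡⟨ solve 5 (λ s c x y z → s :* c :* (x :* (y :* z)) := c :* (s :* x :* (y :* z))) refl (suc j) (trinom (suc j) i k) (j !) (i !) (k !) ⟩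
  trinom (suc j) i k * ((suc j) ! * (i ! * k !))   ≡⟨ trinom*! (suc j) i k ⟩
  suc (j + (i + k)) * (j + (i + k)) !              ≡⟨ cong (suc (j + (i + k)) *_) (trinom*! j i k) ⟨
  suc (j + (i + k)) * (trinom j i k * (j ! * (i ! * k !)))  ≡⟨ ℕP.*-assoc (suc (j + (i + k))) (trinom j i k) (j ! * (i ! * k !)) ⟨
  suc (j + (i + k)) * trinom j i k * (j ! * (i ! * k !)) ∎)
  where
  open ≡-Reasoning
  open ℕS.+-*-Solver

-- Multiplication of the generating series of `c` by X and by Y.
shiftⁱ shiftᵏ : (ℕ → ℕ → ℕ) → ℕ → ℕ → ℕ
shiftⁱ c zero    k = 0
shiftⁱ c (suc i) k = c i k
shiftᵏ c i zero    = 0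
shiftᵏ c i (suc k) = c i k

private
  shiftⁱ-trinom : ∀ j i k → (j + (i + k)) * shiftⁱ (trinom j) i k ≡ i * trinom j i k
  shiftⁱ-trinom j zero    k = ℕP.*-zeroʳ (j + k)
  shiftⁱ-trinom j (suc i) k = trans (cong (_* trinom j i k) (ℕP.+-suc j (i + k))) (sym (trinom-sucⁱ j i k))

  shiftᵏ-trinom : ∀ j i k → (j + (i + k)) * shiftᵏ (trinom j) i k ≡ k * trinom j i k
  shiftᵏ-trinom j i zero    = ℕP.*-zeroʳ (j + (i + 0))
  shiftᵏ-trinom j i (suc k) =
    trans (cong (_* trinom j i k) (trans (cong (λ z → j + z) (ℕP.+-suc i k)) (ℕP.+-suc j (i + k)))) (sym (trinom-sucᵏ j i k))

-- With Q = 1 - X x - Y x² and y = Q^-(j+1), this is the coefficient of X^i Y^k x^l in the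
-- differential equation x Q y′ = (j + 1) (X x + 2 Y x²) y.
trinom-recurrence : ∀ j i k → let l = i + 2 * k in
  l * trinom j i k ≡ (j + l) * shiftⁱ (trinom j) i k + (2 * j + l) * shiftᵏ (trinom j) i k
trinom-recurrence j i k = by-size (j + (i + k)) refl
  where
  open ≡-Reasoning
  open ℕS.+-*-Solver
  c = trinom j i k
  a = shiftⁱ (trinom j) i k
  b = shiftᵏ (trinom j) i k
  by-size : ∀ T → j + (i + k) ≡ T →
    (i + 2 * k) * c ≡ (j + (i + 2 * k)) * a + (2 * j + (i + 2 * k)) * b
  by-size zero eq
    rewrite ℕP.m+n≡0⇒m≡0 i (ℕP.m+n≡0⇒n≡0 j eq) | ℕP.m+n≡0⇒n≡0 i (ℕP.m+n≡0⇒n≡0 j eq) =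
    sym (cong₂ _+_ (ℕP.*-zeroʳ (j + 0)) (ℕP.*-zeroʳ (2 * j + 0)))
  -- After multiplication by T = j + i + k the shifted coefficients become i c and k c, and a
  -- polynomial identity in j, i, k remains. The cancellation needs T ≠ 0, hence the separate case.
  by-size (suc T) eq = ℕP.*-cancelˡ-≡ _ _ (suc T) (begin
    suc T * ((i + 2 * k) * c)
      ≡⟨ cong (λ z → z * ((i + 2 * k) * c)) eq ⟨
    (j + (i + k)) * ((i + 2 * k) * c)
      ≡⟨ solve 4 (λ j i k c → (j :+ (i :+ k)) :* ((i :+ con 2 :* k) :* c)
           := (j :+ (i :+ con 2 :* k)) :* (i :* c) :+ (con 2 :* j :+ (i :+ con 2 :* k)) :* (k :* c)) refl j i k c ⟩
    (j + (i + 2 * k)) * (i * c) + (2 * j + (i + 2 * k)) * (k * c)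
      ≡⟨ cong₂ (λ x y → (j + (i + 2 * k)) * x + (2 * j + (i + 2 * k)) * y)
           (trans (sym (shiftⁱ-trinom j i k)) (cong (_* a) eq))
           (trans (sym (shiftᵏ-trinom j i k)) (cong (_* b) eq)) ⟩
    (j + (i + 2 * k)) * (suc T * a) + (2 * j + (i + 2 * k)) * (suc T * b)
      ≡⟨ solve 6 (λ j i k t a b → (j :+ (i :+ con 2 :* k)) :* (t :* a) :+ (con 2 :* j :+ (i :+ con 2 :* k)) :* (t :* b)
           := t :* ((j :+ (i :+ con 2 :* k)) :* a :+ (con 2 :* j :+ (i :+ con 2 :* k)) :* b)) refl j i k (suc T) a b ⟩
    suc T * ((j + (i + 2 * k)) * a + (2 * j + (i + 2 * k)) * b) ∎)

-- Comes from (x d/dx + j + 1) Q^-(j+1) = (j + 1) (Q - x Q′) Q^-(j+2) with Q - x Q′ = 1 + Y x².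
trinom-raise : ∀ j i k →
  suc (j + (i + 2 * k)) * trinom j i k ≡ suc j * (trinom (suc j) i k + shiftᵏ (trinom (suc j)) i k)
trinom-raise j i zero = begin
  suc (j + (i + 0)) * trinom j i 0  ≡⟨ trinom-sucʲ j i 0 ⟨
  suc j * trinom (suc j) i 0        ≡⟨ cong (suc j *_) (ℕP.+-identityʳ _) ⟨
  suc j * (trinom (suc j) i 0 + 0)  ∎
  where open ≡-Reasoning
trinom-raise j i (suc k) = begin
  suc (j + (i + 2 * suc k)) * t
    ≡⟨ solve 4 (λ j i k t → (con 1 :+ (j :+ (i :+ con 2 :* (con 1 :+ k)))) :* t
         := (con 1 :+ (j :+ (i :+ (con 1 :+ k)))) :* t :+ (con 1 :+ k) :* t) refl j i k t ⟩
  suc (j + (i + suc k)) * t + suc k * t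
    ≡⟨ cong₂ _+_ (sym (trinom-sucʲ j i (suc k))) (trans (trinom-sucᵏ j i k) (sym (trinom-sucʲ j i k))) ⟩
  suc j * trinom (suc j) i (suc k) + suc j * trinom (suc j) i k
    ≡⟨ ℕP.*-distribˡ-+ (suc j) (trinom (suc j) i (suc k)) (trinom (suc j) i k) ⟨
  suc j * (trinom (suc j) i (suc k) + trinom (suc j) i k) ∎
  where
  open ≡-Reasoning
  open ℕS.+-*-Solver
  t = trinom j i (suc k)

-- Divisibility of binomial coefficients and factorials by prime powers.

-- A weak form of Lucas' theorem: the absorption identity lowers both last digits d < b by one until d = 0.
lucas : ∀ {p} → Prime p → ∀ d b c e a → d < b → b < p →
  a + (b + c * p) ≡ d + e * p → p ∣ (a + (b + c * p)) C (b + c * p)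
lucas {p} pp d (suc b) c e a (s≤s d≤b) b<p eq =
  [ (λ p∣b → ⊥-elim (p∤b p∣b)) , (λ h → h) ]′
    (euclidsLemma _ _ pp (subst (p ∣_) (sym (C-absorb a (b + c * p))) (digit d d≤b eq)))
  where
  p∤b : p ∤ suc (b + c * p)
  p∤b h = >⇒∤ b<p (∣m+n∣m⇒∣n (subst (p ∣_) (ℕP.+-comm (suc b) (c * p)) h) (n∣m*n c))
  digit : ∀ d → d ≤ b → a + suc (b + c * p) ≡ d + e * p →
    p ∣ (a + suc (b + c * p)) * ((a + (b + c * p)) C (b + c * p))
  digit zero    _   eq = ∣m⇒∣m*n _ (subst (p ∣_) (sym eq) (n∣m*n e))
  digit (suc d) d<b eq = ∣n⇒∣m*n (a + suc (b + c * p)) (lucas pp d b c e a d<b (ℕP.<-trans (ℕP.n<1+n b) b<p)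
    (ℕP.suc-injective (trans (sym (ℕP.+-suc a _)) eq)))

p^m*m!∣[m*p]! : ∀ p .{{_ : NonZero p}} m → p ^ m * m ! ∣ (m * p) !
p^m*m!∣[m*p]! (suc q) zero    = ∣-refl
p^m*m!∣[m*p]! p@(suc q) (suc m) = subst (_∣ (suc (q + m * p)) !)
  (solve 4 (λ p s x y → (s :* p) :* (x :* y) := (p :* x) :* (s :* y)) refl p (suc m) (p ^ m) (m !))
  (*-pres-∣ (∣-refl {suc m * p}) (∣-trans (p^m*m!∣[m*p]! p m) (m≤n⇒m!∣n! (ℕP.m≤n+m (m * p) q))))
  where open ℕS.+-*-Solver

^-∣ : ∀ p {m n} → m ≤ n → p ^ m ∣ p ^ n
^-∣ p {m} {n} m≤n = subst (p ^ m ∣_)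
  (trans (sym (ℕP.^-distribˡ-+-* p m (n ∸ m))) (cong (p ^_) (ℕP.m+[n∸m]≡n m≤n))) (m∣m*n (p ^ (n ∸ m)))

-- Legendre's formula as an inequality: h n bounds the p-adic valuation of n! up to the number of digits of n.
p^h∣!*p^log : ∀ p → 2 ≤ p → (h : ℕ → ℕ) → h 0 ≡ 0 →
  (∀ m r → r < p → h (r + m * p) ≤ suc (m + h m)) →
  ∀ N → p ^ h N ∣ N ! * p ^ suc ⌊log₂ N ⌋
p^h∣!*p^log p 2≤p h h0 hstep = <-rec _ step
  where
  instance
    p≢0 : NonZero p
    p≢0 = ℕ.>-nonZero (ℕP.<-≤-trans z<s 2≤p)
  P : ℕ → Set
  P N = p ^ h N ∣ N ! * p ^ suc ⌊log₂ N ⌋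
  split : ∀ m r → r < p → (∀ {m′} → m′ < r + m * p → P m′) → P (r + m * p)
  -- Below p, `hstep` allows `h` to be at most 1, which the spare factor p in p^(1 + log) pays for.
  split zero r r<p rec = ∣n⇒∣m*n ((r + 0) !)
    (^-∣ p (ℕP.≤-trans (hstep 0 r r<p) (subst (λ z → suc z ≤ suc ⌊log₂ (r + 0) ⌋) (sym h0) (s≤s z≤n))))
  -- The m multiples of p in (m p)! give p^m m!. The one further unit allowed by `hstep` is paid by
  -- the logarithm, which grows by at least 1 from m to r + m p because p ≥ 2.
  split m@(suc _) r r<p rec = ∣-trans (^-∣ p (hstep m r r<p)) (subst (_∣ (r + m * p) ! * p ^ suc ⌊log₂ (r + m * p) ⌋)
    (sym (ℕP.^-distribˡ-+-* p (suc m) (h m)))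
    (∣-trans (*-monoʳ-∣ (p ^ suc m) (rec m<N))
    (subst (_∣ (r + m * p) ! * p ^ suc ⌊log₂ (r + m * p) ⌋)
      (solve 4 (λ p x y z → (x :* y) :* (p :* z) := (p :* x) :* (y :* z)) refl p (p ^ m) (m !) (p ^ suc ⌊log₂ m ⌋))
      (*-pres-∣ (∣-trans (p^m*m!∣[m*p]! p m) (m≤n⇒m!∣n! (ℕP.m≤n+m (m * p) r))) (^-∣ p (s≤s log<))))))
    where
    open ℕS.+-*-Solver
    m<N : m < r + m * p
    m<N = ℕP.<-≤-trans (ℕP.m<m*n m p 2≤p) (ℕP.m≤n+m (m * p) r)
    log< : suc ⌊log₂ m ⌋ ≤ ⌊log₂ (r + m * p) ⌋
    log< = subst (_≤ ⌊log₂ (r + m * p) ⌋) (⌊log₂[2*b]⌋≡1+⌊log₂b⌋ m)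
      (⌊log₂⌋-mono-≤ (ℕP.≤-trans (ℕP.*-monoˡ-≤ m 2≤p) (ℕP.≤-trans (ℕP.≤-reflexive (ℕP.*-comm p m)) (ℕP.m≤n+m (m * p) r))))
  step : ∀ N → (∀ {m} → m < N → P m) → P N
  step N rec = subst P (sym N≡) (split (N / p) (N % p) (m%n<n N p) (λ lt → rec (subst (_ <_) (sym N≡) lt)))
    where N≡ = m≡m%n+[m/n]*n N p

prime-power-split : ∀ {p} → Prime p → ∀ n → .{{NonZero n}} → ∃₂ λ s m → n ≡ p ^ s * m × p ∤ m
prime-power-split {p} pp = <-rec _ step
  where
  instance
    nt = prime⇒nonTrivial pp
  step : ∀ n → (∀ {m} → m < n → .{{NonZero m}} → ∃₂ λ s k → m ≡ p ^ s * k × p ∤ k) →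
    .{{NonZero n}} → ∃₂ λ s k → n ≡ p ^ s * k × p ∤ k
  step n rec with p ∣? n
  ... | no p∤n = 0 , n , sym (ℕP.*-identityˡ n) , p∤n
  ... | yes p∣n with rec (quotient-< p∣n) {{quotient≢0 p∣n}}
  ...   | s , k , eq , p∤k = suc s , k ,
    trans (m∣n⇒n≡m*quotient p∣n) (trans (cong (p *_) eq) (sym (ℕP.*-assoc p (p ^ s) k))) , p∤k

-- Makes the target exponents of K compatible with products: factors of levels ⌈m/2⌉ and ⌈n/2⌉
-- multiply into level ⌈(m+n)/2⌉.
⌈+/2⌉-subadd : ∀ m n → ⌈ m + n /2⌉ ≤ ⌈ m /2⌉ + ⌈ n /2⌉
⌈+/2⌉-subadd zero          n = ℕP.≤-refl
⌈+/2⌉-subadd (suc zero)    n = s≤s (ℕP.⌊n/2⌋≤⌈n/2⌉ n)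
⌈+/2⌉-subadd (suc (suc m)) n = s≤s (⌈+/2⌉-subadd m n)

suc/2≡⌈/2⌉ : ∀ n → suc n / 2 ≡ ⌈ n /2⌉
suc/2≡⌈/2⌉ zero          = refl
suc/2≡⌈/2⌉ (suc zero)    = refl
suc/2≡⌈/2⌉ (suc (suc n)) = trans (+-distrib-/-∣ˡ {2} (suc n) {2} ∣-refl) (cong suc (suc/2≡⌈/2⌉ n))

-- Integers, reciprocals and powers inside ℚ.

open ℚS.+-*-Solver using (solve; _:=_; _:+_; _:*_; _:-_; :-_; con)

private
  toℚᵘ-ιℤ : ∀ z → toℚᵘ (ιℤ z) ℚᵘ.≃ mkℚᵘ z 0
  toℚᵘ-ιℤ z = ℚP.toℚᵘ-fromℚᵘ (mkℚᵘ z 0)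

ιℤ-+ : ∀ a b → ιℤ (a ℤ.+ b) ≡ ιℤ a ⊕ ιℤ b
ιℤ-+ a b = ℚP.toℚᵘ-injective (begin
  toℚᵘ (ιℤ (a ℤ.+ b))            ≈⟨ toℚᵘ-ιℤ (a ℤ.+ b) ⟩
  mkℚᵘ (a ℤ.+ b) 0               ≈⟨ *≡* (solveℤ 2 (λ a b → (a :+ℤ b) :*ℤ conℤ (+ 1) :=ℤ (a :*ℤ conℤ (+ 1) :+ℤ b :*ℤ conℤ (+ 1)) :*ℤ conℤ (+ 1)) refl a b) ⟩
  mkℚᵘ a 0 ℚᵘ.+ mkℚᵘ b 0         ≈⟨ ℚᵘP.+-cong (ℚᵘP.≃-sym (toℚᵘ-ιℤ a)) (ℚᵘP.≃-sym (toℚᵘ-ιℤ b)) ⟩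
  toℚᵘ (ιℤ a) ℚᵘ.+ toℚᵘ (ιℤ b)   ≈⟨ ℚP.toℚᵘ-homo-+ (ιℤ a) (ιℤ b) ⟨
  toℚᵘ (ιℤ a ⊕ ιℤ b)             ∎)
  where
  open ℚᵘP.≃-Reasoning
  open ℤS.+-*-Solver using () renaming (solve to solveℤ; _:=_ to _:=ℤ_; _:+_ to _:+ℤ_; _:*_ to _:*ℤ_; con to conℤ)

ιℤ-* : ∀ a b → ιℤ (a ℤ.* b) ≡ ιℤ a ⊗ ιℤ b
ιℤ-* a b = ℚP.toℚᵘ-injective (begin
  toℚᵘ (ιℤ (a ℤ.* b))            ≈⟨ toℚᵘ-ιℤ (a ℤ.* b) ⟩
  mkℚᵘ (a ℤ.* b) 0               ≈⟨ *≡* refl ⟩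
  mkℚᵘ a 0 ℚᵘ.* mkℚᵘ b 0         ≈⟨ ℚᵘP.*-cong (ℚᵘP.≃-sym (toℚᵘ-ιℤ a)) (ℚᵘP.≃-sym (toℚᵘ-ιℤ b)) ⟩
  toℚᵘ (ιℤ a) ℚᵘ.* toℚᵘ (ιℤ b)   ≈⟨ ℚP.toℚᵘ-homo-* (ιℤ a) (ιℤ b) ⟨
  toℚᵘ (ιℤ a ⊗ ιℤ b)             ∎)
  where open ℚᵘP.≃-Reasoning

ιℤ-neg : ∀ a → ιℤ (ℤ.- a) ≡ ⊝ ιℤ a
ιℤ-neg a = ℚP.toℚᵘ-injective (begin
  toℚᵘ (ιℤ (ℤ.- a))     ≈⟨ toℚᵘ-ιℤ (ℤ.- a) ⟩
  ℚᵘ.- mkℚᵘ a 0         ≈⟨ ℚᵘP.-‿cong (ℚᵘP.≃-sym (toℚᵘ-ιℤ a)) ⟩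
  ℚᵘ.- toℚᵘ (ιℤ a)      ≈⟨ ℚP.toℚᵘ-homo‿- (ιℤ a) ⟨
  toℚᵘ (⊝ ιℤ a)         ∎)
  where open ℚᵘP.≃-Reasoning

ιℤ-injective : ∀ {a b} → ιℤ a ≡ ιℤ b → a ≡ b
ιℤ-injective {a} {b} eq with ℚᵘP.≃-trans (ℚᵘP.≃-sym (toℚᵘ-ιℤ a)) (ℚᵘP.≃-trans (ℚP.toℚᵘ-cong eq) (toℚᵘ-ιℤ b))
... | *≡* h = trans (sym (ℤP.*-identityʳ a)) (trans h (ℤP.*-identityʳ b))

ιℕ-+ : ∀ m n → ιℕ (m + n) ≡ ιℕ m ⊕ ιℕ n
ιℕ-+ m n = trans (cong ιℤ (ℤP.pos-+ m n)) (ιℤ-+ (+ m) (+ n))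

ιℕ-* : ∀ m n → ιℕ (m * n) ≡ ιℕ m ⊗ ιℕ n
ιℕ-* m n = trans (cong ιℤ (ℤP.pos-* m n)) (ιℤ-* (+ m) (+ n))

ιℕ-^ : ∀ m n → ιℕ (m ^ n) ≡ ιℕ m ^ℚ n
ιℕ-^ m zero    = refl
ιℕ-^ m (suc n) = trans (ιℕ-* m (m ^ n)) (cong (ιℕ m ⊗_) (ιℕ-^ m n))

ιℤ[↧]*q≡ιℤ[↥] : ∀ q → ιℤ (↧ q) ⊗ q ≡ ιℤ (↥ q)
ιℤ[↧]*q≡ιℤ[↥] q = ℚP.toℚᵘ-injective (begin
  toℚᵘ (ιℤ (↧ q) ⊗ q)            ≈⟨ ℚP.toℚᵘ-homo-* (ιℤ (↧ q)) q ⟩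
  toℚᵘ (ιℤ (↧ q)) ℚᵘ.* toℚᵘ q    ≈⟨ ℚᵘP.*-congʳ (toℚᵘ-ιℤ (↧ q)) ⟩
  mkℚᵘ (↧ q) 0 ℚᵘ.* toℚᵘ q       ≈⟨ cancel q ⟩
  mkℚᵘ (↥ q) 0                   ≈⟨ toℚᵘ-ιℤ (↥ q) ⟨
  toℚᵘ (ιℤ (↥ q))                ∎)
  where
  open ℚᵘP.≃-Reasoning
  cancel : ∀ q → mkℚᵘ (↧ q) 0 ℚᵘ.* toℚᵘ q ℚᵘ.≃ mkℚᵘ (↥ q) 0
  cancel (mkℚ n d-1 _) = *≡* (trans (ℤP.*-identityʳ _) (trans (ℤP.*-comm (+ suc d-1) n)
    (cong (λ z → n ℤ.* (+ suc z)) (sym (ℕP.+-identityʳ d-1)))))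

-- Total, so that its argument can be rewritten without transporting a `NonZero` instance; the value
-- at 0 is a default.
recip : ℕ → ℚ
recip zero    = 0ℚ
recip (suc n) = (+ 1) ℚ./ suc n

ιℕ*recip : ∀ n → .{{NonZero n}} → ιℕ n ⊗ recip n ≡ 1ℚ
ιℕ*recip (suc n) = ℚP.toℚᵘ-injective (begin
  toℚᵘ (ιℕ (suc n) ⊗ recip (suc n))              ≈⟨ ℚP.toℚᵘ-homo-* (ιℕ (suc n)) (recip (suc n)) ⟩
  toℚᵘ (ιℕ (suc n)) ℚᵘ.* toℚᵘ (recip (suc n))    ≈⟨ ℚᵘP.*-cong (toℚᵘ-ιℤ (+ suc n)) (ℚP.toℚᵘ-fromℚᵘ (mkℚᵘ (+ 1) n)) ⟩
  mkℚᵘ (+ suc n) 0 ℚᵘ.* mkℚᵘ (+ 1) n             ≈⟨ *≡* (trans (ℤP.*-identityʳ _) (trans (ℤP.*-identityʳ _)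
                                                     (trans (cong (λ z → + suc z) (sym (ℕP.+-identityʳ n))) (sym (ℤP.*-identityˡ _))))) ⟩
  toℚᵘ 1ℚ                                        ∎)
  where open ℚᵘP.≃-Reasoning

/≡recip : ∀ n → .{{_ : NonZero n}} → (+ 1) ℚ./ n ≡ recip n
/≡recip (suc n) = refl

^ℚ-+ : ∀ x m n → x ^ℚ (m + n) ≡ (x ^ℚ m) ⊗ (x ^ℚ n)
^ℚ-+ x zero    n = sym (ℚP.*-identityˡ _)
^ℚ-+ x (suc m) n = trans (cong (x ⊗_) (^ℚ-+ x m n)) (sym (ℚP.*-assoc x _ _))

-- The localisation of ℤ at a prime.

-- The witnessing fraction need not be reduced, so the closure properties only multiply
-- denominators.
record Loc (p : ℕ) (q : ℚ) : Set where
  constructor loc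
  field
    denom    : ℕ
    numer    : ℤ
    p∤denom  : p ∤ denom
    denom*q  : ιℕ denom ⊗ q ≡ ιℤ numer

module _ {p : ℕ} (pp : Prime p) where

  private
    p∤1 : p ∤ 1
    p∤1 p∣1 = ℕP.<-irrefl (sym (∣1⇒≡1 p∣1)) (ℕ.nonTrivial⇒n>1 p {{prime⇒nonTrivial pp}})
    p∤* : ∀ {s t} → p ∤ s → p ∤ t → p ∤ s * t
    p∤* p∤s p∤t p∣st = [ p∤s , p∤t ]′ (euclidsLemma _ _ pp p∣st)

  Loc-ℤ : ∀ z → Loc p (ιℤ z)
  Loc-ℤ z = loc 1 z p∤1 (ℚP.*-identityˡ (ιℤ z))

  Loc-ℕ : ∀ n → Loc p (ιℕ n)
  Loc-ℕ n = Loc-ℤ (+ n)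

  Loc-recip : ∀ {n} → p ∤ n → Loc p (recip n)
  Loc-recip {zero}  p∤n = ⊥-elim (p∤n (p ∣0))
  Loc-recip {suc n} p∤n = loc (suc n) (+ 1) p∤n (ιℕ*recip (suc n))

  Loc-+ : ∀ {x y} → Loc p x → Loc p y → Loc p (x ⊕ y)
  Loc-+ {x} {y} (loc s a p∤s sx) (loc t b p∤t ty) =
    loc (s * t) ((+ t ℤ.* a) ℤ.+ (+ s ℤ.* b)) (p∤* p∤s p∤t) (begin
      ιℕ (s * t) ⊗ (x ⊕ y)                 ≡⟨ cong (_⊗ (x ⊕ y)) (ιℕ-* s t) ⟩
      (ιℕ s ⊗ ιℕ t) ⊗ (x ⊕ y)              ≡⟨ solve 4 (λ s t x y → (s :* t) :* (x :+ y) := t :* (s :* x) :+ s :* (t :* y)) refl (ιℕ s) (ιℕ t) x y ⟩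
      (ιℕ t ⊗ (ιℕ s ⊗ x)) ⊕ (ιℕ s ⊗ (ιℕ t ⊗ y))  ≡⟨ cong₂ (λ u v → (ιℕ t ⊗ u) ⊕ (ιℕ s ⊗ v)) sx ty ⟩
      (ιℕ t ⊗ ιℤ a) ⊕ (ιℕ s ⊗ ιℤ b)        ≡⟨ cong₂ _⊕_ (ιℤ-* (+ t) a) (ιℤ-* (+ s) b) ⟨
      ιℤ (+ t ℤ.* a) ⊕ ιℤ (+ s ℤ.* b)      ≡⟨ ιℤ-+ (+ t ℤ.* a) (+ s ℤ.* b) ⟨
      ιℤ ((+ t ℤ.* a) ℤ.+ (+ s ℤ.* b))     ∎)
    where open ≡-Reasoning

  Loc-* : ∀ {x y} → Loc p x → Loc p y → Loc p (x ⊗ y)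
  Loc-* {x} {y} (loc s a p∤s sx) (loc t b p∤t ty) =
    loc (s * t) (a ℤ.* b) (p∤* p∤s p∤t) (begin
      ιℕ (s * t) ⊗ (x ⊗ y)         ≡⟨ cong (_⊗ (x ⊗ y)) (ιℕ-* s t) ⟩
      (ιℕ s ⊗ ιℕ t) ⊗ (x ⊗ y)      ≡⟨ solve 4 (λ s t x y → (s :* t) :* (x :* y) := (s :* x) :* (t :* y)) refl (ιℕ s) (ιℕ t) x y ⟩
      (ιℕ s ⊗ x) ⊗ (ιℕ t ⊗ y)      ≡⟨ cong₂ _⊗_ sx ty ⟩
      ιℤ a ⊗ ιℤ b                  ≡⟨ ιℤ-* a b ⟨
      ιℤ (a ℤ.* b)                 ∎)
    where open ≡-Reasoning

  Loc-neg : ∀ {x} → Loc p x → Loc p (⊝ x)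
  Loc-neg {x} (loc s a p∤s sx) = loc s (ℤ.- a) p∤s
    (trans (sym (ℚP.neg-distribʳ-* (ιℕ s) x)) (trans (cong ⊝_ sx) (sym (ιℤ-neg a))))

  Loc-^ : ∀ {x} → Loc p x → ∀ n → Loc p (x ^ℚ n)
  Loc-^ lx zero    = Loc-ℤ (+ 1)
  Loc-^ lx (suc n) = Loc-* lx (Loc-^ lx n)

  -- Cross-multiplication gives s · numerator = z · denominator with p ∤ s, so a prime p in the
  -- denominator would also divide the numerator, against coprimality.
  Loc⇒∤↧ : ∀ q → Loc p q → p ∤ ↧ₙ q
  Loc⇒∤↧ q (loc s z p∤s eq) p∣d = [ p∤s , (λ p∣n → p≢1 (coprime q p∣n p∣d)) ]′
    (euclidsLemma s ∣ ↥ q ∣ pp p∣s*n)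
    where
    open ≡-Reasoning
    p≢1 : p ≢ 1
    p≢1 p≡1 = p∤1 (∣-reflexive p≡1)
    coprime : ∀ q → p ∣ ∣ ↥ q ∣ → p ∣ ↧ₙ q → p ≡ 1
    coprime (mkℚ _ _ c) a b = Coprimality.recompute c (a , b)
    cross : + s ℤ.* ↥ q ≡ z ℤ.* ↧ q
    cross = ιℤ-injective (begin
      ιℤ (+ s ℤ.* ↥ q)              ≡⟨ ιℤ-* (+ s) (↥ q) ⟩
      ιℕ s ⊗ ιℤ (↥ q)               ≡⟨ cong (ιℕ s ⊗_) (ιℤ[↧]*q≡ιℤ[↥] q) ⟨
      ιℕ s ⊗ (ιℤ (↧ q) ⊗ q)         ≡⟨ solve 3 (λ s d q → s :* (d :* q) := (s :* q) :* d) refl (ιℕ s) (ιℤ (↧ q)) q ⟩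
      (ιℕ s ⊗ q) ⊗ ιℤ (↧ q)         ≡⟨ cong (_⊗ ιℤ (↧ q)) eq ⟩
      ιℤ z ⊗ ιℤ (↧ q)               ≡⟨ ιℤ-* z (↧ q) ⟨
      ιℤ (z ℤ.* ↧ q)                ∎)
    abs-cross : s * ∣ ↥ q ∣ ≡ ∣ z ∣ * ↧ₙ q
    abs-cross = trans (sym (ℤP.abs-* (+ s) (↥ q))) (trans (cong ∣_∣ cross) (ℤP.abs-* z (↧ q)))
    p∣s*n : p ∣ s * ∣ ↥ q ∣
    p∣s*n = subst (p ∣_) (sym abs-cross) (∣n⇒∣m*n ∣ z ∣ p∣d)

  ∤↧⇒Loc : ∀ q → p ∤ ↧ₙ q → Loc p q
  ∤↧⇒Loc q p∤d = loc (↧ₙ q) (↥ q) p∤d (ιℤ[↧]*q≡ιℤ[↥] q)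

prime-divisor : ∀ n → n ≢ 1 → .{{NonZero n}} → ∃ λ p → Prime p × p ∣ n
prime-divisor n n≢1 with factorise n
... | record { factors = []     ; isFactorisation = eq } = ⊥-elim (n≢1 eq)
... | record { factors = p ∷ ps ; isFactorisation = eq ; factorsPrime = pp ∷ _ } =
  p , pp , subst (p ∣_) (sym eq) (m∣m*n (product ps))

-- A reduced denominator other than 1 has a prime divisor, and q is not local there. This reduces
-- both parts of the theorem to one prime at a time.
Loc⇒IsInt : ∀ q → (∀ p → Prime p → Loc p q) → IsInt q
Loc⇒IsInt q everywhere with ↧ₙ q ℕP.≟ 1
... | yes d≡1 = ↥ q , trans (sym (ℚP.*-identityˡ q)) (trans (cong (λ d → ιℕ d ⊗ q) (sym d≡1)) (ιℤ[↧]*q≡ιℤ[↥] q))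
... | no  d≢1 with prime-divisor (↧ₙ q) d≢1
...   | p , pp , p∣d = ⊥-elim (Loc⇒∤↧ pp q (everywhere p pp) p∣d)

-- The filtration by powers of K.

-- The K-adic filtration of the localisation of ℤ at p, where κ = 1/K.
record Filt (p : ℕ) (κ : ℚ) (k : ℕ) (q : ℚ) : Set where
  constructor filt
  field unfilt : Loc p (q ⊗ (κ ^ℚ k))

module Filtration {p : ℕ} (pp : Prime p) {K κ : ℚ} (K⊗κ : K ⊗ κ ≡ 1ℚ) (K∈ : Loc p K) where

  M : ℕ → ℚ → Set
  M = Filt p κ

  M-+ : ∀ {k x y} → M k x → M k y → M k (x ⊕ y)
  M-+ {k} {x} {y} (filt mx) (filt my) = filt (subst (Loc p) (sym (ℚP.*-distribʳ-+ (κ ^ℚ k) x y)) (Loc-+ pp mx my))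

  M-* : ∀ {a b x y} → M a x → M b y → M (a + b) (x ⊗ y)
  M-* {a} {b} {x} {y} (filt mx) (filt my) = filt (subst (Loc p)
    (trans (solve 4 (λ x y u v → (x :* u) :* (y :* v) := (x :* y) :* (u :* v)) refl x y (κ ^ℚ a) (κ ^ℚ b))
      (cong ((x ⊗ y) ⊗_) (sym (^ℚ-+ κ a b)))) (Loc-* pp mx my))

  M-0 : ∀ {x} → Loc p x → M 0 x
  M-0 {x} lx = filt (subst (Loc p) (sym (ℚP.*-identityʳ x)) lx)

  M-Loc : ∀ {k x y} → Loc p x → M k y → M k (x ⊗ y)
  M-Loc lx my = M-* (M-0 lx) my

  M-K : M 1 K
  M-K = filt (subst (Loc p) (sym (trans (cong (K ⊗_) (ℚP.*-identityʳ κ)) K⊗κ)) (Loc-ℤ pp (+ 1)))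

  M-zero : ∀ k → M k 0ℚ
  M-zero k = filt (subst (Loc p) (sym (ℚP.*-zeroˡ (κ ^ℚ k))) (Loc-ℤ pp 0ℤ))

  M-neg : ∀ {k x} → M k x → M k (⊝ x)
  M-neg {k} {x} (filt mx) = filt (subst (Loc p) (ℚP.neg-distribˡ-* x (κ ^ℚ k)) (Loc-neg pp mx))

  private
    M-pred : ∀ {k x} → M (suc k) x → M k x
    M-pred {k} {x} (filt mx) = filt (subst (Loc p) (begin
      K ⊗ (x ⊗ (κ ⊗ (κ ^ℚ k)))  ≡⟨ solve 4 (λ K κ x y → K :* (x :* (κ :* y)) := (K :* κ) :* (x :* y)) refl K κ x (κ ^ℚ k) ⟩
      (K ⊗ κ) ⊗ (x ⊗ (κ ^ℚ k))  ≡⟨ cong (_⊗ (x ⊗ (κ ^ℚ k))) K⊗κ ⟩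
      1ℚ ⊗ (x ⊗ (κ ^ℚ k))       ≡⟨ ℚP.*-identityˡ _ ⟩
      x ⊗ (κ ^ℚ k)              ∎) (Loc-* pp K∈ mx))
      where open ≡-Reasoning
    M-drop : ∀ d {a x} → M (d + a) x → M a x
    M-drop zero    mx = mx
    M-drop (suc d) mx = M-drop d (M-pred mx)

  -- Each level dropped costs a multiplication by K, which is p-integral.
  M-mono : ∀ {a b x} → a ≤ b → M b x → M a x
  M-mono {a} {b} {x} a≤b mx = M-drop (b ∸ a) (subst (λ k → M k x) (sym (ℕP.m∸n+n≡m a≤b)) mx)

  M-^ : ∀ {x} → M 1 x → ∀ k → M k (x ^ℚ k)
  M-^ mx zero    = M-0 (Loc-ℤ pp (+ 1))
  M-^ mx (suc k) = M-* mx (M-^ mx k)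

-- Power series coefficients and the recurrences of Q^-(j+1).

-- Multiplication of a series by x², as `delay` is by x. It also provides the two leading zeros that
-- let a recurrence of order two start at the origin.
pad : (ℕ → ℚ) → ℕ → ℚ
pad f zero          = 0ℚ
pad f (suc zero)    = 0ℚ
pad f (suc (suc n)) = f n

delay : (ℕ → ℚ) → ℕ → ℚ
delay f zero    = 0ℚ
delay f (suc n) = f n

-- The sum of t i k over all i + 2k = l.
Σ₂ : (ℕ → ℕ → ℚ) → ℕ → ℚ
Σ₂ t zero          = t 0 0
Σ₂ t (suc zero)    = t 1 0
Σ₂ t (suc (suc l)) = t (suc (suc l)) 0 ⊕ Σ₂ (λ i k → t i (suc k)) l

private
  +2*suc : ∀ i k {l} → i + 2 * k ≡ l → i + 2 * suc k ≡ suc (suc l)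
  +2*suc i k eq = trans (ℕS.+-*-Solver.solve 2 (λ i k → i ℕS′.:+ ℕS′.con 2 ℕS′.:* (ℕS′.con 1 ℕS′.:+ k)
      ℕS′.:= ℕS′.con 2 ℕS′.:+ (i ℕS′.:+ ℕS′.con 2 ℕS′.:* k)) refl i k) (cong (λ l → suc (suc l)) eq)
    where module ℕS′ = ℕS.+-*-Solver

Σ₂-cong : ∀ {t u} l → (∀ i k → i + 2 * k ≡ l → t i k ≡ u i k) → Σ₂ t l ≡ Σ₂ u l
Σ₂-cong zero          t≗u = t≗u 0 0 refl
Σ₂-cong (suc zero)    t≗u = t≗u 1 0 refl
Σ₂-cong (suc (suc l)) t≗u = cong₂ _⊕_ (t≗u (suc (suc l)) 0 (ℕP.+-identityʳ _))
  (Σ₂-cong l (λ i k eq → t≗u i (suc k) (+2*suc i k eq)))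

Σ₂-⊕ : ∀ t u l → Σ₂ (λ i k → t i k ⊕ u i k) l ≡ Σ₂ t l ⊕ Σ₂ u l
Σ₂-⊕ t u zero          = refl
Σ₂-⊕ t u (suc zero)    = refl
Σ₂-⊕ t u (suc (suc l)) = trans (cong ((t (suc (suc l)) 0 ⊕ u (suc (suc l)) 0) ⊕_) (Σ₂-⊕ _ _ l))
  (solve 4 (λ a b c d → (a :+ b) :+ (c :+ d) := (a :+ c) :+ (b :+ d)) refl
    (t (suc (suc l)) 0) (u (suc (suc l)) 0) (Σ₂ (λ i k → t i (suc k)) l) (Σ₂ (λ i k → u i (suc k)) l))

Σ₂-⊗ : ∀ x t l → Σ₂ (λ i k → x ⊗ t i k) l ≡ x ⊗ Σ₂ t l
Σ₂-⊗ x t zero          = refl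
Σ₂-⊗ x t (suc zero)    = refl
Σ₂-⊗ x t (suc (suc l)) = trans (cong ((x ⊗ t (suc (suc l)) 0) ⊕_) (Σ₂-⊗ x _ l)) (sym (ℚP.*-distribˡ-+ x _ _))

Σ₂-closed : (P : ℚ → Set) → (∀ {x y} → P x → P y → P (x ⊕ y)) →
  ∀ {t} l → (∀ i k → i + 2 * k ≡ l → P (t i k)) → P (Σ₂ t l)
Σ₂-closed P P-⊕ zero          pt = pt 0 0 refl
Σ₂-closed P P-⊕ (suc zero)    pt = pt 1 0 refl
Σ₂-closed P P-⊕ (suc (suc l)) pt = P-⊕ (pt (suc (suc l)) 0 (ℕP.+-identityʳ _))
  (Σ₂-closed P P-⊕ l (λ i k eq → pt i (suc k) (+2*suc i k eq)))

Σ₂-shiftⁱ : ∀ (t u : ℕ → ℕ → ℚ) → (∀ k → u 0 k ≡ 0ℚ) → (∀ i k → u (suc i) k ≡ t i k) →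
  ∀ l → Σ₂ u l ≡ delay (Σ₂ t) l
Σ₂-shiftⁱ t u u₀ uₛ zero                = u₀ 0
Σ₂-shiftⁱ t u u₀ uₛ (suc zero)          = uₛ 0 0
Σ₂-shiftⁱ t u u₀ uₛ (suc (suc zero))    = trans (cong₂ _⊕_ (uₛ 1 0) (u₀ 1)) (ℚP.+-identityʳ (t 1 0))
Σ₂-shiftⁱ t u u₀ uₛ (suc (suc (suc l))) = cong₂ _⊕_ (uₛ (suc (suc l)) 0)
  (Σ₂-shiftⁱ (λ i k → t i (suc k)) (λ i k → u i (suc k)) (λ k → u₀ (suc k)) (λ i k → uₛ i (suc k)) (suc l))

Σ₂-shiftᵏ : ∀ (t u : ℕ → ℕ → ℚ) → (∀ i → u i 0 ≡ 0ℚ) → (∀ i k → u i (suc k) ≡ t i k) →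
  ∀ l → Σ₂ u l ≡ pad (Σ₂ t) l
Σ₂-shiftᵏ t u u₀ uₛ zero          = u₀ 0
Σ₂-shiftᵏ t u u₀ uₛ (suc zero)    = u₀ 1
Σ₂-shiftᵏ t u u₀ uₛ (suc (suc l)) = trans (cong₂ _⊕_ (u₀ (suc (suc l))) (Σ₂-cong l (λ i k _ → uₛ i k)))
  (ℚP.+-identityˡ (Σ₂ t l))

-- The two bases are the instances X = A/D and X = 0, both with Y = -K.
module Gegenbauer (X Y : ℚ) where

  monomial : (ℕ → ℕ → ℕ) → ℕ → ℕ → ℚ
  monomial c i k = ιℕ (c i k) ⊗ ((X ^ℚ i) ⊗ (Y ^ℚ k))

  gen : (ℕ → ℕ → ℕ) → ℕ → ℚ
  gen c = Σ₂ (monomial c)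

  -- geg j l is the coefficient of x^l in (1 - X x - Y x²)^-(j+1).
  geg : ℕ → ℕ → ℚ
  geg j = gen (trinom j)

  private
    gen-cong : ∀ c d l → (∀ i k → i + 2 * k ≡ l → c i k ≡ d i k) → gen c l ≡ gen d l
    gen-cong c d l c≗d = Σ₂-cong l (λ i k eq → cong (λ z → ιℕ z ⊗ ((X ^ℚ i) ⊗ (Y ^ℚ k))) (c≗d i k eq))

    gen-+ : ∀ c d l → gen (λ i k → c i k + d i k) l ≡ gen c l ⊕ gen d l
    gen-+ c d l = trans
      (Σ₂-cong l (λ i k _ → trans (cong (_⊗ ((X ^ℚ i) ⊗ (Y ^ℚ k))) (ιℕ-+ (c i k) (d i k)))
        (ℚP.*-distribʳ-+ ((X ^ℚ i) ⊗ (Y ^ℚ k)) (ιℕ (c i k)) (ιℕ (d i k)))))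
      (Σ₂-⊕ (monomial c) (monomial d) l)

    gen-* : ∀ a c l → gen (λ i k → a * c i k) l ≡ ιℕ a ⊗ gen c l
    gen-* a c l = trans
      (Σ₂-cong l (λ i k _ → trans (cong (_⊗ ((X ^ℚ i) ⊗ (Y ^ℚ k))) (ιℕ-* a (c i k)))
        (ℚP.*-assoc (ιℕ a) (ιℕ (c i k)) ((X ^ℚ i) ⊗ (Y ^ℚ k)))))
      (Σ₂-⊗ (ιℕ a) (monomial c) l)

    delay-⊗ : ∀ x f l → delay (λ n → x ⊗ f n) l ≡ x ⊗ delay f l
    delay-⊗ x f zero    = sym (ℚP.*-zeroʳ x)
    delay-⊗ x f (suc l) = refl

    pad-⊗ : ∀ x f l → pad (λ n → x ⊗ f n) l ≡ x ⊗ pad f l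
    pad-⊗ x f zero          = sym (ℚP.*-zeroʳ x)
    pad-⊗ x f (suc zero)    = sym (ℚP.*-zeroʳ x)
    pad-⊗ x f (suc (suc l)) = refl

    delay-cong : ∀ {f g} l → (∀ n → f n ≡ g n) → delay f l ≡ delay g l
    delay-cong zero    f≗g = refl
    delay-cong (suc l) f≗g = f≗g l

    pad-cong : ∀ {f g} l → (∀ n → f n ≡ g n) → pad f l ≡ pad g l
    pad-cong zero          f≗g = refl
    pad-cong (suc zero)    f≗g = refl
    pad-cong (suc (suc l)) f≗g = f≗g l

    gen-shiftⁱ : ∀ c l → gen (shiftⁱ c) l ≡ X ⊗ delay (gen c) l
    gen-shiftⁱ c l = trans
      (Σ₂-shiftⁱ (λ i k → X ⊗ monomial c i k) (monomial (shiftⁱ c))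
        (λ k → ℚP.*-zeroˡ ((X ^ℚ 0) ⊗ (Y ^ℚ k)))
        (λ i k → solve 4 (λ c x p q → c :* ((x :* p) :* q) := x :* (c :* (p :* q))) refl (ιℕ (c i k)) X (X ^ℚ i) (Y ^ℚ k)) l)
      (trans (delay-cong l (Σ₂-⊗ X (monomial c))) (delay-⊗ X (gen c) l))

    gen-shiftᵏ : ∀ c l → gen (shiftᵏ c) l ≡ Y ⊗ pad (gen c) l
    gen-shiftᵏ c l = trans
      (Σ₂-shiftᵏ (λ i k → Y ⊗ monomial c i k) (monomial (shiftᵏ c))
        (λ i → ℚP.*-zeroˡ ((X ^ℚ i) ⊗ (Y ^ℚ 0)))
        (λ i k → solve 4 (λ c x p q → c :* (p :* (x :* q)) := x :* (c :* (p :* q))) refl (ιℕ (c i k)) Y (X ^ℚ i) (Y ^ℚ k)) l)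
      (trans (pad-cong l (Σ₂-⊗ Y (monomial c))) (pad-⊗ Y (gen c) l))

  geg-0 : ∀ j → geg j 0 ≡ 1ℚ
  geg-0 j = cong (λ c → ιℕ c ⊗ (1ℚ ⊗ 1ℚ)) (trinom-0 j)

  geg-recurrence : ∀ j l →
    ιℕ l ⊗ geg j l ≡ (ιℕ (j + l) ⊗ (X ⊗ delay (geg j) l)) ⊕ (ιℕ (2 * j + l) ⊗ (Y ⊗ pad (geg j) l))
  geg-recurrence j l = begin
    ιℕ l ⊗ geg j l                             ≡⟨ gen-* l c l ⟨
    gen (λ i k → l * c i k) l                  ≡⟨ gen-cong (λ i k → l * c i k) (λ i k → (j + l) * shiftⁱ c i k + (2 * j + l) * shiftᵏ c i k) l
                                                    (λ { i k refl → trinom-recurrence j i k }) ⟩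
    gen (λ i k → (j + l) * shiftⁱ c i k + (2 * j + l) * shiftᵏ c i k) l
      ≡⟨ gen-+ (λ i k → (j + l) * shiftⁱ c i k) (λ i k → (2 * j + l) * shiftᵏ c i k) l ⟩
    gen (λ i k → (j + l) * shiftⁱ c i k) l ⊕ gen (λ i k → (2 * j + l) * shiftᵏ c i k) l
      ≡⟨ cong₂ _⊕_ (trans (gen-* (j + l) (shiftⁱ c) l) (cong (ιℕ (j + l) ⊗_) (gen-shiftⁱ c l)))
                   (trans (gen-* (2 * j + l) (shiftᵏ c) l) (cong (ιℕ (2 * j + l) ⊗_) (gen-shiftᵏ c l))) ⟩
    (ιℕ (j + l) ⊗ (X ⊗ delay (geg j) l)) ⊕ (ιℕ (2 * j + l) ⊗ (Y ⊗ pad (geg j) l)) ∎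
    where
    open ≡-Reasoning
    c = trinom j

  geg-raise : ∀ j l → ιℕ (suc (j + l)) ⊗ geg j l ≡ ιℕ (suc j) ⊗ (geg (suc j) l ⊕ (Y ⊗ pad (geg (suc j)) l))
  geg-raise j l = begin
    ιℕ (suc (j + l)) ⊗ geg j l                     ≡⟨ gen-* (suc (j + l)) (trinom j) l ⟨
    gen (λ i k → suc (j + l) * trinom j i k) l     ≡⟨ gen-cong (λ i k → suc (j + l) * trinom j i k) (λ i k → suc j * (c i k + shiftᵏ c i k)) l
                                                        (λ { i k refl → trinom-raise j i k }) ⟩
    gen (λ i k → suc j * (c i k + shiftᵏ c i k)) l ≡⟨ gen-* (suc j) (λ i k → c i k + shiftᵏ c i k) l ⟩
    ιℕ (suc j) ⊗ gen (λ i k → c i k + shiftᵏ c i k) l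
      ≡⟨ cong (ιℕ (suc j) ⊗_) (trans (gen-+ c (shiftᵏ c) l) (cong (gen c l ⊕_) (gen-shiftᵏ c l))) ⟩
    ιℕ (suc j) ⊗ (geg (suc j) l ⊕ (Y ⊗ pad (geg (suc j)) l)) ∎
    where
    open ≡-Reasoning
    c = trinom (suc j)

-- Expansion of a solution of the recurrence in a basis of series.

module Recurrence (D : ℕ) (A K : ℚ) where

  lead : ℕ → ℚ
  lead n = ιℕ (D * n + 1)

  lead⁻¹ : ℕ → ℚ
  lead⁻¹ n = recip (D * n + 1)

  lead*lead⁻¹ : ∀ n → lead n ⊗ lead⁻¹ n ≡ 1ℚ
  lead*lead⁻¹ n = ιℕ*recip (D * n + 1) {{subst NonZero (ℕP.+-comm 1 (D * n)) _}}

  -- Sequences are stored with two leading zeros: s (2 + l) is the entry at position n = j + l.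
  Solves : ℕ → (ℕ → ℚ) → (ℕ → ℚ) → Set
  Solves j s r = ∀ n l → j + l ≡ n →
    lead n ⊗ s (suc (suc l)) ≡ (((A ⊗ ιℕ n) ⊗ s (suc l)) ⊖ ((K ⊗ (ιℕ (D * n) ⊖ 1ℚ)) ⊗ s l)) ⊕ r l

  -- Coefficients of (1 - K x²) e(x).
  reduced : (ℕ → ℚ) → ℕ → ℚ
  reduced e l = e l ⊖ (K ⊗ pad e l)

  -- The operator of the recurrence maps x^j e_j to
  -- (1 - K x²) ((D j + 1) x^j e_j - τ_j x^(j+1) e_(j+1)).
  record Basis : Set where
    field
      e        : ℕ → ℕ → ℚ
      τ        : ℕ → ℚ
      e-0      : ∀ j → e j 0 ≡ 1ℚ
      e-solves : ∀ j → Solves j (pad (e j)) (λ l → (lead j ⊗ reduced (e j) l) ⊖ (τ j ⊗ delay (reduced (e (suc j))) l))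

  module _ (b : Basis) where
    open Basis b

    -- Expands a solution in a basis one coefficient at a time: H j describes the possible
    -- j-th coefficients (times D j + 1), R n the admissible right-hand sides at position n.
    module Eliminate (N : ℕ)
      (R H : ℕ → ℚ → Set) (G : ℚ → Set)
      (R-sub : ∀ {j x ρ} l → R (j + l) x → R j ρ → R (j + l) (x ⊖ (ρ ⊗ reduced (e j) l)))
      (R⇒H : ∀ {j x} → R j x → H j x)
      (H-⊕ : ∀ {j x y} → H j x → H j y → H j (x ⊕ y))
      (H-next : ∀ {j ρ} → H j ρ → H (suc j) ((ρ ⊗ lead⁻¹ j) ⊗ τ j))
      (G-⊕ : ∀ {x y} → G x → G y → G (x ⊕ y))
      (H⇒G : ∀ {j ρ} l → j + l ≡ N → H j ρ → G ((ρ ⊗ lead⁻¹ j) ⊗ e j l))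
      where

      private
        reduced-0 : ∀ j → reduced (e j) 0 ≡ 1ℚ
        reduced-0 j = trans (cong₂ _⊖_ (e-0 j) (ℚP.*-zeroʳ K)) refl

      -- The right-hand side is kept in two parts: `g` stems from the original source and is bounded
      -- by `R`, while β is what the previous basis series has passed on through τ. Only `H` has to
      -- follow β, which may satisfy a weaker bound than `R`.
      eliminate : ∀ L j (s g : ℕ → ℚ) β → j + L ≡ N → s 0 ≡ 0ℚ → s 1 ≡ 0ℚ →
        (∀ l → R (j + l) (g l)) → H j β → Solves j s (λ l → g l ⊕ (β ⊗ reduced (e j) l)) →
        G (s (suc (suc L)))
      eliminate L j s g β eq s₀ s₁ gR βH sol = finish L eq
        where
        open ≡-Reasoning
        ρ c β′ : ℚ
        ρ = g 0 ⊕ β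
        c = ρ ⊗ lead⁻¹ j
        β′ = c ⊗ τ j
        s′ g′ : ℕ → ℚ
        -- The entry at position j of the difference is zero, so the indices move by one and the two
        -- leading zeros are restored. From `g` only the multiple `g 0` of `reduced (e j)` is
        -- removed; the multiple β is cancelled by the β-part of the right-hand side.
        s′ l = s (suc l) ⊖ (c ⊗ pad (e j) (suc l))
        g′ l = g (suc l) ⊖ (g 0 ⊗ reduced (e j) (suc l))
        lead*c : lead j ⊗ c ≡ ρ
        lead*c = trans (solve 3 (λ a b c → a :* (b :* c) := b :* (a :* c)) refl (lead j) ρ (lead⁻¹ j))
          (trans (cong (ρ ⊗_) (lead*lead⁻¹ j)) (ℚP.*-identityʳ ρ))
        gR₀ : R j (g 0)
        gR₀ = subst (λ n → R n (g 0)) (ℕP.+-identityʳ j) (gR 0)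
        ρH : H j ρ
        ρH = H-⊕ (R⇒H gR₀) βH
        lead*s₂ : lead j ⊗ s 2 ≡ ρ
        lead*s₂ = begin
          lead j ⊗ s 2  ≡⟨ sol j 0 (ℕP.+-identityʳ j) ⟩
          (((A ⊗ ιℕ j) ⊗ s 1) ⊖ ((K ⊗ (ιℕ (D * j) ⊖ 1ℚ)) ⊗ s 0)) ⊕ (g 0 ⊕ (β ⊗ reduced (e j) 0))
            ≡⟨ cong₂ (λ u v → u ⊕ (g 0 ⊕ v))
                 (cong₂ _⊖_ (trans (cong ((A ⊗ ιℕ j) ⊗_) s₁) (ℚP.*-zeroʳ (A ⊗ ιℕ j)))
                            (trans (cong ((K ⊗ (ιℕ (D * j) ⊖ 1ℚ)) ⊗_) s₀) (ℚP.*-zeroʳ (K ⊗ (ιℕ (D * j) ⊖ 1ℚ)))))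
                 (trans (cong (β ⊗_) (reduced-0 j)) (ℚP.*-identityʳ β)) ⟩
          0ℚ ⊕ ρ        ≡⟨ ℚP.+-identityˡ ρ ⟩
          ρ             ∎
        s₂ : s 2 ≡ c
        s₂ = begin
          s 2                            ≡⟨ ℚP.*-identityˡ (s 2) ⟨
          1ℚ ⊗ s 2                       ≡⟨ cong (_⊗ s 2) (lead*lead⁻¹ j) ⟨
          (lead j ⊗ lead⁻¹ j) ⊗ s 2      ≡⟨ solve 3 (λ a b c → (a :* b) :* c := (a :* c) :* b) refl (lead j) (lead⁻¹ j) (s 2) ⟩
          (lead j ⊗ s 2) ⊗ lead⁻¹ j      ≡⟨ cong (_⊗ lead⁻¹ j) lead*s₂ ⟩
          c                              ∎
        c*e₀ : c ⊗ e j 0 ≡ c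
        c*e₀ = trans (cong (c ⊗_) (e-0 j)) (ℚP.*-identityʳ c)
        s′₀ : s′ 0 ≡ 0ℚ
        s′₀ = trans (cong₂ _⊖_ s₁ (ℚP.*-zeroʳ c)) refl
        s′₁ : s′ 1 ≡ 0ℚ
        s′₁ = trans (cong₂ _⊖_ s₂ c*e₀) (ℚP.+-inverseʳ c)
        g′R : ∀ l → R (suc j + l) (g′ l)
        g′R l = subst (λ n → R n (g′ l)) (ℕP.+-suc j l) (R-sub (suc l) (gR (suc l)) gR₀)
        sol′ : Solves (suc j) s′ (λ l → g′ l ⊕ (β′ ⊗ reduced (e (suc j)) l))
        sol′ n l eq = begin
          lead n ⊗ s′ (suc (suc l))
            ≡⟨ solve 4 (λ d s c p → d :* (s :- c :* p) := d :* s :- c :* (d :* p)) refl (lead n) (s (3 + l)) c (e j (suc l)) ⟩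
          (lead n ⊗ s (3 + l)) ⊖ (c ⊗ (lead n ⊗ e j (suc l)))
            ≡⟨ cong₂ (λ u v → u ⊖ (c ⊗ v)) (sol n (suc l) eq′) (e-solves j n (suc l) eq′) ⟩
          (((a ⊗ s (2 + l)) ⊖ (k ⊗ s (1 + l))) ⊕ (g (suc l) ⊕ (β ⊗ f)))
            ⊖ (c ⊗ (((a ⊗ pad (e j) (2 + l)) ⊖ (k ⊗ pad (e j) (1 + l))) ⊕ ((lead j ⊗ f) ⊖ (τ j ⊗ f′))))
            ≡⟨ solve 13 (λ a k s₂ s₁ g β f c e₂ e₁ d τ f′ →
                 ((a :* s₂ :- k :* s₁) :+ (g :+ β :* f)) :- c :* ((a :* e₂ :- k :* e₁) :+ (d :* f :- τ :* f′))
                 := (a :* (s₂ :- c :* e₂) :- k :* (s₁ :- c :* e₁)) :+ (((g :+ β :* f) :- (d :* c) :* f) :+ (c :* τ) :* f′))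
                 refl a k (s (2 + l)) (s (1 + l)) (g (suc l)) β f c (pad (e j) (2 + l)) (pad (e j) (1 + l)) (lead j) (τ j) f′ ⟩
          ((a ⊗ s′ (1 + l)) ⊖ (k ⊗ s′ l)) ⊕ (((g (suc l) ⊕ (β ⊗ f)) ⊖ ((lead j ⊗ c) ⊗ f)) ⊕ (β′ ⊗ f′))
            ≡⟨ cong (λ z → ((a ⊗ s′ (1 + l)) ⊖ (k ⊗ s′ l)) ⊕ (((g (suc l) ⊕ (β ⊗ f)) ⊖ (z ⊗ f)) ⊕ (β′ ⊗ f′))) lead*c ⟩
          ((a ⊗ s′ (1 + l)) ⊖ (k ⊗ s′ l)) ⊕ (((g (suc l) ⊕ (β ⊗ f)) ⊖ (ρ ⊗ f)) ⊕ (β′ ⊗ f′))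
            ≡⟨ cong (λ z → ((a ⊗ s′ (1 + l)) ⊖ (k ⊗ s′ l)) ⊕ (z ⊕ (β′ ⊗ f′)))
                 (solve 4 (λ g g₀ β f → (g :+ β :* f) :- (g₀ :+ β) :* f := g :- g₀ :* f) refl (g (suc l)) (g 0) β f) ⟩
          ((a ⊗ s′ (1 + l)) ⊖ (k ⊗ s′ l)) ⊕ (g′ l ⊕ (β′ ⊗ f′)) ∎
          where
          eq′ : j + suc l ≡ n
          eq′ = trans (ℕP.+-suc j l) eq
          a k f f′ : ℚ
          a = A ⊗ ιℕ n
          k = K ⊗ (ιℕ (D * n) ⊖ 1ℚ)
          f = reduced (e j) (suc l)
          f′ = reduced (e (suc j)) l
        finish : ∀ L → j + L ≡ N → G (s (suc (suc L)))
        finish zero    eq = subst G (trans c*e₀ (sym s₂)) (H⇒G 0 eq ρH)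
        finish (suc L) eq = subst G (solve 2 (λ x y → (x :- y) :+ y := x) refl (s (3 + L)) (c ⊗ e j (suc L)))
          (G-⊕ (eliminate L (suc j) s′ g′ β′ (trans (sym (ℕP.+-suc j L)) eq) s′₀ s′₁ g′R (H-next ρH) sol′)
               (H⇒G (suc L) eq ρH))

  module _ where
    open ≡-Reasoning

    private
      lead-split : ∀ j l {n} → j + l ≡ n → lead n ≡ (ιℕ D ⊗ (ιℕ j ⊕ ιℕ l)) ⊕ 1ℚ
      lead-split j l refl = trans (ιℕ-+ (D * (j + l)) 1) (cong (_⊕ 1ℚ) (trans (ιℕ-* D (j + l)) (cong (ιℕ D ⊗_) (ιℕ-+ j l))))

      mid-split : ∀ j l {n} → j + l ≡ n → ιℕ (D * n) ≡ ιℕ D ⊗ (ιℕ j ⊕ ιℕ l)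
      mid-split j l refl = trans (ιℕ-* D (j + l)) (cong (ιℕ D ⊗_) (ιℕ-+ j l))

      lead-+ : ∀ j → lead j ≡ (ιℕ D ⊗ ιℕ j) ⊕ 1ℚ
      lead-+ j = trans (ιℕ-+ (D * j) 1) (cong (_⊕ 1ℚ) (ιℕ-* D j))

      ιℕ-2j+l : ∀ j l → ιℕ (2 * j + l) ≡ (ιℕ j ⊕ ιℕ j) ⊕ ιℕ l
      ιℕ-2j+l j l = trans (ιℕ-+ (2 * j) l) (cong (_⊕ ιℕ l)
        (trans (cong (λ z → ιℕ (j + z)) (ℕP.+-identityʳ j)) (ιℕ-+ j j)))

      pad-suc : ∀ f l → pad f (suc l) ≡ delay f l
      pad-suc f zero    = refl
      pad-suc f (suc l) = refl

    -- The substitution t = x / Q with Q = 1 - (A/D) x + K x² turns the homogeneous equation into θ y = (1 - 1/D) y.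
    module _ {X : ℚ} (D*X : ιℕ D ⊗ X ≡ A) where
      open Gegenbauer X (⊝ K)

      gegenbauerBasis : Basis
      gegenbauerBasis = record
        { e = geg ; τ = λ _ → 0ℚ ; e-0 = geg-0 ; e-solves = solves }
        where
        solves : ∀ j → Solves j (pad (geg j)) (λ l → (lead j ⊗ reduced (geg j) l) ⊖ (0ℚ ⊗ delay (reduced (geg (suc j))) l))
        solves j n l eq = begin
          lead n ⊗ e₀                               ≡⟨ cong (_⊗ e₀) (lead-split j l eq) ⟩
          ((d ⊗ (ιj ⊕ ιl)) ⊕ 1ℚ) ⊗ e₀
            ≡⟨ solve 4 (λ d j l e → (d :* (j :+ l) :+ con 1ℚ) :* e := d :* (l :* e) :+ (d :* j :+ con 1ℚ) :* e) refl d ιj ιl e₀ ⟩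
          (d ⊗ (ιl ⊗ e₀)) ⊕ (((d ⊗ ιj) ⊕ 1ℚ) ⊗ e₀)  ≡⟨ cong (λ z → (d ⊗ z) ⊕ (((d ⊗ ιj) ⊕ 1ℚ) ⊗ e₀)) rec ⟩
          (d ⊗ (((ιj ⊕ ιl) ⊗ (X ⊗ e₁)) ⊕ (((ιj ⊕ ιj) ⊕ ιl) ⊗ ((⊝ K) ⊗ e₂)))) ⊕ (((d ⊗ ιj) ⊕ 1ℚ) ⊗ e₀)
            ≡⟨ solve 8 (λ d j l x k e₀ e₁ e₂ →
                 d :* ((j :+ l) :* (x :* e₁) :+ ((j :+ j) :+ l) :* ((:- k) :* e₂)) :+ (d :* j :+ con 1ℚ) :* e₀
                 := ((d :* x) :* (j :+ l) :* e₁ :- k :* (d :* (j :+ l) :- con 1ℚ) :* e₂) :+ (d :* j :+ con 1ℚ) :* (e₀ :- k :* e₂))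
                 refl d ιj ιl X K e₀ e₁ e₂ ⟩
          ((((d ⊗ X) ⊗ (ιj ⊕ ιl)) ⊗ e₁) ⊖ ((K ⊗ ((d ⊗ (ιj ⊕ ιl)) ⊖ 1ℚ)) ⊗ e₂)) ⊕ (((d ⊗ ιj) ⊕ 1ℚ) ⊗ (e₀ ⊖ (K ⊗ e₂)))
            ≡⟨ cong₂ _⊕_
                 (cong₂ _⊖_
                   (cong₂ _⊗_ (cong₂ _⊗_ D*X (trans (sym (ιℕ-+ j l)) (cong ιℕ eq))) (sym (pad-suc (geg j) l)))
                   (cong (λ z → (K ⊗ (z ⊖ 1ℚ)) ⊗ e₂) (sym (mid-split j l eq))))
                 (trans (cong (_⊗ reduced (geg j) l) (sym (lead-+ j))) (zero-tail (lead j ⊗ reduced (geg j) l))) ⟩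
          (((A ⊗ ιℕ n) ⊗ pad (geg j) (suc l)) ⊖ ((K ⊗ (ιℕ (D * n) ⊖ 1ℚ)) ⊗ e₂))
            ⊕ ((lead j ⊗ reduced (geg j) l) ⊖ (0ℚ ⊗ delay (reduced (geg (suc j))) l)) ∎
          where
          d ιj ιl e₀ e₁ e₂ : ℚ
          d = ιℕ D
          ιj = ιℕ j
          ιl = ιℕ l
          e₀ = geg j l
          e₁ = delay (geg j) l
          e₂ = pad (geg j) l
          rec : ιl ⊗ e₀ ≡ ((ιj ⊕ ιl) ⊗ (X ⊗ e₁)) ⊕ (((ιj ⊕ ιj) ⊕ ιl) ⊗ ((⊝ K) ⊗ e₂))
          rec = trans (geg-recurrence j l) (cong₂ _⊕_ (cong (_⊗ (X ⊗ e₁)) (ιℕ-+ j l)) (cong (_⊗ ((⊝ K) ⊗ e₂)) (ιℕ-2j+l j l)))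
          zero-tail : ∀ x → x ≡ x ⊖ (0ℚ ⊗ delay (reduced (geg (suc j))) l)
          zero-tail x = sym (trans (cong (λ z → x ⊖ z) (ℚP.*-zeroˡ (delay (reduced (geg (suc j))) l))) (ℚP.+-identityʳ x))

    -- The substitution y = x / (1 + K x²) reduces the homogeneous equation to its case K = 0.
    module _ where
      open Gegenbauer 0ℚ (⊝ K)

      quadraticBasis : Basis
      quadraticBasis = record
        { e = geg ; τ = λ j → ιℕ (suc j) ⊗ A ; e-0 = geg-0 ; e-solves = solves }
        where
        solves : ∀ j → Solves j (pad (geg j)) (λ l → (lead j ⊗ reduced (geg j) l) ⊖ ((ιℕ (suc j) ⊗ A) ⊗ delay (reduced (geg (suc j))) l))
        solves j n l eq = begin
          lead n ⊗ e₀                               ≡⟨ cong (_⊗ e₀) (lead-split j l eq) ⟩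
          ((d ⊗ (ιj ⊕ ιl)) ⊕ 1ℚ) ⊗ e₀
            ≡⟨ solve 4 (λ d j l e → (d :* (j :+ l) :+ con 1ℚ) :* e := d :* (l :* e) :+ (d :* j :+ con 1ℚ) :* e) refl d ιj ιl e₀ ⟩
          (d ⊗ (ιl ⊗ e₀)) ⊕ (((d ⊗ ιj) ⊕ 1ℚ) ⊗ e₀)  ≡⟨ cong (λ z → (d ⊗ z) ⊕ (((d ⊗ ιj) ⊕ 1ℚ) ⊗ e₀)) rec ⟩
          (d ⊗ (((ιj ⊕ ιj) ⊕ ιl) ⊗ ((⊝ K) ⊗ e₂))) ⊕ (((d ⊗ ιj) ⊕ 1ℚ) ⊗ e₀)
            ≡⟨ solve 7 (λ d j l k w e₀ e₂ →
                 d :* (((j :+ j) :+ l) :* ((:- k) :* e₂)) :+ (d :* j :+ con 1ℚ) :* e₀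
                 := (w :- k :* (d :* (j :+ l) :- con 1ℚ) :* e₂) :+ ((d :* j :+ con 1ℚ) :* (e₀ :- k :* e₂) :- w))
                 refl d ιj ιl K w e₀ e₂ ⟩
          (w ⊖ ((K ⊗ ((d ⊗ (ιj ⊕ ιl)) ⊖ 1ℚ)) ⊗ e₂)) ⊕ ((((d ⊗ ιj) ⊕ 1ℚ) ⊗ (e₀ ⊖ (K ⊗ e₂))) ⊖ w)
            ≡⟨ cong₂ (λ u v → (w ⊖ ((K ⊗ (u ⊖ 1ℚ)) ⊗ e₂)) ⊕ ((v ⊗ reduced (geg j) l) ⊖ w)) (mid-split j l eq) (lead-+ j) ⟨
          (w ⊖ ((K ⊗ (ιℕ (D * n) ⊖ 1ℚ)) ⊗ e₂)) ⊕ ((lead j ⊗ reduced (geg j) l) ⊖ w)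
            ≡⟨ cong (λ z → (w ⊖ ((K ⊗ (ιℕ (D * n) ⊖ 1ℚ)) ⊗ e₂)) ⊕ ((lead j ⊗ reduced (geg j) l) ⊖ z)) (raise l eq) ⟩
          (((A ⊗ ιℕ n) ⊗ pad (geg j) (suc l)) ⊖ ((K ⊗ (ιℕ (D * n) ⊖ 1ℚ)) ⊗ e₂))
            ⊕ ((lead j ⊗ reduced (geg j) l) ⊖ ((ιℕ (suc j) ⊗ A) ⊗ delay (reduced (geg (suc j))) l)) ∎
          where
          d ιj ιl e₀ e₂ w : ℚ
          d = ιℕ D
          ιj = ιℕ j
          ιl = ιℕ l
          e₀ = geg j l
          e₂ = pad (geg j) l
          w = (A ⊗ ιℕ n) ⊗ pad (geg j) (suc l)
          rec : ιl ⊗ e₀ ≡ ((ιj ⊕ ιj) ⊕ ιl) ⊗ ((⊝ K) ⊗ e₂)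
          rec = trans (geg-recurrence j l) (trans
            (cong₂ _⊕_ (trans (cong (ιℕ (j + l) ⊗_) (ℚP.*-zeroˡ (delay (geg j) l))) (ℚP.*-zeroʳ (ιℕ (j + l))))
                       (cong (_⊗ ((⊝ K) ⊗ e₂)) (ιℕ-2j+l j l)))
            (ℚP.+-identityˡ (((ιj ⊕ ιj) ⊕ ιl) ⊗ ((⊝ K) ⊗ e₂))))
          -- The A-term of the recurrence has no counterpart in the recurrence of (1 + K x²)^-(j+1).
          -- The factor n = j + l in it raises the exponent and turns it into the τ-term with the
          -- next basis series.
          raise : ∀ l → j + l ≡ n →
            (A ⊗ ιℕ n) ⊗ pad (geg j) (suc l) ≡ (ιℕ (suc j) ⊗ A) ⊗ delay (reduced (geg (suc j))) l
          raise zero    eq = trans (ℚP.*-zeroʳ (A ⊗ ιℕ n)) (sym (ℚP.*-zeroʳ (ιℕ (suc j) ⊗ A)))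
          raise (suc l) eq = begin
            (A ⊗ ιℕ n) ⊗ geg j l                    ≡⟨ ℚP.*-assoc A (ιℕ n) (geg j l) ⟩
            A ⊗ (ιℕ n ⊗ geg j l)                    ≡⟨ cong (λ m → A ⊗ (ιℕ m ⊗ geg j l)) (trans (sym eq) (ℕP.+-suc j l)) ⟩
            A ⊗ (ιℕ (suc (j + l)) ⊗ geg j l)        ≡⟨ cong (A ⊗_) (geg-raise j l) ⟩
            A ⊗ (ιℕ (suc j) ⊗ (e₀′ ⊕ ((⊝ K) ⊗ e₂′)))
              ≡⟨ solve 5 (λ a j k x y → a :* (j :* (x :+ (:- k) :* y)) := (j :* a) :* (x :- k :* y)) refl A (ιℕ (suc j)) K e₀′ e₂′ ⟩
            (ιℕ (suc j) ⊗ A) ⊗ (e₀′ ⊖ (K ⊗ e₂′))    ∎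
            where
            e₀′ e₂′ : ℚ
            e₀′ = geg (suc j) l
            e₂′ = pad (geg (suc j)) l

-- Bounds for the solution at one prime, in either basis.

⌈i+2k/2⌉≤i+k : ∀ i k → ⌈ i + 2 * k /2⌉ ≤ i + k
⌈i+2k/2⌉≤i+k i k = ℕP.≤-trans (⌈+/2⌉-subadd i (2 * k)) (ℕP.+-mono-≤ (ℕP.⌈n/2⌉≤n i)
  (ℕP.≤-reflexive (trans (cong (λ z → ⌈ k + z /2⌉) (ℕP.+-identityʳ k)) (sym (ℕP.n≡⌈n+n/2⌉ k)))))

rise : ℕ → ℕ → ℕ
rise j zero    = 1
rise j (suc d) = suc j * rise (suc j) d

-- A product of d consecutive integers is an integer multiple of d!, so estimates for d! serve every
-- starting point j.
rise≡!*C : ∀ j d → rise j d ≡ d ! * ((j + d) C d)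
rise≡!*C j d = ℕP.*-cancelʳ-≡ _ _ (j !) {{j ℕP.!≢0}} (trans (rise*! j d)
  (trans (sym (C*!*! j d)) (ℕS′.solve 3 (λ c x y → c ℕS′.:* (x ℕS′.:* y) ℕS′.:= y ℕS′.:* c ℕS′.:* x) refl ((j + d) C d) (j !) (d !))))
  where
  module ℕS′ = ℕS.+-*-Solver
  rise*! : ∀ j d → rise j d * j ! ≡ (j + d) !
  rise*! j zero    = trans (ℕP.+-identityʳ (j !)) (cong _! (sym (ℕP.+-identityʳ j)))
  rise*! j (suc d) = trans (ℕS′.solve 3 (λ s r x → s ℕS′.:* r ℕS′.:* x ℕS′.:= r ℕS′.:* (s ℕS′.:* x)) refl (suc j) (rise (suc j) d) (j !))
    (trans (rise*! (suc j) d) (cong _! (sym (ℕP.+-suc j d))))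

module GegenbauerFiltration {p : ℕ} (pp : Prime p) (D : ℕ) (A : ℚ) {K κ X : ℚ} (K⊗κ : K ⊗ κ ≡ 1ℚ) (K∈ : Loc p K)
  (X∈ : Filt p κ 1 X) where

  open Filtration pp K⊗κ K∈
  open Recurrence D A K
  open Gegenbauer X (⊝ K)

  -- Every monomial X^i K^k with i + 2k = l lies in level i + k ≥ ⌈l/2⌉. The scalar ρ has to be
  -- integral only together with the trinomial coefficients; later it is 1/p.
  geg-filt : ∀ ρ j l → (∀ i k → i + 2 * k ≡ l → Loc p (ρ ⊗ ιℕ (trinom j i k))) → M ⌈ l /2⌉ (ρ ⊗ geg j l)
  geg-filt ρ j l coeff∈ = subst (M ⌈ l /2⌉) (Σ₂-⊗ ρ (monomial (trinom j)) l)
    (Σ₂-closed (M ⌈ l /2⌉) M-+ l (λ { i k refl →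
      M-mono (⌈i+2k/2⌉≤i+k i k) (subst (M (i + k)) (ℚP.*-assoc ρ (ιℕ (trinom j i k)) ((X ^ℚ i) ⊗ ((⊝ K) ^ℚ k)))
        (M-Loc (coeff∈ i k refl) (M-* (M-^ X∈ i) (M-^ (M-neg M-K) k)))) }))

  geg∈M : ∀ j l → M ⌈ l /2⌉ (geg j l)
  geg∈M j l = subst (M ⌈ l /2⌉) (ℚP.*-identityˡ (geg j l)) (geg-filt 1ℚ j l
    (λ i k _ → Loc-* pp (Loc-ℕ pp 1) (Loc-ℕ pp (trinom j i k))))

  private
    pad-geg∈M : ∀ j l → M ⌈ l /2⌉ (K ⊗ pad (geg j) l)
    pad-geg∈M j zero          = subst (M 0) (sym (ℚP.*-zeroʳ K)) (M-zero 0)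
    pad-geg∈M j (suc zero)    = subst (M 1) (sym (ℚP.*-zeroʳ K)) (M-zero 1)
    pad-geg∈M j (suc (suc l)) = M-* M-K (geg∈M j l)

  reduced-sub : ∀ {j x ρ} l → M ⌈ j + l /2⌉ x → M ⌈ j /2⌉ ρ → M ⌈ j + l /2⌉ (x ⊖ (ρ ⊗ reduced (geg j) l))
  reduced-sub {j} l mx mρ = M-+ mx (M-neg (M-mono (⌈+/2⌉-subadd j l)
    (M-* mρ (M-+ (geg∈M j l) (M-neg (pad-geg∈M j l))))))

module Local {p : ℕ} (pp : Prime p) (D : ℕ) (A : ℚ) {K κ : ℚ} (K⊗κ : K ⊗ κ ≡ 1ℚ) (K∈ : Loc p K)
  (v : ℕ → ℚ) (v₀∈ : Loc p (v 0)) (v₁∈ : Loc p (v 1))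
  (rec : ∀ n → 1 ≤ n → ιℕ (D * n + 1) ⊗ v (suc n)
           ≡ ((A ⊗ ιℕ n) ⊗ v n) ⊖ ((K ⊗ (ιℕ (D * n) ⊖ 1ℚ)) ⊗ v (n ∸ 1)))
  where

  open Filtration pp K⊗κ K∈
  open Recurrence D A K

  -- Dropping v 0 makes the recurrence hold from the origin, at the price of this right-hand side.
  private
    source : ℕ → ℚ
    source zero          = v 1
    source (suc zero)    = ⊝ ((K ⊗ (ιℕ (D * 1) ⊖ 1ℚ)) ⊗ v 0)
    source (suc (suc l)) = 0ℚ

    source∈M : ∀ l → M ⌈ l /2⌉ (source l)
    source∈M zero          = M-0 v₁∈
    source∈M (suc zero)    = M-neg (subst (M 1) (solve 3 (λ k d v → k :* (d :* v) := k :* d :* v) refl K (ιℕ (D * 1) ⊖ 1ℚ) (v 0))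
      (M-* M-K (M-0 (Loc-* pp (Loc-+ pp (Loc-ℕ pp (D * 1)) (Loc-neg pp (Loc-ℕ pp 1))) v₀∈))))
    source∈M (suc (suc l)) = M-zero ⌈ suc (suc l) /2⌉

    solves : (f : ℕ → ℚ) → Solves 0 (pad (λ n → v (suc n))) (λ l → source l ⊕ (0ℚ ⊗ f l))
    solves f n l refl = trans (base l) (cong (((A ⊗ ιℕ l) ⊗ pad (λ n → v (suc n)) (suc l)) ⊖ ((K ⊗ (ιℕ (D * l) ⊖ 1ℚ)) ⊗ pad (λ n → v (suc n)) l) ⊕_) (sym (trans (cong (source l ⊕_) (ℚP.*-zeroˡ (f l))) (ℚP.+-identityʳ (source l)))))
      where
      open ≡-Reasoning
      base : ∀ l → lead l ⊗ v (suc l)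
        ≡ (((A ⊗ ιℕ l) ⊗ pad (λ n → v (suc n)) (suc l)) ⊖ ((K ⊗ (ιℕ (D * l) ⊖ 1ℚ)) ⊗ pad (λ n → v (suc n)) l)) ⊕ source l
      base zero = begin
        lead 0 ⊗ v 1       ≡⟨ cong (λ z → ιℕ (z + 1) ⊗ v 1) (ℕP.*-zeroʳ D) ⟩
        1ℚ ⊗ v 1           ≡⟨ ℚP.*-identityˡ (v 1) ⟩
        v 1                ≡⟨ ℚP.+-identityˡ (v 1) ⟨
        (0ℚ ⊖ 0ℚ) ⊕ v 1    ≡⟨ cong (_⊕ v 1) (cong₂ _⊖_ (ℚP.*-zeroʳ (A ⊗ 0ℚ)) (ℚP.*-zeroʳ (K ⊗ (ιℕ (D * 0) ⊖ 1ℚ)))) ⟨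
        (((A ⊗ 0ℚ) ⊗ 0ℚ) ⊖ ((K ⊗ (ιℕ (D * 0) ⊖ 1ℚ)) ⊗ 0ℚ)) ⊕ v 1 ∎
      base (suc zero) = begin
        lead 1 ⊗ v 2       ≡⟨ rec 1 (s≤s z≤n) ⟩
        a ⊕ b              ≡⟨ cong (_⊕ b) (ℚP.+-identityʳ a) ⟨
        (a ⊖ 0ℚ) ⊕ b       ≡⟨ cong (λ z → (a ⊖ z) ⊕ b) (ℚP.*-zeroʳ k) ⟨
        (a ⊖ (k ⊗ 0ℚ)) ⊕ b ∎
        where
        a b k : ℚ
        k = K ⊗ (ιℕ (D * 1) ⊖ 1ℚ)
        a = (A ⊗ ιℕ 1) ⊗ v 1
        b = ⊝ (k ⊗ v 0)
      base (suc (suc l)) = trans (rec (suc (suc l)) (s≤s z≤n)) (sym (ℚP.+-identityʳ _))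

  module _ (N : ℕ) (δ : ℚ) where

    module _ {X : ℚ} (D*X : ιℕ D ⊗ X ≡ A) (X∈ : M 1 X) where
      open Gegenbauer X (⊝ K)
      open GegenbauerFiltration pp D A K⊗κ K∈ X∈

      -- As τ = 0, the numerators (D j + 1) c_j stay in level ⌈j/2⌉. What remains to be checked is
      -- one denominator D j + 1 at a time, against δ and the coefficients of Q^-(j+1).
      gegenbauer-bound : (∀ j l → j + l ≡ N → M ⌈ l /2⌉ ((δ ⊗ lead⁻¹ j) ⊗ geg j l)) → M ⌈ N /2⌉ (δ ⊗ v (suc N))
      gegenbauer-bound coeff∈ = eliminate N 0 (pad (λ n → v (suc n))) source 0ℚ refl refl refl source∈M (M-zero 0)
        (solves (reduced (geg 0)))
        where
        H⇒G : ∀ {j ρ} l → j + l ≡ N → M ⌈ j /2⌉ ρ → M ⌈ N /2⌉ (δ ⊗ ((ρ ⊗ lead⁻¹ j) ⊗ geg j l))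
        H⇒G {j} {ρ} l refl mρ = M-mono (⌈+/2⌉-subadd j l) (subst (M (⌈ j /2⌉ + ⌈ l /2⌉))
          (solve 4 (λ d r u e → r :* ((d :* u) :* e) := d :* ((r :* u) :* e)) refl δ ρ (lead⁻¹ j) (geg j l))
          (M-* mρ (coeff∈ j l refl)))
        H-next : ∀ {j ρ} → M ⌈ j /2⌉ ρ → M ⌈ suc j /2⌉ ((ρ ⊗ lead⁻¹ j) ⊗ 0ℚ)
        H-next {j} {ρ} _ = subst (M ⌈ suc j /2⌉) (sym (ℚP.*-zeroʳ (ρ ⊗ lead⁻¹ j))) (M-zero ⌈ suc j /2⌉)
        G-⊕ : ∀ {x y} → M ⌈ N /2⌉ (δ ⊗ x) → M ⌈ N /2⌉ (δ ⊗ y) → M ⌈ N /2⌉ (δ ⊗ (x ⊕ y))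
        G-⊕ {x} {y} mx my = subst (M ⌈ N /2⌉) (sym (ℚP.*-distribˡ-+ δ x y)) (M-+ mx my)
        open Eliminate (gegenbauerBasis D*X) N (λ n → M ⌈ n /2⌉) (λ j → M ⌈ j /2⌉) (λ x → M ⌈ N /2⌉ (δ ⊗ x))
          reduced-sub id M-+ H-next G-⊕ H⇒G

    module _ (ε : ℚ) (δ∈ : Loc p δ) (lead⁻¹∈ : ∀ j → Loc p (lead⁻¹ j)) where
      open Gegenbauer 0ℚ (⊝ K)
      open GegenbauerFiltration pp D A K⊗κ K∈ (M-zero 1)

      -- The factor ε pays in advance for the denominator of A/K, once for the whole expansion
      -- rather than at each step.
      quadratic-bound : (∀ d → d ≤ N → M ⌈ d /2⌉ (ε ⊗ (ιℕ (d !) ⊗ (A ^ℚ d)))) → M ⌈ N /2⌉ ((ε ⊗ δ) ⊗ v (suc N))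
      quadratic-bound fact∈ = eliminate N 0 (pad (λ n → v (suc n))) source 0ℚ refl refl refl source∈M
        (R⇒H {0} (M-zero 0)) (solves (reduced (geg 0)))
        where
        -- A bound on β alone would not survive a step, since A need not lie in level 1. So `H`
        -- bounds at once all products of β with (j + 1) ⋯ (j + d) A^d that the next d steps can
        -- produce, up to units.
        H : ℕ → ℚ → Set
        H j β = ∀ d → j + d ≤ N → M ⌈ j + d /2⌉ (ε ⊗ ((ιℕ (rise j d) ⊗ (A ^ℚ d)) ⊗ β))
        R⇒H : ∀ {j x} → M ⌈ j /2⌉ x → H j x
        R⇒H {j} {x} mx d j+d≤N = M-mono (⌈+/2⌉-subadd j d) (subst (M (⌈ j /2⌉ + ⌈ d /2⌉)) factor
          (M-* (M-Loc (Loc-ℕ pp ((j + d) C d)) mx) (fact∈ d (ℕP.≤-trans (ℕP.m≤n+m d j) j+d≤N))))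
          where
          factor : (ιℕ ((j + d) C d) ⊗ x) ⊗ (ε ⊗ (ιℕ (d !) ⊗ (A ^ℚ d))) ≡ ε ⊗ ((ιℕ (rise j d) ⊗ (A ^ℚ d)) ⊗ x)
          factor = trans
            (solve 5 (λ c x e f a → (c :* x) :* (e :* (f :* a)) := e :* (((f :* c) :* a) :* x)) refl (ιℕ ((j + d) C d)) x ε (ιℕ (d !)) (A ^ℚ d))
            (cong (λ z → ε ⊗ ((z ⊗ (A ^ℚ d)) ⊗ x)) (sym (trans (cong ιℕ (rise≡!*C j d)) (ιℕ-* (d !) ((j + d) C d)))))
        H-⊕ : ∀ {j x y} → H j x → H j y → H j (x ⊕ y)
        H-⊕ {j} {x} {y} hx hy d le = subst (M ⌈ j + d /2⌉)
          (solve 4 (λ e r x y → e :* (r :* x) :+ e :* (r :* y) := e :* (r :* (x :+ y))) refl ε (ιℕ (rise j d) ⊗ (A ^ℚ d)) x y)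
          (M-+ (hx d le) (hy d le))
        H-next : ∀ {j ρ} → H j ρ → H (suc j) ((ρ ⊗ lead⁻¹ j) ⊗ (ιℕ (suc j) ⊗ A))
        H-next {j} {ρ} h d le = subst₂ M (cong ⌈_/2⌉ (ℕP.+-suc j d)) factor
          (M-Loc (lead⁻¹∈ j) (h (suc d) (subst (_≤ N) (sym (ℕP.+-suc j d)) le)))
          where
          r = rise (suc j) d
          factor : lead⁻¹ j ⊗ (ε ⊗ ((ιℕ (suc j * r) ⊗ (A ⊗ (A ^ℚ d))) ⊗ ρ))
            ≡ ε ⊗ ((ιℕ r ⊗ (A ^ℚ d)) ⊗ ((ρ ⊗ lead⁻¹ j) ⊗ (ιℕ (suc j) ⊗ A)))
          factor = trans (cong (λ z → lead⁻¹ j ⊗ (ε ⊗ ((z ⊗ (A ⊗ (A ^ℚ d))) ⊗ ρ))) (ιℕ-* (suc j) r))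
            (solve 7 (λ u e s r a b x → u :* (e :* (((s :* r) :* (a :* b)) :* x)) := e :* ((r :* b) :* ((x :* u) :* (s :* a)))) refl
              (lead⁻¹ j) ε (ιℕ (suc j)) (ιℕ r) A (A ^ℚ d) ρ)
        H⇒G : ∀ {j ρ} l → j + l ≡ N → H j ρ → M ⌈ N /2⌉ ((ε ⊗ δ) ⊗ ((ρ ⊗ lead⁻¹ j) ⊗ geg j l))
        H⇒G {j} {ρ} l refl h = M-mono (⌈+/2⌉-subadd j l) (subst (M (⌈ j /2⌉ + ⌈ l /2⌉)) factor
          (M-* (M-Loc (Loc-* pp δ∈ (lead⁻¹∈ j))
                 (subst (λ k → M ⌈ k /2⌉ (ε ⊗ ((1ℚ ⊗ 1ℚ) ⊗ ρ))) (ℕP.+-identityʳ j)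
                   (h 0 (subst (_≤ j + l) (sym (ℕP.+-identityʳ j)) (ℕP.m≤m+n j l)))))
               (geg∈M j l)))
          where
          factor : ((δ ⊗ lead⁻¹ j) ⊗ (ε ⊗ ((1ℚ ⊗ 1ℚ) ⊗ ρ))) ⊗ geg j l ≡ (ε ⊗ δ) ⊗ ((ρ ⊗ lead⁻¹ j) ⊗ geg j l)
          factor = trans (cong (λ z → ((δ ⊗ lead⁻¹ j) ⊗ (ε ⊗ z)) ⊗ geg j l) (ℚP.*-identityˡ ρ))
            (solve 5 (λ d u e r g → ((d :* u) :* (e :* r)) :* g := (e :* d) :* ((r :* u) :* g)) refl δ (lead⁻¹ j) ε ρ (geg j l))
        G-⊕ : ∀ {x y} → M ⌈ N /2⌉ ((ε ⊗ δ) ⊗ x) → M ⌈ N /2⌉ ((ε ⊗ δ) ⊗ y) → M ⌈ N /2⌉ ((ε ⊗ δ) ⊗ (x ⊕ y))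
        G-⊕ {x} {y} mx my = subst (M ⌈ N /2⌉) (sym (ℚP.*-distribˡ-+ (ε ⊗ δ) x y)) (M-+ mx my)
        open Eliminate quadraticBasis N (λ n → M ⌈ n /2⌉) H (λ x → M ⌈ N /2⌉ ((ε ⊗ δ) ⊗ x))
          reduced-sub R⇒H H-⊕ H-next G-⊕ H⇒G

-- Fractional parts and the residue of n modulo a prime of 𝒫_n.

ιℤ-cancel-≤ : ∀ {a b} → ιℤ a ℚ.≤ ιℤ b → a ℤ.≤ b
ιℤ-cancel-≤ {a} {b} le with ℚᵘP.≤-trans (ℚᵘP.≤-reflexive (ℚᵘP.≃-sym (toℚᵘ-ιℤ a)))
                              (ℚᵘP.≤-trans (ℚP.toℚᵘ-mono-≤ le) (ℚᵘP.≤-reflexive (toℚᵘ-ιℤ b)))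
... | *≤* h = subst₂ ℤ._≤_ (ℤP.*-identityʳ a) (ℤP.*-identityʳ b) h

ιℤ-cancel-< : ∀ {a b} → ιℤ a ℚ.< ιℤ b → a ℤ.< b
ιℤ-cancel-< {a} {b} lt with ℚᵘP.≤-<-trans (ℚᵘP.≤-reflexive (ℚᵘP.≃-sym (toℚᵘ-ιℤ a)))
                              (ℚᵘP.<-≤-trans (ℚP.toℚᵘ-mono-< lt) (ℚᵘP.≤-reflexive (toℚᵘ-ιℤ b)))
... | *<* h = subst₂ ℤ._<_ (ℤP.*-identityʳ a) (ℤP.*-identityʳ b) h

floor≤ : ∀ q → ιℤ (floor q) ℚ.≤ q
floor≤ q@(mkℚ n d-1 _) = ℚP.toℚᵘ-cancel-≤ (ℚᵘP.≤-trans (ℚᵘP.≤-reflexive (toℚᵘ-ιℤ (floor q)))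
  (*≤* (ℤP.≤-trans (ℤD.[n/d]*d≤n n (+ suc d-1)) (ℤP.≤-reflexive (sym (ℤP.*-identityʳ n))))))

<suc-floor : ∀ q → q ℚ.< ιℤ (1ℤ ℤ.+ floor q)
<suc-floor q@(mkℚ n d-1 _) = ℚP.toℚᵘ-cancel-< (ℚᵘP.<-≤-trans
  (*<* (subst (n ℤ.* 1ℤ ℤ.<_) (cong (λ z → (1ℤ ℤ.+ z) ℤ.* + suc d-1) (sym (ℤD.div-pos-is-/ℕ n (suc d-1))))
    (subst (ℤ._< (1ℤ ℤ.+ n ℤD./ℕ suc d-1) ℤ.* + suc d-1) (sym (ℤP.*-identityʳ n)) (ℤD.n<s[n/ℕd]*d n (suc d-1)))))
  (ℚᵘP.≤-reflexive (ℚᵘP.≃-sym (toℚᵘ-ιℤ (1ℤ ℤ.+ floor q)))))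

0≤frac : ∀ q → 0ℚ ℚ.≤ frac q
0≤frac q = subst (ℚ._≤ frac q) (ℚP.+-inverseʳ (ιℤ (floor q))) (ℚP.+-monoˡ-≤ (⊝ ιℤ (floor q)) (floor≤ q))

frac<1 : ∀ q → frac q ℚ.< 1ℚ
frac<1 q = subst (frac q ℚ.<_)
  (trans (cong (_⊖ ιℤ (floor q)) (ιℤ-+ 1ℤ (floor q))) (solve 2 (λ o x → (o :+ x) :- x := o) refl 1ℚ (ιℤ (floor q))))
  (ℚP.+-monoˡ-< (⊝ ιℤ (floor q)) (<suc-floor q))

-- With c = D p all quantities in the conditions of 𝒫_n become integers.
module Scaled (c : ℕ) .{{_ : NonZero c}} where
  infix 4 _≈_
  _≈_ : ℚ → ℤ → Set
  x ≈ a = ιℕ c ⊗ x ≡ ιℤ a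

  ≤-scaled : ∀ {x y a b} → x ≈ a → y ≈ b → x ℚ.≤ y → a ℤ.≤ b
  ≤-scaled xa yb x≤y = ιℤ-cancel-≤ (subst₂ ℚ._≤_ xa yb (ℚP.*-monoˡ-≤-nonNeg (ιℕ c) {{ℚP.normalize-nonNeg c 1}} x≤y))

  <-scaled : ∀ {x y a b} → x ≈ a → y ≈ b → x ℚ.< y → a ℤ.< b
  <-scaled xa yb x<y = ιℤ-cancel-< (subst₂ ℚ._<_ xa yb (ℚP.*-monoʳ-<-pos (ιℕ c) {{ℚP.normalize-pos c 1}} x<y))

  ≈-sub : ∀ {x y a b} → x ≈ a → y ≈ b → x ⊖ y ≈ a ℤ.- b
  ≈-sub {x} {y} {a} {b} xa yb = trans (solve 3 (λ c x y → c :* (x :- y) := c :* x :- c :* y) refl (ιℕ c) x y)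
    (trans (cong₂ _⊖_ xa yb) (trans (cong (ιℤ a ⊕_) (sym (ιℤ-neg b))) (sym (ιℤ-+ a (ℤ.- b)))))

  ≈-ιℤ : ∀ z → ιℤ z ≈ + c ℤ.* z
  ≈-ιℤ z = sym (ιℤ-* (+ c) z)

  ≈-frac : ∀ {x a} → x ≈ a → frac x ≈ a ℤ.- + c ℤ.* floor x
  ≈-frac {x} {a} xa = ≈-sub {x} {ιℤ (floor x)} {a} {+ c ℤ.* floor x} xa (≈-ιℤ (floor x))

module _ where
  open ℤS.+-*-Solver using () renaming (solve to solveℤ; _:=_ to _:=ℤ_; _:+_ to _:+ℤ_; _:*_ to _:*ℤ_; _:-_ to _:-ℤ_; :-_ to :-ℤ_; con to conℤ)

  private
    0≤+ : ∀ {a b c} → 0ℤ ℤ.≤ a → 0ℤ ℤ.≤ b → a ℤ.+ b ≡ c → 0ℤ ℤ.≤ c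
    0≤+ 0≤a 0≤b refl = ℤP.+-mono-≤ 0≤a 0≤b

    ≤⇒0≤- : ∀ {a b} → a ℤ.≤ b → 0ℤ ℤ.≤ b ℤ.- a
    ≤⇒0≤- = ℤP.i≤j⇒0≤j-i

    <⇒0≤- : ∀ {a b} → a ℤ.< b → 0ℤ ℤ.≤ b ℤ.- (1ℤ ℤ.+ a)
    <⇒0≤- a<b = ℤP.i≤j⇒0≤j-i (ℤP.i<j⇒suc[i]≤j a<b)

    -- From k m > -k follows m > -1: division by k of an integer inequality with a slack below k.
    cancel-nonneg : ∀ k m → 0ℤ ℤ.≤ k ℤ.- 1ℤ → 0ℤ ℤ.≤ k ℤ.* m ℤ.+ (k ℤ.- 1ℤ) → 0ℤ ℤ.≤ m
    cancel-nonneg k         (+ m)      _  _ = ℤ.+≤+ z≤n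
    cancel-nonneg ℤ.+[1+ k ] ℤ.-[1+ m ] _  h = ⊥-elim (absurd (0≤+ h (subst (0ℤ ℤ.≤_) (ℤP.pos-* (suc k) m) (ℤ.+≤+ z≤n))
      (solveℤ 2 (λ k m → (k :*ℤ (:-ℤ (conℤ 1ℤ :+ℤ m)) :+ℤ (k :-ℤ conℤ 1ℤ)) :+ℤ k :*ℤ m :=ℤ conℤ (ℤ.- 1ℤ)) refl (+ suc k) (+ m))))
      where
      absurd : ¬ (0ℤ ℤ.≤ ℤ.- 1ℤ)
      absurd ()

  -- F and G are the floors of the two fractions defining 𝒫_n, and a, b are D P times their
  -- fractional parts. Since P + 1 = D Q, the inequalities can be divided by D. The point is that F
  -- = G, so that both conditions restrict the same residue n - P G.
  window-ℤ : ∀ {D P Q n F G} → P ≡ D ℤ.* Q ℤ.- 1ℤ →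
    0ℤ ℤ.≤ D ℤ.- + 2 → 0ℤ ℤ.≤ P ℤ.- 1ℤ → 0ℤ ℤ.≤ Q ℤ.- 1ℤ → 0ℤ ℤ.≤ n →
    let c = D ℤ.* P; a = (D ℤ.* (n ℤ.+ 1ℤ) ℤ.- 1ℤ) ℤ.- c ℤ.* F; b = (D ℤ.* n ℤ.+ 1ℤ) ℤ.- c ℤ.* G in
    P ℤ.≤ a → a ℤ.< c → b ℤ.< c ℤ.- P → 0ℤ ℤ.≤ b →
    0ℤ ℤ.≤ G × 0ℤ ℤ.≤ n ℤ.- P ℤ.* G ×
    0ℤ ℤ.≤ ((n ℤ.- P ℤ.* G) ℤ.+ 1ℤ) ℤ.- Q × 0ℤ ℤ.≤ (P ℤ.- 1ℤ) ℤ.- ((n ℤ.- P ℤ.* G) ℤ.+ Q)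
  window-ℤ {D} {P} {Q} {n} {F} {G} refl D≥2 P≥1 Q≥1 n≥0 h₁ h₂ h₃ h₄ = G≥0 , e₄ , subst (λ z → 0ℤ ℤ.≤ ((n ℤ.- P ℤ.* z) ℤ.+ 1ℤ) ℤ.- Q) F≡G e₁ , e₃
    where
    D≥1 : 0ℤ ℤ.≤ D ℤ.- 1ℤ
    D≥1 = 0≤+ D≥2 (ℤ.+≤+ (z≤n {1})) (solveℤ 1 (λ d → (d :-ℤ conℤ (+ 2)) :+ℤ conℤ 1ℤ :=ℤ d :-ℤ conℤ 1ℤ) refl D)
    e₁ : 0ℤ ℤ.≤ ((n ℤ.- P ℤ.* F) ℤ.+ 1ℤ) ℤ.- Q
    e₁ = cancel-nonneg D _ D≥1 (0≤+ (≤⇒0≤- h₁) D≥1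
      (solveℤ 4 (λ d q n f → let p = d :*ℤ q :-ℤ conℤ 1ℤ in
        (((d :*ℤ (n :+ℤ conℤ 1ℤ) :-ℤ conℤ 1ℤ) :-ℤ (d :*ℤ p) :*ℤ f) :-ℤ p) :+ℤ (d :-ℤ conℤ 1ℤ)
        :=ℤ d :*ℤ (((n :-ℤ p :*ℤ f) :+ℤ conℤ 1ℤ) :-ℤ q) :+ℤ (d :-ℤ conℤ 1ℤ)) refl D Q n F))
    e₂ : 0ℤ ℤ.≤ P ℤ.- ((n ℤ.- P ℤ.* F) ℤ.+ 1ℤ)
    e₂ = cancel-nonneg D _ D≥1 (0≤+ (<⇒0≤- h₂) D≥1
      (solveℤ 4 (λ d q n f → let p = d :*ℤ q :-ℤ conℤ 1ℤ in
        ((d :*ℤ p) :-ℤ (conℤ 1ℤ :+ℤ ((d :*ℤ (n :+ℤ conℤ 1ℤ) :-ℤ conℤ 1ℤ) :-ℤ (d :*ℤ p) :*ℤ f))) :+ℤ (d :-ℤ conℤ 1ℤ)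
        :=ℤ d :*ℤ (p :-ℤ ((n :-ℤ p :*ℤ f) :+ℤ conℤ 1ℤ)) :+ℤ (d :-ℤ conℤ 1ℤ)) refl D Q n F))
    e₃ : 0ℤ ℤ.≤ (P ℤ.- 1ℤ) ℤ.- ((n ℤ.- P ℤ.* G) ℤ.+ Q)
    e₃ = cancel-nonneg D _ D≥1 (0≤+ (<⇒0≤- h₃) (ℤ.+≤+ (z≤n {0}))
      (solveℤ 4 (λ d q n g → let p = d :*ℤ q :-ℤ conℤ 1ℤ in
        (((d :*ℤ p) :-ℤ p) :-ℤ (conℤ 1ℤ :+ℤ ((d :*ℤ n :+ℤ conℤ 1ℤ) :-ℤ (d :*ℤ p) :*ℤ g))) :+ℤ conℤ 0ℤ
        :=ℤ d :*ℤ ((p :-ℤ conℤ 1ℤ) :-ℤ ((n :-ℤ p :*ℤ g) :+ℤ q)) :+ℤ (d :-ℤ conℤ 1ℤ)) refl D Q n G))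
    -- From b ≥ 0 one has D m ≥ -1 for m = n - P G, and D ≥ 2 excludes m = -1.
    e₄ : 0ℤ ℤ.≤ n ℤ.- P ℤ.* G
    e₄ = cancel-nonneg D _ D≥1 (0≤+ h₄ D≥2
      (solveℤ 4 (λ d q n g → let p = d :*ℤ q :-ℤ conℤ 1ℤ in
        ((d :*ℤ n :+ℤ conℤ 1ℤ) :-ℤ (d :*ℤ p) :*ℤ g) :+ℤ (d :-ℤ conℤ (+ 2))
        :=ℤ d :*ℤ (n :-ℤ p :*ℤ g) :+ℤ (d :-ℤ conℤ 1ℤ)) refl D Q n G))
    -- `e₁` and `e₃` add up to P (G - F) ≥ 2 Q - P > -P.
    F≤G : 0ℤ ℤ.≤ G ℤ.- F
    F≤G = cancel-nonneg P _ P≥1 (0≤+ (0≤+ e₁ e₃ refl) (0≤+ (0≤+ Q≥1 Q≥1 refl) (ℤ.+≤+ (z≤n {1})) refl)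
      (solveℤ 5 (λ p q n f g →
        ((((n :-ℤ p :*ℤ f) :+ℤ conℤ 1ℤ) :-ℤ q) :+ℤ ((p :-ℤ conℤ 1ℤ) :-ℤ ((n :-ℤ p :*ℤ g) :+ℤ q)))
          :+ℤ (((q :-ℤ conℤ 1ℤ) :+ℤ (q :-ℤ conℤ 1ℤ)) :+ℤ conℤ 1ℤ)
        :=ℤ p :*ℤ (g :-ℤ f) :+ℤ (p :-ℤ conℤ 1ℤ)) refl P Q n F G))
    -- `e₂` and `e₄` add up to P (F - G) ≥ 1 - P.
    G≤F : 0ℤ ℤ.≤ F ℤ.- G
    G≤F = cancel-nonneg P _ P≥1 (0≤+ e₂ e₄
      (solveℤ 4 (λ p n f g → (p :-ℤ ((n :-ℤ p :*ℤ f) :+ℤ conℤ 1ℤ)) :+ℤ (n :-ℤ p :*ℤ g)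
        :=ℤ p :*ℤ (f :-ℤ g) :+ℤ (p :-ℤ conℤ 1ℤ)) refl P n F G))
    F≡G : F ≡ G
    F≡G = ℤP.≤-antisym (ℤP.0≤i-j⇒j≤i F≤G) (ℤP.0≤i-j⇒j≤i G≤F)
    G≥0 : 0ℤ ℤ.≤ G
    G≥0 = cancel-nonneg P _ P≥1 (0≤+ e₃ (0≤+ n≥0 (0≤+ Q≥1 (ℤ.+≤+ (z≤n {1})) refl) refl)
      (solveℤ 4 (λ p q n g → ((p :-ℤ conℤ 1ℤ) :-ℤ ((n :-ℤ p :*ℤ g) :+ℤ q)) :+ℤ (n :+ℤ ((q :-ℤ conℤ 1ℤ) :+ℤ conℤ 1ℤ))
        :=ℤ p :*ℤ g :+ℤ (p :-ℤ conℤ 1ℤ)) refl P Q n G))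

module _ where
  private
    ∧-split : ∀ {a b} → a ∧ b ≡ true → a ≡ true × b ≡ true
    ∧-split {true} eq = refl , eq

    from-isYes : ∀ {P : Set} (d : Dec P) → isYes d ≡ true → P
    from-isYes (yes p) _ = p

  -- 𝒫_n in terms of q = (p + 1)/D and of the residue r of n modulo p.
  inP⇒window : ∀ D .{{_ : NonZero D}} → 2 ≤ D → ∀ n p .{{_ : NonZero p}} → inP D n p ≡ true →
    Prime p × ∃ λ q → ∃₂ λ r g → p + 1 ≡ D * q × n ≡ r + g * p × 1 ≤ q × q ≤ suc r × r + q < p
  inP⇒window D 2≤D n p isP
    = pp , q , unpack (floor Y) (+ n ℤ.- + p ℤ.* floor Y) refl (proj₁ bounds) (proj₁ (proj₂ bounds))
        (proj₁ (proj₂ (proj₂ bounds))) (proj₂ (proj₂ (proj₂ bounds)))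
    where
    open Scaled (D * p) {{ℕP.m*n≢0 D p}}
    isP₂ = proj₂ (∧-split {2 * D * n ℕ.<ᵇ p * p} (proj₂ (∧-split {not (D ℕ.≡ᵇ 2)} isP)))
    prime = proj₁ (∧-split {isYes (prime? p)} isP₂)
    isP₃ = proj₂ (∧-split {isYes (prime? p)} isP₂)
    D∣p+1 = proj₁ (∧-split {isYes (D ∣? p + 1)} isP₃)
    isP₆ = proj₂ (∧-split {not (isYes (p ∣? n + 1))} (proj₂ (∧-split {not (p ℕ.≡ᵇ D ∸ 1)} (proj₂ (∧-split {isYes (D ∣? p + 1)} isP₃)))))
    lower = proj₁ (∧-split {isYes (((+ 1) ℚ./ D) ℚP.≤? frac ((ιℕ (n + 1) ⊖ ((+ 1) ℚ./ D)) ⊗ ((+ 1) ℚ./ p)))} isP₆)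
    upper = proj₂ (∧-split {isYes (((+ 1) ℚ./ D) ℚP.≤? frac ((ιℕ (n + 1) ⊖ ((+ 1) ℚ./ D)) ⊗ ((+ 1) ℚ./ p)))} isP₆)
    pp : Prime p
    pp = from-isYes (prime? p) prime

    D∣ : D ∣ p + 1
    D∣ = from-isYes (D ∣? p + 1) D∣p+1
    q : ℕ
    q = quotient D∣
    p+1≡ : p + 1 ≡ D * q
    p+1≡ = m∣n⇒n≡m*quotient D∣
    1≤q : 1 ≤ q
    1≤q = ℕP.n≢0⇒n>0 (λ q≡0 → ℕP.1+n≢0 (trans (ℕP.+-comm 1 p) (trans p+1≡ (trans (cong (D *_) q≡0) (ℕP.*-zeroʳ D)))))
    0≤- : ∀ {a b} → a ≤ b → 0ℤ ℤ.≤ + b ℤ.- + a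
    0≤- a≤b = ℤP.i≤j⇒0≤j-i (ℤ.+≤+ a≤b)
    P≡ : + p ≡ + D ℤ.* + q ℤ.- 1ℤ
    P≡ = trans (trans (sym (ℤP.+-identityʳ (+ p))) (sym (ℤP.+-assoc (+ p) 1ℤ (ℤ.- 1ℤ))))
      (cong (λ z → z ℤ.- 1ℤ) (trans (cong +_ p+1≡) (ℤP.pos-* D q)))
    u w X Y : ℚ
    u = (+ 1) ℚ./ D
    w = (+ 1) ℚ./ p
    X = (ιℕ (n + 1) ⊖ u) ⊗ w
    Y = (ιℕ n ⊕ u) ⊗ w
    D*u : ιℕ D ⊗ u ≡ 1ℚ
    D*u = trans (cong (ιℕ D ⊗_) (/≡recip D)) (ιℕ*recip D)
    p*w : ιℕ p ⊗ w ≡ 1ℚ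
    p*w = trans (cong (ιℕ p ⊗_) (/≡recip p)) (ιℕ*recip p)
    scaled-u : u ≈ + p
    scaled-u = trans (cong (_⊗ u) (ιℕ-* D p))
      (trans (solve 3 (λ d p u → (d :* p) :* u := (d :* u) :* p) refl (ιℕ D) (ιℕ p) u)
      (trans (cong (_⊗ ιℕ p) D*u) (ℚP.*-identityˡ (ιℕ p))))
    clear : ∀ x → ιℕ (D * p) ⊗ (x ⊗ w) ≡ ιℕ D ⊗ x
    clear x = trans (cong (_⊗ (x ⊗ w)) (ιℕ-* D p))
      (trans (solve 4 (λ d p x w → (d :* p) :* (x :* w) := (p :* w) :* (d :* x)) refl (ιℕ D) (ιℕ p) x w)
      (trans (cong (_⊗ (ιℕ D ⊗ x)) p*w) (ℚP.*-identityˡ (ιℕ D ⊗ x))))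
    scaled-X : X ≈ + D ℤ.* (+ n ℤ.+ 1ℤ) ℤ.- 1ℤ
    scaled-X = trans (clear (ιℕ (n + 1) ⊖ u))
      (trans (solve 3 (λ d x u → d :* (x :- u) := d :* x :- d :* u) refl (ιℕ D) (ιℕ (n + 1)) u)
      (trans (cong₂ _⊖_ (sym (ιℤ-* (+ D) (+ n ℤ.+ 1ℤ))) D*u)
      (sym (ιℤ-+ (+ D ℤ.* (+ n ℤ.+ 1ℤ)) (ℤ.- 1ℤ)))))
    scaled-Y : Y ≈ + D ℤ.* + n ℤ.+ 1ℤ
    scaled-Y = trans (clear (ιℕ n ⊕ u))
      (trans (ℚP.*-distribˡ-+ (ιℕ D) (ιℕ n) u)
      (trans (cong₂ _⊕_ (sym (ιℤ-* (+ D) (+ n))) D*u)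
      (sym (ιℤ-+ (+ D ℤ.* + n) 1ℤ))))
    c≡ : + (D * p) ≡ + D ℤ.* + p
    c≡ = ℤP.pos-* D p
    scaled-1 : 1ℚ ≈ + D ℤ.* + p
    scaled-1 = trans (ℚP.*-identityʳ (ιℕ (D * p))) (cong ιℤ c≡)
    scaled-fX : frac X ≈ (+ D ℤ.* (+ n ℤ.+ 1ℤ) ℤ.- 1ℤ) ℤ.- (+ D ℤ.* + p) ℤ.* floor X
    scaled-fX = trans (≈-frac {X} {+ D ℤ.* (+ n ℤ.+ 1ℤ) ℤ.- 1ℤ} scaled-X)
      (cong (λ c → ιℤ ((+ D ℤ.* (+ n ℤ.+ 1ℤ) ℤ.- 1ℤ) ℤ.- c ℤ.* floor X)) c≡)
    scaled-fY : frac Y ≈ (+ D ℤ.* + n ℤ.+ 1ℤ) ℤ.- (+ D ℤ.* + p) ℤ.* floor Y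
    scaled-fY = trans (≈-frac {Y} {+ D ℤ.* + n ℤ.+ 1ℤ} scaled-Y)
      (cong (λ c → ιℤ ((+ D ℤ.* + n ℤ.+ 1ℤ) ℤ.- c ℤ.* floor Y)) c≡)
    h₁ : + p ℤ.≤ (+ D ℤ.* (+ n ℤ.+ 1ℤ) ℤ.- 1ℤ) ℤ.- (+ D ℤ.* + p) ℤ.* floor X
    h₁ = ≤-scaled {u} {frac X} scaled-u scaled-fX (from-isYes (u ℚP.≤? frac X) lower)
    h₂ : (+ D ℤ.* (+ n ℤ.+ 1ℤ) ℤ.- 1ℤ) ℤ.- (+ D ℤ.* + p) ℤ.* floor X ℤ.< + D ℤ.* + p
    h₂ = <-scaled {frac X} {1ℚ} scaled-fX scaled-1 (frac<1 X)
    h₃ : (+ D ℤ.* + n ℤ.+ 1ℤ) ℤ.- (+ D ℤ.* + p) ℤ.* floor Y ℤ.< + D ℤ.* + p ℤ.- + p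
    h₃ = <-scaled {frac Y} {1ℚ ⊖ u} scaled-fY (≈-sub {1ℚ} {u} {+ D ℤ.* + p} {+ p} scaled-1 scaled-u)
      (from-isYes (frac Y ℚP.<? (1ℚ ⊖ u)) upper)
    h₄ : 0ℤ ℤ.≤ (+ D ℤ.* + n ℤ.+ 1ℤ) ℤ.- (+ D ℤ.* + p) ℤ.* floor Y
    h₄ = ≤-scaled {0ℚ} {frac Y} {0ℤ} (ℚP.*-zeroʳ (ιℕ (D * p))) scaled-fY (0≤frac Y)
    bounds = window-ℤ {+ D} {+ p} {+ q} {+ n} {floor X} {floor Y} P≡
      (0≤- 2≤D) (0≤- (ℕ.>-nonZero⁻¹ p)) (0≤- 1≤q) (ℤ.+≤+ z≤n) h₁ h₂ h₃ h₄
    unpack : ∀ G z → z ≡ + n ℤ.- + p ℤ.* G → 0ℤ ℤ.≤ G → 0ℤ ℤ.≤ z →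
      0ℤ ℤ.≤ (z ℤ.+ 1ℤ) ℤ.- + q → 0ℤ ℤ.≤ (+ p ℤ.- 1ℤ) ℤ.- (z ℤ.+ + q) →
      ∃₂ λ r g → p + 1 ≡ D * q × n ≡ r + g * p × 1 ≤ q × q ≤ suc r × r + q < p
    unpack (+ g) (+ r) eq _ _ e₁ e₃ = r , g , p+1≡ , n≡ , 1≤q , q≤ , <p
      where
      n≡ : n ≡ r + g * p
      n≡ = ℤP.+-injective (trans (sym (ℤP.+-identityʳ (+ n))) (trans (cong (λ z → + n ℤ.+ z) (sym (ℤP.+-inverseˡ (+ p ℤ.* + g))))
        (trans (sym (ℤP.+-assoc (+ n) (ℤ.- (+ p ℤ.* + g)) (+ p ℤ.* + g)))
        (trans (cong (λ z → z ℤ.+ + p ℤ.* + g) (sym eq)) (trans (cong (λ z → + r ℤ.+ z) (trans (sym (ℤP.pos-* p g)) (cong +_ (ℕP.*-comm p g))))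
          (sym (ℤP.pos-+ r (g * p))))))))
      q≤ : q ≤ suc r
      q≤ = subst (q ≤_) (ℕP.+-comm r 1) (ℤP.drop‿+≤+ (ℤP.0≤i-j⇒j≤i e₁))
      <p : r + q < p
      <p = ℤP.drop‿+≤+ (ℤP.≤-trans (ℤP.+-monoʳ-≤ 1ℤ (ℤP.0≤i-j⇒j≤i {+ p ℤ.- 1ℤ} {+ r ℤ.+ + q} e₃))
        (ℤP.≤-reflexive (trans (ℤP.+-comm 1ℤ (+ p ℤ.- 1ℤ)) (trans (ℤP.+-assoc (+ p) (ℤ.- 1ℤ) 1ℤ) (ℤP.+-identityʳ (+ p))))))

-- Vanishing of coefficients modulo the primes of 𝒫_n.

-- D (j + q) = (D j + 1) + p, and p ∤ D because p + 1 = D q. Thus j ≡ -q modulo p.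
window-j : ∀ {p D q j} → Prime p → p + 1 ≡ D * q → p ∣ D * j + 1 → p ∣ j + q
window-j {p} {D} {q} {j} pp p+1≡ p∣ = [ (λ p∣D → ⊥-elim (p∤D p∣D)) , (λ h → h) ]′ (euclidsLemma D (j + q) pp p∣D*[j+q])
  where
  p∣D*[j+q] : p ∣ D * (j + q)
  p∣D*[j+q] = subst (p ∣_)
    (trans (trans (ℕP.+-assoc (D * j) 1 p) (cong (λ z → D * j + z) (trans (ℕP.+-comm 1 p) p+1≡))) (sym (ℕP.*-distribˡ-+ D j q)))
    (∣m∣n⇒∣m+n p∣ ∣-refl)
  p∤D : p ∤ D
  p∤D p∣D = ℕP.<-irrefl (sym (∣1⇒≡1 (∣m+n∣m⇒∣n (subst (p ∣_) (sym p+1≡) (∣m⇒∣m*n q p∣D)) ∣-refl)))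
    (ℕ.nonTrivial⇒n>1 p {{prime⇒nonTrivial pp}})

-- Modulo p, (1 - X x - Y x²)^-(j+1) is a power of (1 - X x - Y x²)^p times a polynomial of degree
-- 2(q - 1), so the coefficients at positions 2q - 1, …, p - 1 modulo p vanish.
p∣trinom : ∀ {p D q r g n} → Prime p → p + 1 ≡ D * q → n ≡ r + g * p → 1 ≤ q → q ≤ suc r → r + q < p →
  ∀ j → p ∣ D * j + 1 → ∀ i k → j + (i + 2 * k) ≡ n → p ∣ trinom j i k
p∣trinom {p} {D} {q} {r} {g} {n} pp p+1≡ n≡ 1≤q q≤1+r r+q<p j p∣lead i k j+l≡n =
  go (ℕP.<-≤-connex (s % p) q) (ℕP.<-≤-connex (s % p) (k % p))
  where
  instance
    p≢0 = prime⇒nonZero pp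
  module ℕS′ = ℕS.+-*-Solver
  s t σ κ c d : ℕ
  s = i + k
  p∣j+q = window-j {p} {D} {q} {j} pp p+1≡ p∣lead
  t = quotient p∣j+q
  σ = s % p
  κ = k % p
  c = s / p
  d = k / p
  s≡ : s ≡ σ + c * p
  s≡ = m≡m%n+[m/n]*n s p
  k≡ : k ≡ κ + d * p
  k≡ = m≡m%n+[m/n]*n k p
  j+q≡ : j + q ≡ t * p
  j+q≡ = m∣n⇒n≡quotient*m p∣j+q
  -- As n = j + s + k and j ≡ -q, the last base-p digits σ of s and κ of k satisfy σ + κ ≡ r + q
  -- modulo p.
  n+q≡ : σ + κ + (t + c + d) * p ≡ r + q + g * p
  n+q≡ = begin
    σ + κ + (t + c + d) * p              ≡⟨ ℕS′.solve 6 (λ σ κ t c d p → σ ℕS′.:+ κ ℕS′.:+ (t ℕS′.:+ c ℕS′.:+ d) ℕS′.:* p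
                                              ℕS′.:= t ℕS′.:* p ℕS′.:+ (σ ℕS′.:+ c ℕS′.:* p) ℕS′.:+ (κ ℕS′.:+ d ℕS′.:* p)) refl σ κ t c d p ⟩
    t * p + (σ + c * p) + (κ + d * p)    ≡⟨ cong₂ _+_ (cong₂ _+_ j+q≡ s≡) k≡ ⟨
    j + q + (i + k) + k                  ≡⟨ ℕS′.solve 4 (λ j q i k → j ℕS′.:+ q ℕS′.:+ (i ℕS′.:+ k) ℕS′.:+ k
                                              ℕS′.:= (j ℕS′.:+ (i ℕS′.:+ ℕS′.con 2 ℕS′.:* k)) ℕS′.:+ q) refl j q i k ⟩
    j + (i + 2 * k) + q                  ≡⟨ cong (λ z → z + q) (trans j+l≡n n≡) ⟩
    r + g * p + q                        ≡⟨ ℕS′.solve 3 (λ r x q → r ℕS′.:+ x ℕS′.:+ q ℕS′.:= r ℕS′.:+ q ℕS′.:+ x) refl r (g * p) q ⟩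
    r + q + g * p                        ∎
    where open ≡-Reasoning
  go : σ < q ⊎ q ≤ σ → σ < κ ⊎ κ ≤ σ → p ∣ trinom j i k
  -- The last digit of j + s is σ - q < σ, so Lucas makes the first binomial factor divisible by p.
  go (inj₂ q≤σ) _ = ∣-trans
    (subst (λ z → p ∣ (j + z) C z) (sym s≡) (lucas pp (σ ∸ q) σ c (t + c) j (ℕP.∸-monoʳ-< 1≤q q≤σ) (m%n<n s p) eq))
    (C∣trinom j i k)
    where
    eq : j + (σ + c * p) ≡ σ ∸ q + (t + c) * p
    eq = begin
      j + (σ + c * p)              ≡⟨ cong (λ z → j + (z + c * p)) (sym (ℕP.m+[n∸m]≡n q≤σ)) ⟩
      j + (q + (σ ∸ q) + c * p)    ≡⟨ ℕS′.solve 4 (λ j q x y → j ℕS′.:+ (q ℕS′.:+ x ℕS′.:+ y) ℕS′.:= x ℕS′.:+ ((j ℕS′.:+ q) ℕS′.:+ y)) refl j q (σ ∸ q) (c * p) ⟩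
      σ ∸ q + (j + q + c * p)      ≡⟨ cong (λ z → σ ∸ q + (z + c * p)) j+q≡ ⟩
      σ ∸ q + (t * p + c * p)      ≡⟨ cong (λ z → σ ∸ q + z) (ℕP.*-distribʳ-+ p t c) ⟨
      σ ∸ q + (t + c) * p          ∎
      where open ≡-Reasoning
  -- The last digit of i + k = s is smaller than that of k, so the second binomial factor is
  -- divisible by p.
  go (inj₁ _) (inj₁ σ<κ) = ∣-trans
    (subst (λ z → p ∣ (i + z) C z) (sym k≡) (lucas pp σ κ d c i σ<κ (m%n<n k p) (trans (cong (λ z → i + z) (sym k≡)) s≡)))
    (C∣trinom′ j i k)
  -- Now σ + κ ≤ 2 q - 2 < r + q < p, so the congruence for σ + κ would be an equality, which is
  -- absurd.
  go (inj₁ σ<q) (inj₂ κ≤σ) = ⊥-elim (ℕP.<-irrefl same (ℕP.<-≤-trans σ+κ<2q-1 (ℕP.+-monoˡ-≤ q (ℕP.≤-pred (ℕP.≤-trans (ℕP.≤-reflexive 1+pred) q≤1+r)))))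
    where
    1+pred : suc (ℕ.pred q) ≡ q
    1+pred = ℕP.suc-pred q {{ℕ.>-nonZero 1≤q}}
    σ+κ<2q-1 : σ + κ < ℕ.pred q + q
    σ+κ<2q-1 = ℕP.+-mono-≤-< (ℕP.≤-pred (subst (σ <_) (sym 1+pred) σ<q)) (ℕP.≤-<-trans κ≤σ σ<q)
    same : σ + κ ≡ r + q
    same = begin
      σ + κ                            ≡⟨ m<n⇒m%n≡m σ+κ<p ⟨
      (σ + κ) % p                      ≡⟨ [m+kn]%n≡m%n (σ + κ) (t + c + d) p ⟨
      (σ + κ + (t + c + d) * p) % p    ≡⟨ cong (_% p) n+q≡ ⟩
      (r + q + g * p) % p              ≡⟨ [m+kn]%n≡m%n (r + q) g p ⟩
      (r + q) % p                      ≡⟨ m<n⇒m%n≡m r+q<p ⟩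
      r + q                            ∎
      where
      open ≡-Reasoning
      σ+κ<p : σ + κ < p
      σ+κ<p = ℕP.<-trans (ℕP.<-≤-trans σ+κ<2q-1 (ℕP.+-monoˡ-≤ q (ℕP.≤-pred (ℕP.≤-trans (ℕP.≤-reflexive 1+pred) q≤1+r)))) r+q<p

-- The p-part of d_D^* and the first basis.

prime∣prime⇒≡ : ∀ {p q} → Prime p → Prime q → p ∣ q → p ≡ q
prime∣prime⇒≡ {p} pp pq p∣q = [ (λ p≡1 → ⊥-elim (ℕP.<-irrefl (sym p≡1) (ℕ.nonTrivial⇒n>1 p {{prime⇒nonTrivial pp}}))) , (λ h → h) ]′
  (prime⇒irreducible pq p∣q)

recip-* : ∀ m n .{{_ : NonZero m}} .{{_ : NonZero n}} → recip (m * n) ≡ recip m ⊗ recip n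
recip-* m n = begin
  recip (m * n)                                                      ≡⟨ ℚP.*-identityˡ (recip (m * n)) ⟨
  1ℚ ⊗ recip (m * n)                                                 ≡⟨ cong (_⊗ recip (m * n)) (cong₂ _⊗_ (ιℕ*recip m) (ιℕ*recip n)) ⟨
  ((ιℕ m ⊗ recip m) ⊗ (ιℕ n ⊗ recip n)) ⊗ recip (m * n)
    ≡⟨ solve 5 (λ m m′ n n′ x → ((m :* m′) :* (n :* n′)) :* x := ((m :* n) :* x) :* (m′ :* n′)) refl (ιℕ m) (recip m) (ιℕ n) (recip n) (recip (m * n)) ⟩
  ((ιℕ m ⊗ ιℕ n) ⊗ recip (m * n)) ⊗ (recip m ⊗ recip n)
    ≡⟨ cong (_⊗ (recip m ⊗ recip n)) (trans (cong (_⊗ recip (m * n)) (sym (ιℕ-* m n))) (ιℕ*recip (m * n) {{ℕP.m*n≢0 m n}})) ⟩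
  1ℚ ⊗ (recip m ⊗ recip n)                                           ≡⟨ ℚP.*-identityˡ (recip m ⊗ recip n) ⟩
  recip m ⊗ recip n                                                  ∎
  where open ≡-Reasoning

ι∣⊗recip : ∀ {m n} .{{_ : NonZero m}} (m∣n : m ∣ n) → ιℕ n ⊗ recip m ≡ ιℕ (quotient m∣n)
ι∣⊗recip {m} {n} m∣n = begin
  ιℕ n ⊗ recip m             ≡⟨ cong (λ z → ιℕ z ⊗ recip m) (m∣n⇒n≡quotient*m m∣n) ⟩
  ιℕ (k * m) ⊗ recip m       ≡⟨ cong (_⊗ recip m) (ιℕ-* k m) ⟩
  (ιℕ k ⊗ ιℕ m) ⊗ recip m    ≡⟨ ℚP.*-assoc (ιℕ k) (ιℕ m) (recip m) ⟩
  ιℕ k ⊗ (ιℕ m ⊗ recip m)    ≡⟨ cong (ιℕ k ⊗_) (ιℕ*recip m) ⟩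
  ιℕ k ⊗ 1ℚ                  ≡⟨ ℚP.*-identityʳ (ιℕ k) ⟩
  ιℕ k                       ∎
  where
  open ≡-Reasoning
  k = quotient m∣n

-- Each factor is 1 or a prime equal to its own position, so p occurs at most once. The offset c
-- lets the induction pass to tails, and the lower bound on p keeps the head's prime out of the
-- tail.
product-split : ∀ (P : ℕ → Set) (f : ℕ → ℕ) c m →
  (∀ k → f k ≡ 1 ⊎ (f k ≡ c + k × Prime (c + k) × P (c + k))) → ∀ {p} → Prime p →
  p ∤ product (applyUpTo f m) ⊎
  ∃ λ u → product (applyUpTo f m) ≡ p * u × p ∤ u × P p × c ≤ p × p < c + m
product-split P f c zero    hf {p} pp = inj₁ (λ p∣1 → ℕP.<-irrefl (sym (∣1⇒≡1 p∣1)) (ℕ.nonTrivial⇒n>1 p {{prime⇒nonTrivial pp}}))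
product-split P f c (suc m) hf {p} pp = combine (hf 0) rest
  where
  tail : ℕ
  tail = product (applyUpTo (λ k → f (suc k)) m)
  rest : p ∤ tail ⊎ ∃ λ u → tail ≡ p * u × p ∤ u × P p × suc c ≤ p × p < suc c + m
  rest = product-split P (λ k → f (suc k)) (suc c) m
    (λ k → subst (λ z → f (suc k) ≡ 1 ⊎ (f (suc k) ≡ z × Prime z × P z)) (ℕP.+-suc c k) (hf (suc k))) pp
  <shift : ∀ {x} → x < suc c + m → x < c + suc m
  <shift {x} = subst (x <_) (sym (ℕP.+-suc c m))
  combine : f 0 ≡ 1 ⊎ (f 0 ≡ c + 0 × Prime (c + 0) × P (c + 0)) →
    p ∤ tail ⊎ (∃ λ u → tail ≡ p * u × p ∤ u × P p × suc c ≤ p × p < suc c + m) →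
    p ∤ f 0 * tail ⊎ ∃ λ u → f 0 * tail ≡ p * u × p ∤ u × P p × c ≤ p × p < c + suc m
  combine (inj₁ f₀) (inj₁ p∤tail) = inj₁ (subst (λ z → p ∤ z) (sym (trans (cong (_* tail) f₀) (ℕP.*-identityˡ tail))) p∤tail)
  combine (inj₁ f₀) (inj₂ (u , eq , p∤u , Pp , c<p , p<)) =
    inj₂ (u , trans (cong (_* tail) f₀) (trans (ℕP.*-identityˡ tail) eq) , p∤u , Pp , ℕP.<⇒≤ c<p , <shift p<)
  combine (inj₂ (f₀ , pc , Pc)) r with p ∣? f 0
  combine (inj₂ (f₀ , pc , Pc)) (inj₁ p∤tail) | no p∤f₀ = inj₁ (λ h → [ p∤f₀ , p∤tail ]′ (euclidsLemma (f 0) tail pp h))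
  combine (inj₂ (f₀ , pc , Pc)) (inj₂ (u , eq , p∤u , Pp , c<p , p<)) | no p∤f₀ =
    inj₂ (f 0 * u , trans (cong (f 0 *_) eq) (ℕS.+-*-Solver.solve 3 (λ a p u → a ℕ:* (p ℕ:* u) ℕ:= p ℕ:* (a ℕ:* u)) refl (f 0) p u) ,
      (λ h → [ p∤f₀ , p∤u ]′ (euclidsLemma (f 0) u pp h)) , Pp , ℕP.<⇒≤ c<p , <shift p<)
    where open ℕS.+-*-Solver using () renaming (_:*_ to _ℕ:*_; _:=_ to _ℕ:=_)
  combine (inj₂ (f₀ , pc , Pc)) r | yes p∣f₀ = equal (trans p≡c+0 (ℕP.+-identityʳ c)) r
    where
    p≡c+0 : p ≡ c + 0
    p≡c+0 = prime∣prime⇒≡ pp pc (subst (p ∣_) f₀ p∣f₀)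
    equal : p ≡ c → p ∤ tail ⊎ (∃ λ u → tail ≡ p * u × p ∤ u × P p × suc c ≤ p × p < suc c + m) → _
    equal p≡c (inj₁ p∤tail) = inj₂ (tail , cong (_* tail) (trans f₀ (sym p≡c+0)) , p∤tail , subst P (sym p≡c+0) Pc ,
      ℕP.≤-reflexive (sym p≡c) , subst (_< c + suc m) (sym p≡c) (ℕP.m<m+n c (s≤s z≤n)))
    equal p≡c (inj₂ (_ , _ , _ , _ , c<p , _)) = ⊥-elim (ℕP.<-irrefl (sym p≡c) c<p)

f∣foldr-lcm : ∀ (f : ℕ → ℕ) n k → k < n → f k ∣ foldr lcm 1 (applyUpTo f n)
f∣foldr-lcm f (suc n) zero    _         = m∣lcm[m,n] (f 0) _
f∣foldr-lcm f (suc n) (suc k) (s≤s k<n) = ∣-trans (f∣foldr-lcm (λ k → f (suc k)) n k k<n) (n∣lcm[m,n] (f 0) _)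

lead∣dD : ∀ D n j → j ≤ n → D * j + 1 ∣ dD D n
-- j = 0 lies outside the range of the lcm, but there D j + 1 = 1.
lead∣dD D n zero    _   = subst (_∣ dD D n) (cong (_+ 1) (sym (ℕP.*-zeroʳ D))) (1∣ dD D n)
lead∣dD D n (suc j) j<n = f∣foldr-lcm (λ k → D * suc k + 1) n j j<n

module _ (D : ℕ) .{{_ : NonZero D}} (2≤D : 2 ≤ D) (N : ℕ) where

  private
    instance
      prodP≢0 : NonZero (prodP D N)
      prodP≢0 = product-nonZero (PFactor D N) (PFactor-nonZero D N) N

    inProdP : ℕ → Set
    inProdP p = ∃ λ q → ∃₂ λ r g → p + 1 ≡ D * q × N ≡ r + g * p × 1 ≤ q × q ≤ suc r × r + q < p

    PFactor-cases : ∀ k → PFactor D N k ≡ 1 ⊎ (PFactor D N k ≡ 1 + k × Prime (1 + k) × inProdP (1 + k))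
    PFactor-cases k = by-cases (inP D N (suc k)) refl
      where
      by-cases : ∀ b → inP D N (suc k) ≡ b →
        (if b then suc k else 1) ≡ 1 ⊎ ((if b then suc k else 1) ≡ 1 + k × Prime (1 + k) × inProdP (1 + k))
      by-cases false eq = inj₁ refl
      by-cases true  eq = inj₂ (refl , inP⇒window D 2≤D N (suc k) eq)

  dStar≡ : dStar D N ≡ ιℕ (dD D N) ⊗ recip (prodP D N)
  dStar≡ = cong (ιℕ (dD D N) ⊗_) (/≡recip (prodP D N))

  prodP-cases : ∀ {p} → Prime p → p ∤ prodP D N ⊎ ∃ λ u → prodP D N ≡ p * u × p ∤ u × inProdP p × p ≤ N
  prodP-cases {p} pp = weaken (product-split inProdP (PFactor D N) 1 N PFactor-cases pp)
    where
    weaken : p ∤ prodP D N ⊎ (∃ λ u → prodP D N ≡ p * u × p ∤ u × inProdP p × 1 ≤ p × p < 1 + N) →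
      p ∤ prodP D N ⊎ ∃ λ u → prodP D N ≡ p * u × p ∤ u × inProdP p × p ≤ N
    weaken (inj₁ p∤)                                = inj₁ p∤
    weaken (inj₂ (u , eq , p∤u , w , _ , s≤s p≤N))  = inj₂ (u , eq , p∤u , w , p≤N)

  -- A prime of 𝒫_n satisfies p + 1 = D q, hence cannot divide D; so dividing by the product over
  -- 𝒫_n is harmless at p ∣ D.
  dStar∈Loc : ∀ {p} → Prime p → p ∣ D → Loc p (dStar D N)
  dStar∈Loc {p} pp p∣D = subst (Loc p) (sym dStar≡) (Loc-* pp (Loc-ℕ pp (dD D N)) (Loc-recip pp (absurd (prodP-cases pp))))
    where
    absurd : p ∤ prodP D N ⊎ (∃ λ u → prodP D N ≡ p * u × p ∤ u × inProdP p × p ≤ N) → p ∤ prodP D N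
    absurd (inj₁ p∤) = p∤
    absurd (inj₂ (_ , _ , _ , (q , _ , _ , p+1≡ , _) , _)) = ⊥-elim (ℕP.<-irrefl
      (sym (∣1⇒≡1 (∣m+n∣m⇒∣n (subst (p ∣_) (sym p+1≡) (∣m⇒∣m*n q p∣D)) ∣-refl))) (ℕ.nonTrivial⇒n>1 p {{prime⇒nonTrivial pp}}))

  -- For p ∈ 𝒫_n the number p (D - 1) = D (p - q) + 1 is one of the arguments of the lcm.
  p∣dD : ∀ {p} → inProdP p → p ≤ N → p ∣ dD D N
  p∣dD {p} (q , r , _ , p+1≡ , _ , _ , _ , r+q<p) p≤N =
    ∣-trans (∣m+n∣m⇒∣n (subst (p ∣_) (sym sum) (n∣m*n D)) ∣-refl) (lead∣dD D N (p ∸ q) (ℕP.≤-trans (ℕP.m∸n≤m p q) p≤N))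
    where
    open ≡-Reasoning
    q≤p : q ≤ p
    q≤p = ℕP.<⇒≤ (ℕP.≤-<-trans (ℕP.m≤n+m q r) r+q<p)
    sum : p + (D * (p ∸ q) + 1) ≡ D * p
    sum = begin
      p + (D * (p ∸ q) + 1)      ≡⟨ ℕP.+-comm p (D * (p ∸ q) + 1) ⟩
      D * (p ∸ q) + 1 + p        ≡⟨ ℕP.+-assoc (D * (p ∸ q)) 1 p ⟩
      D * (p ∸ q) + (1 + p)      ≡⟨ cong (λ z → D * (p ∸ q) + z) (trans (ℕP.+-comm 1 p) p+1≡) ⟩
      D * (p ∸ q) + D * q        ≡⟨ ℕP.*-distribˡ-+ D (p ∸ q) q ⟨
      D * (p ∸ q + q)            ≡⟨ cong (D *_) (ℕP.m∸n+n≡m q≤p) ⟩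
      D * p                      ∎

  module _ {p : ℕ} (pp : Prime p) {A K κ X : ℚ} (K⊗κ : K ⊗ κ ≡ 1ℚ) (K∈ : Loc p K) (X∈ : Filt p κ 1 X) where
    open Filtration pp K⊗κ K∈
    open Gegenbauer X (⊝ K)
    open Recurrence D A K
    open GegenbauerFiltration pp D A K⊗κ K∈ X∈

    private
      instance
        p≢0 = prime⇒nonZero pp
        lead≢0 : ∀ {j} → NonZero (D * j + 1)
        lead≢0 {j} = subst NonZero (ℕP.+-comm 1 (D * j)) _

    -- Outside 𝒫_n the lcm absorbs D j + 1. For p ∈ 𝒫_n with p ∤ D j + 1, a factor p of the lcm pays
    -- for the division by p. If p ∣ D j + 1, the lcm is spent on D j + 1, and the division by p
    -- falls on the trinomial coefficients, which are all divisible by p.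
    dStar-coeff∈M : ∀ j l → j + l ≡ N → M ⌈ l /2⌉ ((dStar D N ⊗ lead⁻¹ j) ⊗ geg j l)
    dStar-coeff∈M j l eq = subst (λ δ → M ⌈ l /2⌉ ((δ ⊗ lead⁻¹ j) ⊗ geg j l)) (sym dStar≡) (go (prodP-cases pp))
      where
      open ≡-Reasoning
      d m : ℕ
      d = dD D N
      m = prodP D N
      lead∣d : D * j + 1 ∣ d
      lead∣d = lead∣dD D N j (subst (j ≤_) eq (ℕP.m≤m+n j l))
      c : ℕ
      c = quotient lead∣d
      go : p ∤ m ⊎ (∃ λ u → m ≡ p * u × p ∤ u × inProdP p × p ≤ N) →
        M ⌈ l /2⌉ (((ιℕ d ⊗ recip m) ⊗ lead⁻¹ j) ⊗ geg j l)
      go (inj₁ p∤m) = M-Loc (subst (Loc p) reorder (Loc-* pp (Loc-ℕ pp c) (Loc-recip pp p∤m))) (geg∈M j l)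
        where
        reorder : ιℕ c ⊗ recip m ≡ (ιℕ d ⊗ recip m) ⊗ lead⁻¹ j
        reorder = trans (cong (_⊗ recip m) (sym (ι∣⊗recip lead∣d)))
          (solve 3 (λ d l m → (d :* l) :* m := (d :* m) :* l) refl (ιℕ d) (lead⁻¹ j) (recip m))
      go (inj₂ (u , m≡ , p∤u , w , p≤N)) = in-𝒫 (p ∣? D * j + 1)
        where
        instance
          u≢0 : NonZero u
          u≢0 = ℕ.≢-nonZero (λ u≡0 → p∤u (subst (p ∣_) (sym u≡0) (p ∣0)))
        recip-m : recip m ≡ recip p ⊗ recip u
        recip-m = trans (cong recip m≡) (recip-* p u)
        in-𝒫 : Dec (p ∣ D * j + 1) → M ⌈ l /2⌉ (((ιℕ d ⊗ recip m) ⊗ lead⁻¹ j) ⊗ geg j l)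
        in-𝒫 (no p∤lead) = M-Loc (subst (Loc p) reorder
          (Loc-* pp (Loc-* pp (Loc-ℕ pp (quotient p∣d)) (Loc-recip pp p∤u)) (Loc-recip pp p∤lead))) (geg∈M j l)
          where
          p∣d : p ∣ d
          p∣d = p∣dD w p≤N
          reorder : (ιℕ (quotient p∣d) ⊗ recip u) ⊗ lead⁻¹ j ≡ (ιℕ d ⊗ recip m) ⊗ lead⁻¹ j
          reorder = cong (_⊗ lead⁻¹ j) (trans (cong (_⊗ recip u) (sym (ι∣⊗recip p∣d)))
            (trans (ℚP.*-assoc (ιℕ d) (recip p) (recip u)) (cong (ιℕ d ⊗_) (sym recip-m))))
        in-𝒫 (yes p∣lead) = subst (M ⌈ l /2⌉) reorder
          (M-Loc (Loc-* pp (Loc-ℕ pp c) (Loc-recip pp p∤u)) (geg-filt (recip p) j l divided))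
          where
          divided : ∀ i k → i + 2 * k ≡ l → Loc p (recip p ⊗ ιℕ (trinom j i k))
          divided i k i+2k≡l =
            subst (Loc p) (trans (sym (ι∣⊗recip p∣t)) (ℚP.*-comm (ιℕ (trinom j i k)) (recip p))) (Loc-ℕ pp (quotient p∣t))
            where
            p∣t : p ∣ trinom j i k
            p∣t = let q , r , g , p+1≡ , N≡ , 1≤q , q≤ , r+q< = w in
              p∣trinom {p} {D} {q} {r} {g} pp p+1≡ N≡ 1≤q q≤ r+q< j p∣lead i k (trans (cong (λ z → j + z) i+2k≡l) eq)
          reorder : (ιℕ c ⊗ recip u) ⊗ (recip p ⊗ geg j l) ≡ ((ιℕ d ⊗ recip m) ⊗ lead⁻¹ j) ⊗ geg j l
          reorder = begin
            (ιℕ c ⊗ recip u) ⊗ (recip p ⊗ geg j l)                  ≡⟨ cong (λ z → (z ⊗ recip u) ⊗ (recip p ⊗ geg j l)) (ι∣⊗recip lead∣d) ⟨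
            ((ιℕ d ⊗ lead⁻¹ j) ⊗ recip u) ⊗ (recip p ⊗ geg j l)
              ≡⟨ solve 5 (λ d l u p g → ((d :* l) :* u) :* (p :* g) := ((d :* (p :* u)) :* l) :* g) refl (ιℕ d) (lead⁻¹ j) (recip u) (recip p) (geg j l) ⟩
            ((ιℕ d ⊗ (recip p ⊗ recip u)) ⊗ lead⁻¹ j) ⊗ geg j l     ≡⟨ cong (λ z → ((ιℕ d ⊗ z) ⊗ lead⁻¹ j) ⊗ geg j l) recip-m ⟨
            ((ιℕ d ⊗ recip m) ⊗ lead⁻¹ j) ⊗ geg j l                 ∎

-- Factorials against the denominator of A/K at 2 and 3.

private
  ⌊2m+n/2⌋ : ∀ m n → ⌊ m * 2 + n /2⌋ ≡ m + ⌊ n /2⌋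
  ⌊2m+n/2⌋ zero    n = refl
  ⌊2m+n/2⌋ (suc m) n = cong suc (⌊2m+n/2⌋ m n)

-- v₂(n!) is n minus the binary digit sum of n, so each pair of factors of n! contributes two
-- factors 2, up to a logarithmic error.
2-adic-! : ∀ n → 2 ^ (2 * ⌊ n /2⌋) ∣ n ! * 2 ^ suc ⌊log₂ n ⌋
2-adic-! = p^h∣!*p^log 2 (s≤s (s≤s z≤n)) (λ n → 2 * ⌊ n /2⌋) refl step
  where
  n≤1+2⌊n/2⌋ : ∀ n → n ≤ suc (2 * ⌊ n /2⌋)
  n≤1+2⌊n/2⌋ n = begin
    n                          ≡⟨ ℕP.⌊n/2⌋+⌈n/2⌉≡n n ⟨
    ⌊ n /2⌋ + ⌈ n /2⌉          ≤⟨ ℕP.+-monoʳ-≤ ⌊ n /2⌋ (ℕP.⌊n/2⌋-mono (ℕP.n≤1+n (suc n))) ⟩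
    ⌊ n /2⌋ + suc ⌊ n /2⌋      ≡⟨ ℕP.+-suc ⌊ n /2⌋ ⌊ n /2⌋ ⟩
    suc (⌊ n /2⌋ + ⌊ n /2⌋)    ≡⟨ cong (λ z → suc (⌊ n /2⌋ + z)) (ℕP.+-identityʳ ⌊ n /2⌋) ⟨
    suc (2 * ⌊ n /2⌋)          ∎
    where open ℕP.≤-Reasoning
  step : ∀ m r → r < 2 → 2 * ⌊ r + m * 2 /2⌋ ≤ suc (m + 2 * ⌊ m /2⌋)
  step m r r<2 = begin
    2 * ⌊ r + m * 2 /2⌋      ≡⟨ cong (λ z → 2 * ⌊ z /2⌋) (ℕP.+-comm r (m * 2)) ⟩
    2 * ⌊ m * 2 + r /2⌋      ≡⟨ cong (2 *_) (⌊2m+n/2⌋ m r) ⟩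
    2 * (m + ⌊ r /2⌋)        ≤⟨ ℕP.*-monoʳ-≤ 2 (ℕP.+-monoʳ-≤ m (ℕP.⌊n/2⌋-mono (ℕP.≤-pred r<2))) ⟩
    2 * (m + 0)              ≡⟨ cong₂ _+_ (ℕP.+-identityʳ m) (trans (ℕP.+-identityʳ (m + 0)) (ℕP.+-identityʳ m)) ⟩
    m + m                    ≤⟨ ℕP.+-monoʳ-≤ m (n≤1+2⌊n/2⌋ m) ⟩
    m + suc (2 * ⌊ m /2⌋)    ≡⟨ ℕP.+-suc m (2 * ⌊ m /2⌋) ⟩
    suc (m + 2 * ⌊ m /2⌋)    ∎
    where open ℕP.≤-Reasoning

-- v₃(n!) is about n/2, one factor 3 per pair. The exponent is written `1 * ⌊ n /2⌋` to share the
-- shape f ⌊n/2⌋ with the prime 2.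
3-adic-! : ∀ n → 3 ^ (1 * ⌊ n /2⌋) ∣ n ! * 3 ^ suc ⌊log₂ n ⌋
3-adic-! = p^h∣!*p^log 3 (s≤s (s≤s z≤n)) (λ n → 1 * ⌊ n /2⌋) refl step
  where
  step : ∀ m r → r < 3 → 1 * ⌊ r + m * 3 /2⌋ ≤ suc (m + 1 * ⌊ m /2⌋)
  step m r r<3 = begin
    1 * ⌊ r + m * 3 /2⌋          ≡⟨ ℕP.*-identityˡ ⌊ r + m * 3 /2⌋ ⟩
    ⌊ r + m * 3 /2⌋              ≤⟨ ℕP.⌊n/2⌋-mono (ℕP.+-monoˡ-≤ (m * 3) (ℕP.≤-pred r<3)) ⟩
    suc ⌊ m * 3 /2⌋              ≡⟨ cong (λ z → suc ⌊ z /2⌋) (trans (ℕP.*-suc m 2) (ℕP.+-comm m (m * 2))) ⟩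
    suc ⌊ m * 2 + m /2⌋          ≡⟨ cong suc (⌊2m+n/2⌋ m m) ⟩
    suc (m + ⌊ m /2⌋)            ≡⟨ cong (λ z → suc (m + z)) (ℕP.*-identityˡ ⌊ m /2⌋) ⟨
    suc (m + 1 * ⌊ m /2⌋)        ∎
    where open ℕP.≤-Reasoning

n<m^n : ∀ m n → 2 ≤ m → n < m ^ n
n<m^n m zero    2≤m = s≤s z≤n
n<m^n m (suc n) 2≤m = begin-strict
  suc n          ≤⟨ n<m^n m n 2≤m ⟩
  m ^ n          <⟨ ℕP.m<m*n (m ^ n) m {{ℕP.m^n≢0 m n {{ℕ.>-nonZero (ℕP.≤-trans (s≤s z≤n) 2≤m)}}}} 2≤m ⟩
  m ^ n * m      ≡⟨ ℕP.*-comm (m ^ n) m ⟩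
  m * m ^ n      ∎
  where open ℕP.≤-Reasoning

f∣product : ∀ (f : ℕ → ℕ) m k → k < m → f k ∣ product (applyUpTo f m)
f∣product f (suc m) zero    _         = m∣m*n _
f∣product f (suc m) (suc k) (s≤s k<m) = ∣-trans (f∣product (λ k → f (suc k)) m k k<m) (n∣m*n (f 0))

p^e∣primeDivProd : ∀ {p} g .{{_ : NonZero g}} (e : ℕ → ℕ) → Prime p → p ∣ g → p ^ e p ∣ primeDivProd g e
p^e∣primeDivProd {zero}  g e pp p∣g = ⊥-elim (ℕ.≢-nonZero⁻¹ 0 {{prime⇒nonZero pp}} refl)
p^e∣primeDivProd {suc k} g e pp p∣g = subst (_∣ primeDivProd g e)
  (cong₂ (λ a b → if a ∧ b then suc k ^ e (suc k) else 1) (to-isYes (prime? (suc k)) pp) (to-isYes (suc k ∣? g) p∣g))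
  (f∣product (λ k → if isYes (prime? (suc k)) ∧ isYes (suc k ∣? g) then suc k ^ e (suc k) else 1) g k (∣⇒≤ p∣g))
  where
  to-isYes : ∀ {P : Set} (d : Dec P) → P → isYes d ≡ true
  to-isYes (yes _) _ = refl
  to-isYes (no ¬p) p = ⊥-elim (¬p p)

module _ {p : ℕ} (pp : Prime p) {K κ : ℚ} (K⊗κ : K ⊗ κ ≡ 1ℚ) (K∈ : Loc p K) {A P Q : ℚ} where
  open Filtration pp K⊗κ K∈

  -- The factors A are taken in pairs, each pair with its own Q gaining one level; P is needed once,
  -- for the A left over when d is odd.
  power∈M : Loc p P → M 1 (P ⊗ A) → M 1 (Q ⊗ (A ⊗ A)) → ∀ d → M ⌈ d /2⌉ ((P ⊗ (Q ^ℚ ⌊ d /2⌋)) ⊗ (A ^ℚ d))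
  power∈M P∈ PA∈ QA²∈ zero          = M-0 (Loc-* pp (Loc-* pp P∈ (Loc-ℕ pp 1)) (Loc-ℕ pp 1))
  power∈M P∈ PA∈ QA²∈ (suc zero)    = subst (M 1) (cong₂ _⊗_ (sym (ℚP.*-identityʳ P)) (sym (ℚP.*-identityʳ A))) PA∈
  power∈M P∈ PA∈ QA²∈ (suc (suc d)) = subst (M ⌈ suc (suc d) /2⌉)
    (solve 5 (λ q a p x y → (q :* (a :* a)) :* ((p :* x) :* y) := (p :* (q :* x)) :* (a :* (a :* y))) refl
      Q A P (Q ^ℚ ⌊ d /2⌋) (A ^ℚ d))
    (M-* QA²∈ (power∈M P∈ PA∈ QA²∈ d))

ιℕ-∣-factor : ∀ a b c d f i → a * b ^ (f * i) ∣ c * d →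
  ∃ λ x → ∀ y → ιℕ c ⊗ (ιℕ d ⊗ y) ≡ ιℕ x ⊗ ((ιℕ a ⊗ (ιℕ (b ^ f) ^ℚ i)) ⊗ y)
ιℕ-∣-factor a b c d f i a∣ = x , λ y →
  trans (sym (ℚP.*-assoc (ιℕ c) (ιℕ d) y)) (trans (cong (_⊗ y) coeff) (ℚP.*-assoc (ιℕ x) (ιℕ a ⊗ (ιℕ (b ^ f) ^ℚ i)) y))
  where
  open ≡-Reasoning
  x : ℕ
  x = quotient a∣
  coeff : ιℕ c ⊗ ιℕ d ≡ ιℕ x ⊗ (ιℕ a ⊗ (ιℕ (b ^ f) ^ℚ i))
  coeff = begin
    ιℕ c ⊗ ιℕ d                             ≡⟨ ιℕ-* c d ⟨
    ιℕ (c * d)                              ≡⟨ cong ιℕ (m∣n⇒n≡quotient*m a∣) ⟩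
    ιℕ (x * (a * b ^ (f * i)))              ≡⟨ ιℕ-* x (a * b ^ (f * i)) ⟩
    ιℕ x ⊗ ιℕ (a * b ^ (f * i))             ≡⟨ cong (ιℕ x ⊗_) (ιℕ-* a (b ^ (f * i))) ⟩
    ιℕ x ⊗ (ιℕ a ⊗ ιℕ (b ^ (f * i)))        ≡⟨ cong (λ z → ιℕ x ⊗ (ιℕ a ⊗ z)) (trans (cong ιℕ (sym (ℕP.^-*-assoc b f i))) (ιℕ-^ (b ^ f) i)) ⟩
    ιℕ x ⊗ (ιℕ a ⊗ (ιℕ (b ^ f) ^ℚ i))       ∎

IsInt⇒Loc : ∀ {p q} → Prime p → IsInt q → Loc p q
IsInt⇒Loc {p} pp (z , eq) = subst (Loc p) (sym eq) (Loc-ℤ pp z)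

-- Integrality of the scaled value at a single prime.

module _ (D : ℕ) .{{_ : NonZero D}} (2≤D : 2 ≤ D) (A : ℚ) (K : ℤ) (κ : ℚ) (K⊗κ : ιℤ K ⊗ κ ≡ 1ℚ)
  (v : ℕ → ℚ) (v₀∈ℤ : IsInt (v 0)) (v₁∈ℤ : IsInt (v 1))
  (rec : ∀ n → 1 ≤ n → ιℕ (D * n + 1) ⊗ v (suc n)
           ≡ ((A ⊗ ιℕ n) ⊗ v n) ⊖ ((ιℤ K ⊗ (ιℕ (D * n) ⊖ 1ℚ)) ⊗ v (n ∸ 1)))
  where

  private
    a : ℚ
    a = A ⊗ κ

  module _ {p : ℕ} (pp : Prime p) (N : ℕ) where
    private
      K∈ : Loc p (ιℤ K)
      K∈ = Loc-ℤ pp K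
      δ : ℚ
      δ = dStar D N
    open Filtration pp K⊗κ K∈
    open Recurrence D A (ιℤ K)
    open Local pp D A K⊗κ K∈ v (IsInt⇒Loc pp v₀∈ℤ) (IsInt⇒Loc pp v₁∈ℤ) rec

    private
      lead⁻¹∈ : p ∣ D → ∀ j → Loc p (lead⁻¹ j)
      lead⁻¹∈ p∣D j = Loc-recip pp (λ p∣ → ℕP.<-irrefl (sym (∣1⇒≡1 (∣m+n∣m⇒∣n p∣ (∣m⇒∣m*n j p∣D))))
        (ℕ.nonTrivial⇒n>1 p {{prime⇒nonTrivial pp}}))

      M⇒Loc : ∀ x → M ⌈ N /2⌉ (x ⊗ v (suc N)) → Loc p ((x ⊗ (κ ^ℚ (suc N / 2))) ⊗ v (suc N))
      M⇒Loc x (filt lx) = subst (Loc p)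
        (trans (cong (λ k → (x ⊗ v (suc N)) ⊗ (κ ^ℚ k)) (sym (suc/2≡⌈/2⌉ N)))
          (solve 3 (λ x y z → (x :* y) :* z := (x :* z) :* y) refl x (v (suc N)) (κ ^ℚ (suc N / 2)))) lx

    -- Integrality of A/K at p puts A into level 1. For p ∤ D also A/D is in level 1 and the first
    -- basis applies; for p ∣ D the second one does, with nothing to pay in advance (ε = 1), since
    -- A^d already lies in level d.
    regular : Loc p a → Loc p ((δ ⊗ (κ ^ℚ (suc N / 2))) ⊗ v (suc N))
    regular a∈ = M⇒Loc δ (by-cases (p ∣? D))
      where
      A∈M : M 1 A
      A∈M = filt (subst (Loc p) (cong (A ⊗_) (sym (ℚP.*-identityʳ κ))) a∈)
      by-cases : Dec (p ∣ D) → M ⌈ N /2⌉ (δ ⊗ v (suc N))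
      by-cases (yes p∣D) = subst (λ x → M ⌈ N /2⌉ (x ⊗ v (suc N))) (ℚP.*-identityˡ δ)
        (quadratic-bound N δ 1ℚ (dStar∈Loc D 2≤D N pp p∣D) (lead⁻¹∈ p∣D)
          (λ d _ → M-Loc (Loc-ℕ pp 1) (M-Loc (Loc-ℕ pp (d !)) (M-mono (ℕP.⌈n/2⌉≤n d) (M-^ A∈M d)))))
      by-cases (no p∤D) = gegenbauer-bound N δ D*X X∈M (dStar-coeff∈M D 2≤D N pp {A} K⊗κ K∈ X∈M)
        where
        X : ℚ
        X = recip D ⊗ A
        D*X : ιℕ D ⊗ X ≡ A
        D*X = trans (sym (ℚP.*-assoc (ιℕ D) (recip D) A)) (trans (cong (_⊗ A) (ιℕ*recip D)) (ℚP.*-identityˡ A))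
        X∈M : M 1 X
        X∈M = M-Loc (Loc-recip pp p∤D) A∈M

    -- Let s = v_p(g). The condition on K makes p^f K (A/K)² integral at p, that is, p^f A² lies in
    -- level 1. The factors p^f, one for each pair of A's, are taken from d!.
    singular : ∀ g .{{_ : NonZero g}} z → ιℕ g ⊗ (A ⊗ κ) ≡ ιℤ z → ∀ f → (∀ n → p ^ (f * ⌊ n /2⌋) ∣ n ! * p ^ suc ⌊log₂ n ⌋) → p ∣ D →
      (∀ s → p ^ s ∣ g → p ^ (2 * s ∸ f) ∣ ℤ.∣ K ∣) →
      Loc p (((ιℕ (p ^ (g + suc ⌊log₂ N ⌋)) ⊗ δ) ⊗ (κ ^ℚ (suc N / 2))) ⊗ v (suc N))
    singular g z g*a f fact p∣D K-div = M⇒Loc (ιℕ (p ^ e) ⊗ δ)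
      (quadratic-bound N δ (ιℕ (p ^ e)) (dStar∈Loc D 2≤D N pp p∣D) (lead⁻¹∈ p∣D) fact∈)
      where
      g-split : ∃₂ λ s h → g ≡ p ^ s * h × p ∤ h
      g-split = prime-power-split pp g
      s h : ℕ
      s = proj₁ g-split
      h = proj₁ (proj₂ g-split)
      g≡ : g ≡ p ^ s * h
      g≡ = proj₁ (proj₂ (proj₂ g-split))
      p∤h : p ∤ h
      p∤h = proj₂ (proj₂ (proj₂ g-split))
      e : ℕ
      -- The summand g pays for a single unpaired A, because s < p^s ≤ g; the rest is the error in
      -- `fact`, which grows with d and is therefore taken at N.
      e = g + suc ⌊log₂ N ⌋
      p>1 : 2 ≤ p
      p>1 = ℕ.nonTrivial⇒n>1 p {{prime⇒nonTrivial pp}}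
      p^s∣g : p ^ s ∣ g
      p^s∣g = subst (p ^ s ∣_) (sym g≡) (m∣m*n h)
      s≤g : s ≤ g
      s≤g = ℕP.≤-trans (ℕP.<⇒≤ (n<m^n p s p>1)) (∣⇒≤ p^s∣g)
      p^s*a∈ : Loc p (ιℕ (p ^ s) ⊗ a)
      p^s*a∈ = loc h z p∤h (begin
        ιℕ h ⊗ (ιℕ (p ^ s) ⊗ a)    ≡⟨ solve 3 (λ h q a → h :* (q :* a) := (q :* h) :* a) refl (ιℕ h) (ιℕ (p ^ s)) a ⟩
        (ιℕ (p ^ s) ⊗ ιℕ h) ⊗ a    ≡⟨ cong (_⊗ a) (trans (sym (ιℕ-* (p ^ s) h)) (cong ιℕ (sym g≡))) ⟩
        ιℕ g ⊗ a                   ≡⟨ g*a ⟩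
        ιℤ z                       ∎)
        where open ≡-Reasoning
      p^g*A∈M : M 1 (ιℕ (p ^ g) ⊗ A)
      p^g*A∈M = filt (subst (Loc p) eq (Loc-* pp (Loc-ℕ pp (p ^ (g ∸ s))) p^s*a∈))
        where
        open ≡-Reasoning
        eq : ιℕ (p ^ (g ∸ s)) ⊗ (ιℕ (p ^ s) ⊗ a) ≡ (ιℕ (p ^ g) ⊗ A) ⊗ (κ ⊗ 1ℚ)
        eq = begin
          ιℕ (p ^ (g ∸ s)) ⊗ (ιℕ (p ^ s) ⊗ a)    ≡⟨ ℚP.*-assoc (ιℕ (p ^ (g ∸ s))) (ιℕ (p ^ s)) a ⟨
          (ιℕ (p ^ (g ∸ s)) ⊗ ιℕ (p ^ s)) ⊗ a    ≡⟨ cong (_⊗ a) (trans (sym (ιℕ-* (p ^ (g ∸ s)) (p ^ s)))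
                                                      (cong ιℕ (trans (sym (ℕP.^-distribˡ-+-* p (g ∸ s) s)) (cong (p ^_) (ℕP.m∸n+n≡m s≤g))))) ⟩
          ιℕ (p ^ g) ⊗ (A ⊗ κ)                   ≡⟨ ℚP.*-assoc (ιℕ (p ^ g)) A κ ⟨
          (ιℕ (p ^ g) ⊗ A) ⊗ κ                   ≡⟨ cong ((ιℕ (p ^ g) ⊗ A) ⊗_) (ℚP.*-identityʳ κ) ⟨
          (ιℕ (p ^ g) ⊗ A) ⊗ (κ ⊗ 1ℚ)            ∎
      -- 2 s ≤ f + (2 s ∸ f) holds also when the subtraction is truncated.
      p^2s∣ : p ^ (s + s) ∣ p ^ f * ℤ.∣ K ∣
      p^2s∣ = ∣-trans (^-∣ p (subst (_≤ f + (2 * s ∸ f)) (cong (λ z → s + z) (ℕP.+-identityʳ s)) (ℕP.m≤n+m∸n (2 * s) f)))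
        (subst (_∣ p ^ f * ℤ.∣ K ∣) (sym (ℕP.^-distribˡ-+-* p f (2 * s ∸ f))) (*-monoʳ-∣ (p ^ f) (K-div s p^s∣g)))
      p^f*|K|*a²∈ : Loc p ((ιℕ (p ^ f) ⊗ ιℕ ℤ.∣ K ∣) ⊗ (a ⊗ a))
      p^f*|K|*a²∈ = subst (Loc p) eq (Loc-* pp (Loc-ℕ pp c) (Loc-* pp p^s*a∈ p^s*a∈))
        where
        open ≡-Reasoning
        c : ℕ
        c = quotient p^2s∣
        eq : ιℕ c ⊗ ((ιℕ (p ^ s) ⊗ a) ⊗ (ιℕ (p ^ s) ⊗ a)) ≡ (ιℕ (p ^ f) ⊗ ιℕ ℤ.∣ K ∣) ⊗ (a ⊗ a)
        eq = begin
          ιℕ c ⊗ ((ιℕ (p ^ s) ⊗ a) ⊗ (ιℕ (p ^ s) ⊗ a))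
            ≡⟨ solve 3 (λ c q a → c :* ((q :* a) :* (q :* a)) := (c :* (q :* q)) :* (a :* a)) refl (ιℕ c) (ιℕ (p ^ s)) a ⟩
          (ιℕ c ⊗ (ιℕ (p ^ s) ⊗ ιℕ (p ^ s))) ⊗ (a ⊗ a)
            ≡⟨ cong (λ z → (ιℕ c ⊗ z) ⊗ (a ⊗ a)) (trans (sym (ιℕ-* (p ^ s) (p ^ s))) (cong ιℕ (sym (ℕP.^-distribˡ-+-* p s s)))) ⟩
          (ιℕ c ⊗ ιℕ (p ^ (s + s))) ⊗ (a ⊗ a)
            ≡⟨ cong (_⊗ (a ⊗ a)) (trans (sym (ιℕ-* c (p ^ (s + s)))) (trans (cong ιℕ (sym (m∣n⇒n≡quotient*m p^2s∣))) (ιℕ-* (p ^ f) ℤ.∣ K ∣))) ⟩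
          (ιℕ (p ^ f) ⊗ ιℕ ℤ.∣ K ∣) ⊗ (a ⊗ a) ∎
      p^f*K*a²∈ : ∀ L → Loc p ((ιℕ (p ^ f) ⊗ ιℕ ℤ.∣ L ∣) ⊗ (a ⊗ a)) → Loc p ((ιℕ (p ^ f) ⊗ ιℤ L) ⊗ (a ⊗ a))
      p^f*K*a²∈ (+ n)      l = l
      p^f*K*a²∈ ℤ.-[1+ n ] l = subst (Loc p)
        (trans (solve 3 (λ q k a → :- ((q :* k) :* a) := (q :* (:- k)) :* a) refl (ιℕ (p ^ f)) (ιℕ (suc n)) (a ⊗ a))
          (cong (λ z → (ιℕ (p ^ f) ⊗ z) ⊗ (a ⊗ a)) (sym (ιℤ-neg (+ suc n))))) (Loc-neg pp l)
      p^f*A²∈M : M 1 (ιℕ (p ^ f) ⊗ (A ⊗ A))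
      p^f*A²∈M = filt (subst (Loc p) eq (p^f*K*a²∈ K p^f*|K|*a²∈))
        where
        open ≡-Reasoning
        eq : (ιℕ (p ^ f) ⊗ ιℤ K) ⊗ (a ⊗ a) ≡ (ιℕ (p ^ f) ⊗ (A ⊗ A)) ⊗ (κ ⊗ 1ℚ)
        eq = begin
          (ιℕ (p ^ f) ⊗ ιℤ K) ⊗ ((A ⊗ κ) ⊗ (A ⊗ κ))
            ≡⟨ solve 4 (λ q k a r → (q :* k) :* ((a :* r) :* (a :* r)) := (k :* r) :* ((q :* (a :* a)) :* r)) refl (ιℕ (p ^ f)) (ιℤ K) A κ ⟩
          (ιℤ K ⊗ κ) ⊗ ((ιℕ (p ^ f) ⊗ (A ⊗ A)) ⊗ κ)    ≡⟨ cong (_⊗ ((ιℕ (p ^ f) ⊗ (A ⊗ A)) ⊗ κ)) K⊗κ ⟩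
          1ℚ ⊗ ((ιℕ (p ^ f) ⊗ (A ⊗ A)) ⊗ κ)            ≡⟨ ℚP.*-identityˡ _ ⟩
          (ιℕ (p ^ f) ⊗ (A ⊗ A)) ⊗ κ                   ≡⟨ cong ((ιℕ (p ^ f) ⊗ (A ⊗ A)) ⊗_) (ℚP.*-identityʳ κ) ⟨
          (ιℕ (p ^ f) ⊗ (A ⊗ A)) ⊗ (κ ⊗ 1ℚ)            ∎
      fact∈ : ∀ d → d ≤ N → M ⌈ d /2⌉ (ιℕ (p ^ e) ⊗ (ιℕ (d !) ⊗ (A ^ℚ d)))
      fact∈ d d≤N = subst (M ⌈ d /2⌉) (sym (proj₂ factor (A ^ℚ d)))
        (M-Loc (Loc-ℕ pp (proj₁ factor))
          (power∈M pp K⊗κ K∈ {A} {ιℕ (p ^ g)} {ιℕ (p ^ f)} (Loc-ℕ pp (p ^ g)) p^g*A∈M p^f*A²∈M d))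
        where
        div : p ^ g * p ^ (f * ⌊ d /2⌋) ∣ p ^ e * d !
        div = subst (p ^ g * p ^ (f * ⌊ d /2⌋) ∣_)
          (trans (ℕS.+-*-Solver.solve 3 (λ x y z → x ℕ:* (y ℕ:* z) ℕ:= (x ℕ:* z) ℕ:* y) refl (p ^ g) (d !) (p ^ suc ⌊log₂ N ⌋))
            (cong (_* d !) (sym (ℕP.^-distribˡ-+-* p g (suc ⌊log₂ N ⌋)))))
          (*-monoʳ-∣ (p ^ g) (∣-trans (fact d) (*-monoʳ-∣ (d !) (^-∣ p (s≤s (⌊log₂⌋-mono-≤ d≤N))))))
          where open ℕS.+-*-Solver using () renaming (_:*_ to _ℕ:*_; _:=_ to _ℕ:=_)
        factor : ∃ λ x → ∀ y → ιℕ (p ^ e) ⊗ (ιℕ (d !) ⊗ y) ≡ ιℕ x ⊗ ((ιℕ (p ^ g) ⊗ (ιℕ (p ^ f) ^ℚ ⌊ d /2⌋)) ⊗ y)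
        factor = ιℕ-∣-factor (p ^ g) p (p ^ e) (d !) f ⌊ d /2⌋ div

-- From single primes to the theorem.

-- All of 2, 3, 4, 6 divide 12, so the primes dividing g are among the two for which a factorial
-- estimate is at hand.
prime∣12 : ∀ {p} → Prime p → p ∣ 12 → p ≡ 2 ⊎ p ≡ 3
prime∣12 {p} pp p∣12 = [ (λ h → inj₁ (prime∣prime⇒≡ pp prime[2] h)) , six ]′ (euclidsLemma 2 6 pp p∣12)
  where
  prime[3] : Prime 3
  prime[3] = from-yes (prime? 3)
  six : p ∣ 6 → p ≡ 2 ⊎ p ≡ 3
  six h = [ (λ h → inj₁ (prime∣prime⇒≡ pp prime[2] h)) , (λ h → inj₂ (prime∣prime⇒≡ pp prime[3] h)) ]′ (euclidsLemma 2 3 pp h)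

private
  2≤D∧D∣12 : ∀ {D} → D ≡ 2 ⊎ D ≡ 3 ⊎ D ≡ 4 ⊎ D ≡ 6 → 2 ≤ D × D ∣ 12
  2≤D∧D∣12 (inj₁ refl)               = s≤s (s≤s z≤n) , divides 6 refl
  2≤D∧D∣12 (inj₂ (inj₁ refl))        = s≤s (s≤s z≤n) , divides 4 refl
  2≤D∧D∣12 (inj₂ (inj₂ (inj₁ refl))) = s≤s (s≤s z≤n) , divides 3 refl
  2≤D∧D∣12 (inj₂ (inj₂ (inj₂ refl))) = s≤s (s≤s z≤n) , divides 2 refl

  -- From n = 2 on the logarithm is at least 1 and absorbs the constant g + 1; at n = 1 it vanishes,
  -- hence the threshold.
  log-bound : ∀ g n → 2 ≤ n → g + suc ⌊log₂ n ⌋ ≤ (2 + g) * ⌊log₂ n ⌋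
  log-bound g n 2≤n = begin
    g + suc L            ≤⟨ ℕP.+-mono-≤ (ℕP.m≤m*n g L {{ℕ.>-nonZero 1≤L}}) (ℕP.+-monoˡ-≤ L 1≤L) ⟩
    g * L + (L + L)      ≡⟨ ℕP.+-comm (g * L) (L + L) ⟩
    L + L + g * L        ≡⟨ ℕP.+-assoc L L (g * L) ⟩
    (2 + g) * L          ∎
    where
    open ℕP.≤-Reasoning
    L : ℕ
    L = ⌊log₂ n ⌋
    1≤L : 1 ≤ L
    1≤L = subst (_≤ L) (⌊log₂[2^n]⌋≡n 1) (⌊log₂⌋-mono-≤ 2≤n)

  Loc-scale : ∀ {p} → Prime p → ∀ P δ k w → Loc p ((δ ⊗ k) ⊗ w) → Loc p (((ιℕ P ⊗ δ) ⊗ k) ⊗ w)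
  Loc-scale {p} pp P δ k w l = subst (Loc p)
    (solve 4 (λ c δ k w → c :* ((δ :* k) :* w) := ((c :* δ) :* k) :* w) refl (ιℕ P) δ k w)
    (Loc-* pp (Loc-ℕ pp P) l)

  Loc-multiple : ∀ {p} → Prime p → ∀ {P Q} → P ∣ Q → ∀ δ k w →
    Loc p (((ιℕ P ⊗ δ) ⊗ k) ⊗ w) → Loc p (((ιℕ Q ⊗ δ) ⊗ k) ⊗ w)
  Loc-multiple {p} pp {P} {Q} P∣Q δ k w l = subst (Loc p)
    (trans (solve 5 (λ c x δ k w → c :* (((x :* δ) :* k) :* w) := (((c :* x) :* δ) :* k) :* w) refl (ιℕ (quotient P∣Q)) (ιℕ P) δ k w)
      (cong (λ z → ((z ⊗ δ) ⊗ k) ⊗ w) (trans (sym (ιℕ-* (quotient P∣Q) P)) (cong ιℕ (sym (m∣n⇒n≡quotient*m P∣Q))))))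
    (Loc-* pp (Loc-ℕ pp (quotient P∣Q)) l)

theorem8p2 : (D : ℕ) .{{_ : NonZero D}} → (D ≡ 2 ⊎ D ≡ 3 ⊎ D ≡ 4 ⊎ D ≡ 6) →
    (A : ℚ) (K : ℤ) (K≢0 : K ≢ 0ℤ) (v : ℕ → ℚ) →
    IsInt (v 0) → IsInt (v 1) →
    (∀ n → 1 ≤ n →
    ℚ._*_ (ιℕ (D * n + 1)) (v (suc n))
    ≡ ℚ._-_ (ℚ._*_ (ℚ._*_ A (ιℕ n)) (v n))
    (ℚ._*_ (ℚ._*_ (ιℤ K) (ℚ._-_ (ιℕ (D * n)) 1ℚ)) (v (n ∸ 1)))) →
    ((IsInt (ℚ._*_ A (invℤ K K≢0)) →
    ∀ n → 1 ≤ n →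
    IsInt (ℚ._*_ (ℚ._*_ (dStar D n) (invℤ K K≢0 ^ℚ (suc n / 2))) (v (suc n))))
    × ((∀ p → Prime p → p ∣ ↧ₙ (ℚ._*_ A (invℤ K K≢0)) → p ∣ D) →
    (∀ k → 2 ^ k ∣ ↧ₙ (ℚ._*_ A (invℤ K K≢0)) → 2 ^ (2 * k ∸ 2) ∣ ℤ.∣ K ∣) →
    (∀ p k → Prime p → 3 ≤ p → p ^ k ∣ ↧ₙ (ℚ._*_ A (invℤ K K≢0)) → p ^ (2 * k ∸ 1) ∣ ℤ.∣ K ∣) →
    ∃ λ (e : ℕ → ℕ → ℕ) →
    (∀ p → Prime p → p ∣ ↧ₙ (ℚ._*_ A (invℤ K K≢0)) →
    ∃₂ λ (C N : ℕ) → ∀ n → N ≤ n → e p n ≤ C * ⌊log₂ n ⌋)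
    × (∀ n → 1 ≤ n →
    IsInt (ℚ._*_ (ℚ._*_ (ℚ._*_ (ιℕ (primeDivProd (↧ₙ (ℚ._*_ A (invℤ K K≢0))) (λ p → e p n)))
    (dStar D n))
    (invℤ K K≢0 ^ℚ (suc n / 2)))
    (v (suc n))))))
theorem8p2 D D∈ A K K≢0 v v₀∈ℤ v₁∈ℤ rec = part-i , part-ii
  where
  2≤D : 2 ≤ D
  2≤D = let h , _ = 2≤D∧D∣12 D∈ in h
  D∣12 : D ∣ 12
  D∣12 = let _ , h = 2≤D∧D∣12 D∈ in h
  κ : ℚ
  κ = invℤ K K≢0
  K⊗κ : ιℤ K ⊗ κ ≡ 1ℚ
  K⊗κ = ℚP.*-inverseʳ (ιℤ K) {{ιℤ-nonZero K K≢0}}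
  g : ℕ
  g = ↧ₙ (A ⊗ κ)
  Value : ℚ → ℕ → ℚ
  Value δ n = (δ ⊗ (κ ^ℚ (suc n / 2))) ⊗ v (suc n)

  part-i : IsInt (A ⊗ κ) → ∀ n → 1 ≤ n → IsInt (Value (dStar D n) n)
  part-i a∈ℤ n _ = Loc⇒IsInt (Value (dStar D n) n)
    (λ p pp → regular D 2≤D A K κ K⊗κ v v₀∈ℤ v₁∈ℤ rec pp n (IsInt⇒Loc pp a∈ℤ))

  part-ii : (∀ p → Prime p → p ∣ g → p ∣ D) →
    (∀ k → 2 ^ k ∣ g → 2 ^ (2 * k ∸ 2) ∣ ℤ.∣ K ∣) →
    (∀ p k → Prime p → 3 ≤ p → p ^ k ∣ g → p ^ (2 * k ∸ 1) ∣ ℤ.∣ K ∣) →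
    ∃ λ (e : ℕ → ℕ → ℕ) →
      (∀ p → Prime p → p ∣ g → ∃₂ λ (C N : ℕ) → ∀ n → N ≤ n → e p n ≤ C * ⌊log₂ n ⌋)
      × (∀ n → 1 ≤ n → IsInt (Value (ιℕ (primeDivProd g (λ p → e p n)) ⊗ dStar D n) n))
  part-ii rad-g v₂ v₃ = e , (λ p _ _ → 2 + g , 2 , log-bound g) , integral
    where
    e : ℕ → ℕ → ℕ
    e p n = g + suc ⌊log₂ n ⌋
    integral : ∀ n → 1 ≤ n → IsInt (Value (ιℕ (primeDivProd g (λ p → e p n)) ⊗ dStar D n) n)
    integral n _ = Loc⇒IsInt (Value (ιℕ P ⊗ dStar D n) n) (λ p pp → local pp (p ∣? g))
      where
      P : ℕ
      P = primeDivProd g (λ p → e p n)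
      at-2-or-3 : ∀ {p} → Prime p → p ∣ g → p ≡ 2 ⊎ p ≡ 3 → Loc p (Value (ιℕ (p ^ e p n) ⊗ dStar D n) n)
      at-2-or-3 pp p∣g (inj₁ refl) = singular D 2≤D A K κ K⊗κ v v₀∈ℤ v₁∈ℤ rec pp n
        g (ℚ.↥ (A ⊗ κ)) (ιℤ[↧]*q≡ιℤ[↥] (A ⊗ κ)) 2 2-adic-! (rad-g 2 pp p∣g) v₂
      at-2-or-3 pp p∣g (inj₂ refl) = singular D 2≤D A K κ K⊗κ v v₀∈ℤ v₁∈ℤ rec pp n
        g (ℚ.↥ (A ⊗ κ)) (ιℤ[↧]*q≡ιℤ[↥] (A ⊗ κ)) 1 3-adic-! (rad-g 3 pp p∣g) (λ s → v₃ 3 s pp ℕP.≤-refl)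
      local : ∀ {p} → Prime p → Dec (p ∣ g) → Loc p (Value (ιℕ P ⊗ dStar D n) n)
      -- Here A/K is integral at p, so the argument of part (i) applies, and P is only an additional
      -- integer factor.
      local pp (no p∤g)  = Loc-scale pp P (dStar D n) (κ ^ℚ (suc n / 2)) (v (suc n))
        (regular D 2≤D A K κ K⊗κ v v₀∈ℤ v₁∈ℤ rec pp n (∤↧⇒Loc pp (A ⊗ κ) p∤g))
      local {p} pp (yes p∣g) = Loc-multiple pp (p^e∣primeDivProd g (λ p → e p n) pp p∣g)
        (dStar D n) (κ ^ℚ (suc n / 2)) (v (suc n))
        (at-2-or-3 pp p∣g (prime∣12 pp (∣-trans (rad-g p pp p∣g) D∣12)))
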